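{- Let $W$ be a finite irreducible Coxeter group with Coxeter number $h$, and let $L$ be a lattice quotient of $\mathrm{Weak}(W)$. Then $\max_{x\in L}|\mathcal O_L(x)|\le h$.
   Context: $\mathrm{Weak}(W)$ is the (right) weak order on $W$: $u\le v$ iff every left inversion of $u$ (reflection $t$ with $\ell(tu)<\ell(u)$) is one of $v$. The Coxeter number $h$ is the order of a Coxeter element (product of all simple reflections, each once). A lattice quotient of a lattice $M$ is a lattice $L$ admitting a surjective lattice homomorphism $M\to L$. For a finite lattice $L$, $\mathrm{pop}^{\downarrow}_L(x)=x\wedge\bigwedge\{y\mid y\lessdot x\}$, and $\mathcal O_L(x)=\{x,\mathrm{pop}^{\downarrow}_L(x),(\mathrm{pop}^{\downarrow}_L)^2(x),\dots\}$ is the forward orbit of $x$. -}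

module Defs where

open import Level using (0ℓ)
open import Data.Nat using (ℕ; zero; suc; _<_; _≤_)
open import Data.Fin using (Fin)
open import Data.Bool using (Bool; true; false)
open import Data.List using (List; []; _∷_; foldr; length; allFin)
open import Data.List.Membership.Propositional using (_∈_)
open import Data.Product using (Σ; ∃; ∃-syntax; _×_; _,_)
open import Data.Sum using (_⊎_)
open import Relation.Nullary using (¬_)
open import Relation.Binary.PropositionalEquality using (_≡_; _≢_)
open import Algebra.Structures using (IsGroup)
open import Algebra.Bundles using (Group)
open import Relation.Binary.Structures using (IsPartialOrder)
open import Relation.Binary.Lattice.Structures using (IsLattice)
open import Function.Definitions using (Injective)

pow : {A : Set} → (A → A → A) → A → A → ℕ → A
pow _·_ e c zero    = e
pow _·_ e c (suc k) = c · pow _·_ e c k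

-- Finite Coxeter systems (W, S), S = {s_0,...,s_{n-1}}, given by the
-- Coxeter presentation  < S | (s_i s_j)^{m i j} = 1 >  (universal property).
-- Since W is finite all m i j are finite natural numbers.

record FiniteCoxeterSystem : Set₁ where
  field
    W       : Set
    _·_     : W → W → W
    e       : W
    _⁻¹     : W → W
    isGroup : IsGroup _≡_ _·_ e _⁻¹
    elemsW  : List W
    allW    : ∀ w → w ∈ elemsW
    rank    : ℕ
    gen     : Fin rank → W
    m       : Fin rank → Fin rank → ℕ
    m-diag  : ∀ i → m i i ≡ 1
    m-sym   : ∀ i j → m i j ≡ m j i
    m-off   : ∀ i j → i ≢ j → 2 ≤ m i j
    relations : ∀ i j → pow _·_ e (gen i · gen j) (m i j) ≡ e

  prod : List (Fin rank) → W
  prod = foldr (λ i w → gen i · w) e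

  field
    generated : ∀ w → ∃[ ws ] prod ws ≡ w
    universal : (G : Group 0ℓ 0ℓ) (g : Fin rank → Group.Carrier G) →
      (∀ i j → Group._≈_ G (pow (Group._∙_ G) (Group.ε G) (Group._∙_ G (g i) (g j)) (m i j)) (Group.ε G)) →
      Σ (W → Group.Carrier G) λ φ →
        (∀ a b → Group._≈_ G (φ (a · b)) (Group._∙_ G (φ a) (φ b))) ×
        (∀ i → Group._≈_ G (φ (gen i)) (g i))

module Coxeter (C : FiniteCoxeterSystem) where
  open FiniteCoxeterSystem C

  HasLength : W → ℕ → Set
  HasLength w k = (∃[ ws ] (prod ws ≡ w × length ws ≡ k)) ×
                  (∀ ws → prod ws ≡ w → k ≤ length ws)

  IsReflection : W → Set
  IsReflection t = ∃[ w ] ∃[ i ] t ≡ (w · gen i) · (w ⁻¹)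

  LeftInversion : W → W → Set
  LeftInversion u t = IsReflection t ×
    ∃[ k ] ∃[ l ] (HasLength (t · u) k × HasLength u l × k < l)

  _≤w_ : W → W → Set
  u ≤w v = ∀ t → LeftInversion u t → LeftInversion v t

  IsMeetW : W → W → W → Set
  IsMeetW u v z = z ≤w u × z ≤w v × (∀ y → y ≤w u → y ≤w v → y ≤w z)

  IsJoinW : W → W → W → Set
  IsJoinW u v z = u ≤w z × v ≤w z × (∀ y → u ≤w y → v ≤w y → z ≤w y)

  -- irreducible: rank ≥ 1 and S admits no partition into two nonempty
  -- mutually commuting parts (Coxeter graph connected)
  Irreducible : Set
  Irreducible = (1 ≤ rank) ×
    ¬ (Σ (Fin rank → Bool) λ P →
         (∃[ i ] P i ≡ true) × (∃[ j ] P j ≡ false) ×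
         (∀ i j → P i ≡ true → P j ≡ false → gen i · gen j ≡ gen j · gen i))

  coxeterElement : W
  coxeterElement = prod (allFin rank)

  IsOrder : W → ℕ → Set
  IsOrder c h = (1 ≤ h) × (pow _·_ e c h ≡ e) ×
                (∀ k → 1 ≤ k → pow _·_ e c k ≡ e → h ≤ k)

  CoxeterNumber : ℕ → Set
  CoxeterNumber h = IsOrder coxeterElement h

record FiniteLattice : Set₁ where
  field
    Carrier   : Set
    _⊑_       : Carrier → Carrier → Set
    _⊔_       : Carrier → Carrier → Carrier
    _⊓_       : Carrier → Carrier → Carrier
    isLattice : IsLattice _≡_ _⊑_ _⊔_ _⊓_
    elems     : List Carrier
    allElems  : ∀ x → x ∈ elems

module LatticeOps (L : FiniteLattice) where
  open FiniteLattice L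

  _⋖_ : Carrier → Carrier → Set
  y ⋖ x = y ⊑ x × y ≢ x × (∀ z → y ⊑ z → z ⊑ x → z ≡ y ⊎ z ≡ x)

  IsPop : Carrier → Carrier → Set
  IsPop x p = p ⊑ x × (∀ y → y ⋖ x → p ⊑ y) ×
              (∀ q → q ⊑ x → (∀ y → y ⋖ x → q ⊑ y) → q ⊑ p)

  data InOrbit (x : Carrier) : Carrier → Set where
    here : InOrbit x x
    next : ∀ {z p} → InOrbit x z → IsPop z p → InOrbit x p

  OrbitSizeAtMost : Carrier → ℕ → Set
  OrbitSizeAtMost x h = ∀ k (g : Fin k → Carrier) →
    Injective _≡_ _≡_ g → (∀ i → InOrbit x (g i)) → k ≤ h

IsLatticeQuotientMap : (C : FiniteCoxeterSystem) (L : FiniteLattice) →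
  (FiniteCoxeterSystem.W C → FiniteLattice.Carrier L) → Set
IsLatticeQuotientMap C L f =
  (∀ x → ∃[ w ] f w ≡ x) ×
  (∀ u v z → IsMeetW u v z → f z ≡ f u ⊓ f v) ×
  (∀ u v z → IsJoinW u v z → f z ≡ f u ⊔ f v)
  where open Coxeter C
        open FiniteLattice L

{-# OPTIONS --safe #-}

-- Identify x in the quotient with the least element w of its fibre. The images of the elements
-- covered by w are covered by x, so one step of pop replaces w by an element below all elements
-- that w covers. Let S be split into two commuting parts with products a and b. By the exchange
-- property, if w is the product of a subword of a word ending in the letters of a, then after one
-- step those letters are no longer needed. So it suffices to see that every element is the product
-- of a subword of both alternating words a b a … and b a b … with h layers: after h - 1 steps what
-- is left is a subword of a as well as of b, hence trivial.
--
-- The Coxeter element is conjugate to ab, because the noncommutation graph is a forest: a walk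
-- without backtracking spells a reduced word. So (ab)ʰ = 1, whence the alternating words with h
-- layers have the same product; if both are reduced, then all generators are left descents of it
-- and it is the longest element. Otherwise consider the first k for which an alternating word x
-- with k layers cannot be extended by a further layer. Then x sᵢ = sⱼ x for some generators, and
-- comparing the lengths of x r = r′ x, where r and r′ are the conjugates of sᵢ and sⱼ by the
-- products of their neighbours, shows that all neighbours of sⱼ are left descents of x and that
-- they are again intertwined by alternating words. By irreducibility x is the longest element.

module Submission where

open import Defs
open import Level using (0ℓ)
open import Algebra.Bundles using (Group)
open import Algebra.Structures using (IsGroup)
open import Data.Bool using (Bool; true; false; _xor_; not; if_then_else_)
import Data.Bool.Properties as Bool
open import Data.Empty using (⊥; ⊥-elim)
open import Data.Fin using (Fin; fromℕ<)
import Data.Fin as F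
import Data.Fin.Properties as Fin
open import Data.List using (List; []; _∷_; _++_; length; filter; foldr; allFin; lookup; reverse; [_])
import Data.List.Properties as List
import Data.List.Membership.DecPropositional as DecMembership
open import Data.List.Membership.Propositional using (_∈_)
open import Data.List.Membership.Propositional.Properties using (∈-filter⁺; ∈-filter⁻; ∈-allFin)
open import Data.List.Relation.Binary.Sublist.Propositional using (_⊆_; []; _∷ʳ_; _∷_; ⊆-refl; ⊆-trans)
open import Data.List.Relation.Binary.Sublist.Propositional.Properties using (All-resp-⊆)
open import Data.List.Relation.Unary.All as All using (All; []; _∷_)
import Data.List.Relation.Unary.All.Properties as All
open import Data.List.Relation.Unary.AllPairs using (AllPairs; []; _∷_)
import Data.List.Relation.Unary.AllPairs.Properties as AllPairs
open import Data.List.Relation.Unary.Any as Any using (here; there; index)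
open import Data.List.Relation.Unary.Any.Properties using (lookup-index)
open import Data.List.Relation.Unary.Unique.Propositional using (Unique; []; _∷_)
import Data.List.Relation.Unary.Unique.Propositional.Properties as Unique
open import Data.Nat using (ℕ; zero; suc; pred; _≤_; _<_; z≤n; s≤s; s≤s⁻¹) renaming (_+_ to _+ℕ_; _⊓_ to _⊓ℕ_; _⊔_ to _⊔ℕ_)
import Data.Nat.Properties as ℕ
open import Data.Product using (∃-syntax; _×_; _,_; proj₁; proj₂)
open import Data.Sum using (_⊎_; inj₁; inj₂)
open import Data.Unit using (⊤; tt)
open import Function using (_∘_)
open import Relation.Binary using (DecidableEquality)
open import Relation.Binary.Definitions using (tri<; tri≈; tri>)
open import Relation.Binary.Lattice.Structures using (IsLattice)
open import Relation.Binary.PropositionalEquality hiding ([_]; _≗_)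
open import Relation.Nullary using (Dec; yes; no; ¬_; ¬?; does)
open import Relation.Nullary.Decidable using (map′; _×-dec_; _⊎-dec_; decidable-stable; dec-true; dec-false)

-- The group is known only through its presentation, so every fact about it has to come from a
-- homomorphism out of `W`. Inversions, lengths and the exchange property come from a cocycle with
-- values in the functions `W → Bool`. That cocycle is defined through equality in `W`, so it cannot
-- rule out that two generators coincide; this is why `Distinct` builds a second representation,
-- over the integers, so that no real cosines occur. The usual proof that alternating words with h
-- layers reach the longest element uses a positive eigenvector of the Coxeter graph. Here it is
-- replaced by a comparison of the palindromes `star i`: an intertwined pair yields an inequality
-- between two of their lengths, and since being intertwined is symmetric, the inequality is an
-- equality. The outcome is a number n ≤ h of layers that suffice, which is what the orbit count
-- asks for.

enumerated⇒≟ : {A : Set} (xs : List A) → (∀ x → x ∈ xs) → DecidableEquality A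
enumerated⇒≟ xs all x y = map′ from (cong (λ z → index (all z))) (index (all x) Fin.≟ index (all y))
  where
  from : index (all x) ≡ index (all y) → x ≡ y
  from eq = trans (lookup-index (all x)) (trans (cong (lookup xs) eq) (sym (lookup-index (all y))))

-- A discrete wave equation with odd period

module WaveEquation where

  open import Data.Integer using (ℤ; -_; _+_; 0ℤ)
  import Data.Integer.Properties as ℤ
  open import Data.Integer.Solver using (module +-*-Solver)
  open import Data.Nat using (_%_; _/_) renaming (_*_ to _*ℕ_)
  open import Data.Nat.DivMod using (m%n<n; m≡m%n+[m/n]*n; [m+kn]%n≡m%n; m<n⇒m%n≡m; n%n≡0)
  open +-*-Solver using (solve; _:+_; _:=_; :-_; con)

  Fn : Set
  Fn = ℕ → ℤ

  record Linear (a : Fn → Fn) : Set where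
    field
      ≗-cong : ∀ {f g} → (∀ x → f x ≡ g x) → ∀ x → a f x ≡ a g x
      +-hom  : ∀ f g x → a (λ y → f y + g y) x ≡ a f x + a g x
      neg-hom : ∀ f x → a (λ y → - f y) x ≡ - a f x

    0-hom : ∀ x → a (λ _ → 0ℤ) x ≡ 0ℤ
    0-hom x = trans (+-hom (λ _ → 0ℤ) (λ _ → - 0ℤ) x)
      (trans (cong (a (λ _ → 0ℤ) x +_) (neg-hom (λ _ → 0ℤ) x)) (ℤ.+-inverseʳ (a (λ _ → 0ℤ) x)))

  sum : (ℕ → Fn) → ℕ → Fn
  sum u zero    x = 0ℤ
  sum u (suc n) x = u 0 x + sum (λ j → u (suc j)) n x

  sum-snoc : ∀ u n x → sum u (suc n) x ≡ sum u n x + u n x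
  sum-snoc u zero    x = ℤ.+-comm (u 0 x) 0ℤ
  sum-snoc u (suc n) x = trans (cong (u 0 x +_) (sum-snoc (λ j → u (suc j)) n x)) (sym (ℤ.+-assoc (u 0 x) _ _))

  double odd : ℕ → ℕ
  double zero    = zero
  double (suc r) = suc (suc (double r))
  odd r = suc (double r)

  module Wave (p : ℕ) where

    q : ℕ
    q = suc p

    -- On each block {tq, …, tq + p} the operator τ is f(s - 1) + f(s + 1) with the boundary
    -- conditions f(-1) = - f(0) and f(q) = 0. Its eigenvalues are of the form 2 cos (2πk / (2q + 1)).
    left right τ : Fn → Fn
    left  f x = if does (x % q ℕ.≟ 0) then - f x else f (pred x)
    right f x = if does (suc x % q ℕ.≟ 0) then 0ℤ else f (suc x)
    τ f x = left f x + right f x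

    τ-linear : Linear τ
    τ-linear = record { ≗-cong = pointwise ; +-hom = add ; neg-hom = neg }
      where
      pointwise : ∀ {f g} → (∀ x → f x ≡ g x) → ∀ x → τ f x ≡ τ g x
      pointwise eq x with does (x % q ℕ.≟ 0) | does (suc x % q ℕ.≟ 0)
      ... | true  | true  = cong (λ z → - z + 0ℤ) (eq x)
      ... | true  | false = cong₂ (λ y z → - y + z) (eq x) (eq (suc x))
      ... | false | true  = cong (_+ 0ℤ) (eq (pred x))
      ... | false | false = cong₂ _+_ (eq (pred x)) (eq (suc x))
      add : ∀ f g x → τ (λ y → f y + g y) x ≡ τ f x + τ g x
      add f g x with does (x % q ℕ.≟ 0) | does (suc x % q ℕ.≟ 0)
      ... | true  | true  = solve 2 (λ a b → (:- (a :+ b)) :+ con 0ℤ := ((:- a) :+ con 0ℤ) :+ ((:- b) :+ con 0ℤ)) refl (f x) (g x)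
      ... | true  | false = solve 4 (λ a b c d → (:- (a :+ b)) :+ (c :+ d) := ((:- a) :+ c) :+ ((:- b) :+ d)) refl (f x) (g x) (f (suc x)) (g (suc x))
      ... | false | true  = solve 2 (λ a b → (a :+ b) :+ con 0ℤ := (a :+ con 0ℤ) :+ (b :+ con 0ℤ)) refl (f (pred x)) (g (pred x))
      ... | false | false = solve 4 (λ a b c d → (a :+ b) :+ (c :+ d) := (a :+ c) :+ (b :+ d)) refl (f (pred x)) (g (pred x)) (f (suc x)) (g (suc x))
      neg : ∀ f x → τ (λ y → - f y) x ≡ - τ f x
      neg f x with does (x % q ℕ.≟ 0) | does (suc x % q ℕ.≟ 0)
      ... | true  | true  = solve 1 (λ a → (:- (:- a)) :+ con 0ℤ := :- ((:- a) :+ con 0ℤ)) refl (f x)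
      ... | true  | false = solve 2 (λ a c → (:- (:- a)) :+ (:- c) := :- ((:- a) :+ c)) refl (f x) (f (suc x))
      ... | false | true  = solve 1 (λ a → (:- a) :+ con 0ℤ := :- (a :+ con 0ℤ)) refl (f (pred x))
      ... | false | false = solve 2 (λ a c → (:- a) :+ (:- c) := :- (a :+ c)) refl (f (pred x)) (f (suc x))

    open Linear τ-linear

    Rec : (ℕ → Fn) → Set
    Rec u = ∀ j x → u (suc (suc j)) x + u j x ≡ τ (u (suc j)) x

    sum-Rec : ∀ u → Rec u → ∀ n x → sum (λ j → u (suc (suc j))) n x + sum u n x ≡ τ (sum (λ j → u (suc j)) n) x
    sum-Rec u rec zero    x = sym (0-hom x)
    sum-Rec u rec (suc n) x = trans
      (solve 4 (λ a b c d → (a :+ b) :+ (c :+ d) := (a :+ c) :+ (b :+ d)) refl (u 2 x) (sum (λ j → u (3 +ℕ j)) n x) (u 0 x) (sum (λ j → u (suc j)) n x))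
      (trans (cong₂ _+_ (rec 0 x) (sum-Rec (λ j → u (suc j)) (λ j → rec (suc j)) n x))
        (sym (+-hom (u 1) (sum (λ j → u (suc (suc j))) n) x)))

    private
      module Block (t : ℕ) where
        -- Extension by zero beyond the block, so that the boundary condition at `q` needs no
        -- separate case.
        val : Fn → ℕ → ℤ
        val f s = if does (s ℕ.<? q) then f (s +ℕ t *ℕ q) else 0ℤ

        val-< : ∀ f s → s < q → val f s ≡ f (s +ℕ t *ℕ q)
        val-< f s s<q = cong (if_then f (s +ℕ t *ℕ q) else 0ℤ) (dec-true (s ℕ.<? q) s<q)

        val-≮ : ∀ f s → ¬ s < q → val f s ≡ 0ℤ
        val-≮ f s s≮q = cong (if_then f (s +ℕ t *ℕ q) else 0ℤ) (dec-false (s ℕ.<? q) s≮q)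

        mod : ∀ s → s < q → (s +ℕ t *ℕ q) % q ≡ s
        mod s s<q = trans ([m+kn]%n≡m%n s t q) (m<n⇒m%n≡m s<q)

        right-val : ∀ f s → s < q → right f (s +ℕ t *ℕ q) ≡ val f (suc s)
        right-val f s s<q with suc s ℕ.<? q
        ... | yes ss<q = trans (cong (if_then 0ℤ else f (suc s +ℕ t *ℕ q))
                           (dec-false (_ ℕ.≟ 0) (λ eq → ℕ.0≢1+n (trans (sym eq) (mod (suc s) ss<q))))) (sym (val-< f (suc s) ss<q))
        ... | no  ss≮q = trans (cong (if_then 0ℤ else f (suc s +ℕ t *ℕ q))
                           (dec-true (_ ℕ.≟ 0) (trans ([m+kn]%n≡m%n (suc s) t q)
                             (trans (cong (_% q) (ℕ.≤-antisym s<q (ℕ.≮⇒≥ ss≮q))) (n%n≡0 q))))) (sym (val-≮ f (suc s) ss≮q))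

        τ-0 : ∀ f → τ f (t *ℕ q) ≡ - val f 0 + val f 1
        τ-0 f = cong₂ _+_
          (trans (cong (if_then - f (t *ℕ q) else f (pred (t *ℕ q))) (dec-true (_ ℕ.≟ 0) (mod 0 (s≤s z≤n)))) (cong -_ (sym (val-< f 0 (s≤s z≤n)))))
          (right-val f 0 (s≤s z≤n))

        τ-suc : ∀ f s → suc s < q → τ f (suc s +ℕ t *ℕ q) ≡ val f s + val f (suc (suc s))
        τ-suc f s ss<q = cong₂ _+_
          (trans (cong (if_then - f (suc s +ℕ t *ℕ q) else f (s +ℕ t *ℕ q)) (dec-false (_ ℕ.≟ 0) (λ eq → ℕ.0≢1+n (trans (sym eq) (mod (suc s) ss<q)))))
                 (sym (val-< f s (ℕ.<-trans (ℕ.n<1+n s) ss<q))))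
          (right-val f (suc s) ss<q)

        -- Both sides obey one recursion in the radius: the window 0, ..., 2r + 4 and its middle
        -- part 2, ..., 2r + 2 together make up the windows 0, ..., 2r + 2 and 2, ..., 2r + 4, which
        -- on the right is the wave equation at place r + 1. The reflecting boundary enters for
        -- radius one. For radius `q` the right side lies outside the block and is zero.
        sum-centre : ∀ r u → Rec u → r ≤ q → sum u (odd r) (t *ℕ q) ≡ val (u r) r
        sum-centre zero u rec _ = trans (ℤ.+-identityʳ _) (sym (val-< (u 0) 0 (s≤s z≤n)))
        sum-centre (suc zero) u rec _ = trans
          (solve 3 (λ a b c → a :+ (b :+ (c :+ con 0ℤ)) := (c :+ a) :+ b) refl (u 0 x) (u 1 x) (u 2 x))
          (trans (cong₂ _+_ (trans (rec 0 x) (τ-0 (u 1))) (sym (val-< (u 1) 0 (s≤s z≤n))))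
            (solve 2 (λ a b → ((:- a) :+ b) :+ a := b) refl (val (u 1) 0) (val (u 1) 1)))
          where x = t *ℕ q
        sum-centre (suc (suc r)) u rec r<q = lemma (u 0 x) (u 1 x) _ _ _ _ _ _
            (sum-centre (suc r) u rec (ℕ.≤-trans (ℕ.n≤1+n _) r<q))
            (sum-centre (suc r) (λ j → u (suc (suc j))) (λ j → rec (suc (suc j))) (ℕ.≤-trans (ℕ.n≤1+n _) r<q))
            (sum-centre r (λ j → u (suc (suc j))) (λ j → rec (suc (suc j))) (ℕ.≤-trans (ℕ.n≤1+n _) (ℕ.≤-trans (ℕ.n≤1+n _) r<q)))
            wave
          where
          x = t *ℕ q
          wave : val (u (3 +ℕ r)) (suc r) + val (u (suc r)) (suc r) ≡ val (u (2 +ℕ r)) r + val (u (2 +ℕ r)) (2 +ℕ r)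
          wave = trans (cong₂ _+_ (val-< (u (3 +ℕ r)) (suc r) r<q) (val-< (u (suc r)) (suc r) r<q))
                       (trans (rec (suc r) (suc r +ℕ t *ℕ q)) (τ-suc (u (2 +ℕ r)) r r<q))
          lemma : ∀ a b s s′ c d f g → a + (b + s) ≡ c → s′ ≡ d → s ≡ f → d + c ≡ f + g → a + (b + s′) ≡ g
          lemma a b s s′ c d f g refl refl refl h = trans
            (solve 4 (λ a b s s′ → a :+ (b :+ s′) := (s′ :+ (a :+ (b :+ s))) :+ (:- s)) refl a b s s′)
            (trans (cong (_+ (- s)) h) (solve 2 (λ s g → (s :+ g) :+ (:- s) := g) refl s g))

        -- The recursion can be run backwards. This is wanted because `τ` of a window is the sum of
        -- the windows starting one step earlier and one step later.
        prepend : (ℕ → Fn) → ℕ → Fn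
        prepend u zero    = λ x → τ (u 0) x + (- u 1 x)
        prepend u (suc j) = u j

        prepend-Rec : ∀ u → Rec u → Rec (prepend u)
        prepend-Rec u rec zero    x = solve 2 (λ a b → a :+ (b :+ (:- a)) := b) refl (u 1 x) (τ (u 0) x)
        prepend-Rec u rec (suc j) x = rec j x

        -- One step backwards in time moves the vanishing of the sums one place further into the block.
        sum-step : ∀ s → (∀ u → Rec u → sum u (odd q) (s +ℕ t *ℕ q) ≡ 0ℤ) → ∀ u → Rec u → τ (sum u (odd q)) (s +ℕ t *ℕ q) ≡ 0ℤ
        sum-step s ih u rec = trans (sym (sum-Rec (prepend u) (prepend-Rec u rec) (odd q) _))
          (cong₂ _+_ (ih (λ j → u (suc j)) (λ j → rec (suc j))) (ih (prepend u) (prepend-Rec u rec)))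

        sum-vanishes : ∀ s → s < q → ∀ u → Rec u → sum u (odd q) (s +ℕ t *ℕ q) ≡ 0ℤ
        sum-vanishes zero _ u rec = trans (sum-centre q u rec ℕ.≤-refl) (val-≮ (u q) q (ℕ.<-irrefl refl))
        sum-vanishes (suc zero) s<q u rec = trans (sym (trans (cong (λ z → - z + val S 1) (trans (val-< S 0 (s≤s z≤n)) (sum-vanishes 0 (s≤s z≤n) u rec)))
            (trans (ℤ.+-identityˡ _) (val-< S 1 s<q))))
          (trans (sym (τ-0 S)) (sum-step 0 (sum-vanishes 0 (s≤s z≤n)) u rec))
          where S = sum u (odd q)
        sum-vanishes (suc (suc s)) s<q u rec = trans (sym (trans (cong (_+ val S (suc (suc s))) (trans (val-< S s s<q₂) (sum-vanishes s s<q₂ u rec)))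
            (trans (ℤ.+-identityˡ _) (val-< S (suc (suc s)) s<q))))
          (trans (sym (τ-suc S s s<q₁)) (sum-step (suc s) (sum-vanishes (suc s) s<q₁) u rec))
          where
          S = sum u (odd q)
          s<q₁ = ℕ.<-trans (ℕ.n<1+n _) s<q
          s<q₂ = ℕ.<-trans (ℕ.n<1+n _) s<q₁

    window : ∀ u → Rec u → ∀ x → sum u (odd q) x ≡ 0ℤ
    window u rec x = subst (λ y → sum u (odd q) y ≡ 0ℤ) (sym (m≡m%n+[m/n]*n x q))
      (Block.sum-vanishes (x / q) (x % q) (m%n<n x q) u rec)

    periodic : ∀ u → Rec u → ∀ x → u (odd q) x ≡ u 0 x
    periodic u rec x = trans (sym (trans (cong (_+ u (odd q) x) (window u rec x)) (ℤ.+-identityˡ _)))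
      (trans (sym (sum-snoc u (odd q) x)) (trans (cong (u 0 x +_) (window (λ j → u (suc j)) (λ j → rec (suc j)) x)) (ℤ.+-identityʳ _)))

-- A variant of the geometric representation, whose scalars 2cos(2πk/m) are replaced by integral
-- operators, shows that the generators are pairwise distinct.
module Distinct (C : FiniteCoxeterSystem) where

  open WaveEquation
  open import Data.Integer using (ℤ; -_; _+_; 0ℤ; 1ℤ)
  import Data.Integer.Properties as ℤ
  open import Data.Integer.Solver using (module +-*-Solver)
  open FiniteCoxeterSystem C using (rank; gen; m; m-diag; m-sym; m-off; universal)

  open +-*-Solver using (solve; _:+_; _:=_; :-_; con)

  private
    I : Set
    I = Fin rank

  data Parity : ℕ → Set where
    isEven : ∀ r → Parity (double r)
    isOdd  : ∀ r → Parity (odd r)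

  parity : ∀ n → Parity n
  parity zero = isEven 0
  parity (suc n) with parity n
  ... | isEven r = isOdd r
  ... | isOdd r  = isEven (suc r)

  zeroMap : Fn → Fn
  zeroMap f x = 0ℤ

  2+τ : ℕ → Fn → Fn
  2+τ p f x = Wave.τ p f x + (f x + f x)

  -- The product of the two operators attached to an edge with m = 2q + 1 is 2 + τ, which plays the role of 4cos²(π/m).
  edge : ∀ {n} → Parity n → Bool → Fn → Fn
  edge (isEven r)      _     = zeroMap
  edge (isOdd zero)    _     = zeroMap
  edge (isOdd (suc p)) true  = λ f → f
  edge (isOdd (suc p)) false = 2+τ p

  zeroMap-linear : Linear (zeroMap)
  zeroMap-linear = record { ≗-cong = λ _ _ → refl ; +-hom = λ _ _ _ → refl ; neg-hom = λ _ _ → refl }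

  id-linear : Linear (λ f → f)
  id-linear = record { ≗-cong = λ eq → eq ; +-hom = λ _ _ _ → refl ; neg-hom = λ _ _ → refl }

  2+τ-linear : ∀ p → Linear (2+τ p)
  2+τ-linear p = record
    { ≗-cong  = λ eq x → cong₂ _+_ (≗-cong eq x) (cong₂ _+_ (eq x) (eq x))
    ; +-hom   = λ f g x → trans (cong (_+ ((f x + g x) + (f x + g x))) (+-hom f g x))
        (solve 4 (λ a b c d → (a :+ b) :+ ((c :+ d) :+ (c :+ d)) := (a :+ (c :+ c)) :+ (b :+ (d :+ d))) refl (Wave.τ p f x) (Wave.τ p g x) (f x) (g x))
    ; neg-hom = λ f x → trans (cong (_+ ((- f x) + (- f x))) (neg-hom f x))
        (solve 2 (λ a c → (:- a) :+ ((:- c) :+ (:- c)) := :- (a :+ (c :+ c))) refl (Wave.τ p f x) (f x))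
    }
    where open Linear (Wave.τ-linear p)

  edge-linear : ∀ {n} (P : Parity n) b → Linear (edge P b)
  edge-linear (isEven r)      _     = zeroMap-linear
  edge-linear (isOdd zero)    _     = zeroMap-linear
  edge-linear (isOdd (suc p)) true  = id-linear
  edge-linear (isOdd (suc p)) false = 2+τ-linear p

  op : I → I → Fn → Fn
  op k l = edge (parity (m k l)) (does (k F.<? l))

  module Op (k l : I) = Linear (edge-linear (parity (m k l)) (does (k F.<? l)))

  Vector : Set
  Vector = I → Fn

  act : I → Vector → Vector
  act k u r with r Fin.≟ k
  ... | yes _ = λ x → - u k x
  ... | no  _ = λ x → u r x + op r k (u k) x

  act-self : ∀ k u x → act k u k x ≡ - u k x
  act-self k u x with k Fin.≟ k
  ... | yes _  = refl
  ... | no k≢k = ⊥-elim (k≢k refl)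

  act-other : ∀ {k r} → r ≢ k → ∀ u x → act k u r x ≡ u r x + op r k (u k) x
  act-other {k} {r} r≢k u x with r Fin.≟ k
  ... | yes r≡k = ⊥-elim (r≢k r≡k)
  ... | no _    = refl

  infix 4 _≗_
  _≗_ : Vector → Vector → Set
  u ≗ w = ∀ r x → u r x ≡ w r x

  act-cong : ∀ k {u w} → u ≗ w → act k u ≗ act k w
  act-cong k eq r x with r Fin.≟ k
  ... | yes _ = cong -_ (eq k x)
  ... | no  _ = cong₂ _+_ (eq r x) (Op.≗-cong r k (eq k) x)

  act-involutive : ∀ k u → act k (act k u) ≗ u
  act-involutive k u r x with r Fin.≟ k
  ... | yes refl = trans (cong -_ (act-self k u x)) (ℤ.neg-involutive (u k x))
  ... | no  r≢k  = trans (cong₂ _+_ (act-other r≢k u x) (trans (Op.≗-cong r k (act-self k u) x) (Op.neg-hom r k (u k) x)))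
      (solve 2 (λ a b → (a :+ b) :+ (:- b) := a) refl (u r x) (op r k (u k) x))

  act* : List I → Vector → Vector
  act* []       u = u
  act* (k ∷ ks) u = act k (act* ks u)

  act*-cong : ∀ ks {u w} → u ≗ w → act* ks u ≗ act* ks w
  act*-cong []       eq = eq
  act*-cong (k ∷ ks) eq = act-cong k (act*-cong ks eq)

  act*-++ : ∀ ks ls u → act* (ks ++ ls) u ≡ act* ks (act* ls u)
  act*-++ []       ls u = refl
  act*-++ (k ∷ ks) ls u = cong (act k) (act*-++ ks ls u)

  reverse-inverseˡ : ∀ ks u → act* (reverse ks ++ ks) u ≗ u
  reverse-inverseˡ [] u r x = refl
  reverse-inverseˡ (k ∷ ks) u r x =
    trans (cong (λ z → act* (z ++ k ∷ ks) u r x) (List.unfold-reverse k ks))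
      (trans (cong (λ z → act* z u r x) (List.++-assoc (reverse ks) (k ∷ []) (k ∷ ks)))
        (trans (cong (λ z → z r x) (act*-++ (reverse ks) (k ∷ k ∷ ks) u))
          (trans (act*-cong (reverse ks) (act-involutive k (act* ks u)) r x)
            (trans (sym (cong (λ z → z r x) (act*-++ (reverse ks) ks u))) (reverse-inverseˡ ks u r x)))))

  -- With words as elements and equality of their actions as the equivalence, inverses are reversed
  -- words, because every letter acts as an involution.
  Words : Group 0ℓ 0ℓ
  Words = record
    { Carrier = List I
    ; _≈_     = λ ks ls → ∀ u → act* ks u ≗ act* ls u
    ; _∙_     = _++_
    ; ε       = []
    ; _⁻¹     = reverse
    ; isGroup = record
      { isMonoid = record
        { isSemigroup = record
          { isMagma = record
            { isEquivalence = record
              { refl  = λ u r x → refl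
              ; sym   = λ p u r x → sym (p u r x)
              ; trans = λ p q u r x → trans (p u r x) (q u r x)
              }
            ; ∙-cong = λ {ks} {ks′} {ls} {ls′} p q u r x → trans (cong (λ z → z r x) (act*-++ ks ls u))
                (trans (act*-cong ks (q u) r x) (trans (p (act* ls′ u) r x) (sym (cong (λ z → z r x) (act*-++ ks′ ls′ u)))))
            }
          ; assoc = λ ks ls ns u r x → cong (λ z → act* z u r x) (List.++-assoc ks ls ns)
          }
        ; identity = (λ ks u r x → refl) , (λ ks u r x → cong (λ z → act* z u r x) (List.++-identityʳ ks))
        }
      ; inverse = reverse-inverseˡ , λ ks u r x →
          trans (cong (λ z → act* (z ++ reverse ks) u r x) (sym (List.reverse-involutive ks))) (reverse-inverseˡ (reverse ks) u r x)
      ; ⁻¹-cong = λ {ks} {ls} p u r x →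
          trans (sym (reverse-inverseˡ ls (act* (reverse ks) u) r x))
            (trans (cong (λ z → z r x) (act*-++ (reverse ls) ls (act* (reverse ks) u)))
              (act*-cong (reverse ls) (λ r x → trans (sym (p (act* (reverse ks) u) r x))
                (trans (sym (cong (λ z → z r x) (act*-++ ks (reverse ks) u)))
                  (trans (cong (λ z → act* (z ++ reverse ks) u r x) (sym (List.reverse-involutive ks)))
                    (reverse-inverseˡ (reverse ks) u r x)))) r x))
      }
    }

  -- The relations between two operators

  module RankTwo {k l : I} (k≢l : k ≢ l) (u : Vector) where
    l≢k : l ≢ k
    l≢k eq = k≢l (sym eq)

    a b : Fn → Fn
    a = op k l
    b = op l k

    state : ℕ → Vector
    state n = act* (pow _++_ [] ((k ∷ []) ++ (l ∷ [])) n) u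

    -- The sign in `Z` makes the two recursions alike: consecutive values of one sequence add up to
    -- an edge operator applied to the other. If the edge operators compose to 2 + τ, eliminating
    -- either sequence leaves the wave equation.
    X Z : ℕ → Fn
    X n = state n l
    Z n x = - state n k x

    Z-suc : ∀ n x → Z (suc n) x ≡ a (X n) x + (- Z n x)
    Z-suc n x = trans (cong -_ (trans (act-self k (act l (state n)) x) (cong -_ (act-other k≢l (state n) x))))
      (solve 2 (λ y z → :- (:- (y :+ z)) := z :+ (:- (:- y))) refl (state n k x) (a (X n) x))

    X-suc : ∀ n x → X (suc n) x ≡ b (Z (suc n)) x + (- X n x)
    X-suc n x = trans (act-other l≢k (act l (state n)) x)
      (trans (cong₂ _+_ (act-self l (state n) x) (Op.≗-cong l k (λ y → sym (eq y)) x))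
        (ℤ.+-comm (- X n x) (b (Z (suc n)) x)))
      where
      eq : ∀ y → Z (suc n) y ≡ act l (state n) k y
      eq y = trans (cong -_ (act-self k (act l (state n)) y)) (ℤ.neg-involutive _)

    -- The remaining coordinates only accumulate contributions, so they return to their start once
    -- the sums over a period vanish. Periodicity alone would not be enough.
    rest : ∀ r → r ≢ k → r ≢ l → ∀ n x → state n r x ≡ u r x + (op r l (sum X n) x + op r k (sum (λ j → Z (suc j)) n) x)
    rest r r≢k r≢l zero x = sym (trans (cong (u r x +_) (cong₂ _+_ (Op.0-hom r l x) (Op.0-hom r k x))) (ℤ.+-identityʳ _))
    rest r r≢k r≢l (suc n) x = trans (act-other r≢k (act l (state n)) x)
      (trans (cong₂ _+_ (trans (act-other r≢l (state n) x) (cong (_+ op r l (X n) x) (rest r r≢k r≢l n x)))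
          (Op.≗-cong r k (λ y → trans (sym (ℤ.neg-involutive _)) (cong -_ (sym (act-self k (act l (state n)) y)))) x))
        (trans (solve 5 (λ u c d e f → ((u :+ (c :+ d)) :+ e) :+ f := u :+ ((c :+ e) :+ (d :+ f))) refl
            (u r x) (op r l (sum X n) x) (op r k (sum (λ j → Z (suc j)) n) x) (op r l (X n) x) (op r k (Z (suc n)) x))
          (cong (u r x +_) (cong₂ _+_ (sum-op r l X) (sum-op r k (λ j → Z (suc j)))))))
      where
      sum-op : ∀ r l Y → op r l (sum Y n) x + op r l (Y n) x ≡ op r l (sum Y (suc n)) x
      sum-op r l Y = trans (sym (Op.+-hom r l (sum Y n) (Y n) x)) (Op.≗-cong r l (λ y → sym (sum-snoc Y n y)) x)

    trivial : ∀ n → (∀ x → X n x ≡ X 0 x) → (∀ x → Z n x ≡ Z 0 x) →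
      (∀ x → sum X n x ≡ 0ℤ) → (∀ x → sum (λ j → Z (suc j)) n x ≡ 0ℤ) → state n ≗ u
    trivial n X-per Z-per X-sum Z-sum r x with r Fin.≟ k | r Fin.≟ l
    ... | yes refl | _        = trans (sym (ℤ.neg-involutive _)) (trans (cong -_ (Z-per x)) (ℤ.neg-involutive _))
    ... | no  _    | yes refl = X-per x
    ... | no r≢k   | no r≢l   = trans (rest r r≢k r≢l n x)
      (trans (cong (u r x +_) (cong₂ _+_ (trans (Op.≗-cong r l X-sum x) (Op.0-hom r l x)) (trans (Op.≗-cong r k Z-sum x) (Op.0-hom r k x)))) (ℤ.+-identityʳ _))

    alternating : ∀ (Y : ℕ → Fn) → (∀ n x → Y (suc n) x ≡ - Y n x) → ∀ r x → Y (double r) x ≡ Y 0 x × sum Y (double r) x ≡ 0ℤ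
    alternating Y neg zero    x = refl , refl
    alternating Y neg (suc r) x with alternating (λ j → Y (suc (suc j))) (λ n → neg (suc (suc n))) r x
    ... | per , s = trans per (trans (neg 1 x) (trans (cong -_ (neg 0 x)) (ℤ.neg-involutive _))) ,
      trans (cong₂ (λ c d → Y 0 x + (c + d)) (neg 0 x) s) (solve 1 (λ c → c :+ ((:- c) :+ con 0ℤ) := con 0ℤ) refl (Y 0 x))

    -- With vanishing edge operators the two reflections commute, so the square of their product is
    -- trivial, and so is every even power.
    even-relation : ∀ r → (∀ f x → a f x ≡ 0ℤ) → (∀ f x → b f x ≡ 0ℤ) → state (double r) ≗ u
    even-relation r a≡0 b≡0 = trivial (double r)
        (λ x → proj₁ (alternating X X-neg r x)) (λ x → proj₁ (alternating Z Z-neg r x))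
        (λ x → proj₂ (alternating X X-neg r x)) (λ x → proj₂ (alternating (λ j → Z (suc j)) (λ n → Z-neg (suc n)) r x))
      where
      X-neg : ∀ n x → X (suc n) x ≡ - X n x
      X-neg n x = trans (X-suc n x) (trans (cong (_+ (- X n x)) (b≡0 _ x)) (ℤ.+-identityˡ _))
      Z-neg : ∀ n x → Z (suc n) x ≡ - Z n x
      Z-neg n x = trans (Z-suc n x) (trans (cong (_+ (- Z n x)) (a≡0 _ x)) (ℤ.+-identityˡ _))

    odd-relation : ∀ p → (∀ f x → a (b f) x ≡ 2+τ p f x) → (∀ f x → b (a f) x ≡ 2+τ p f x) → state (odd (suc p)) ≗ u
    odd-relation p ab ba = trivial (odd (suc p)) (periodic X X-Rec) (periodic Z Z-Rec) (window X X-Rec)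
        (window (λ j → Z (suc j)) (λ j → Z-Rec (suc j)))
      where
      open Wave p
      -- Both alternating recursions a + a′ = A c, c + c′ = B a′ eliminate to the same three term recursion.
      eliminate : ∀ (A B : Fn → Fn) → Linear B → (∀ f x → B (A f) x ≡ 2+τ p f x) → (Y Y′ Y″ V V′ : Fn) →
        (∀ x → Y′ x ≡ B V x + (- Y x)) → (∀ x → V′ x ≡ A Y′ x + (- V x)) → (∀ x → Y″ x ≡ B V′ x + (- Y′ x)) →
        ∀ x → Y″ x + Y x ≡ τ Y′ x
      eliminate A B lin BA Y Y′ Y″ V V′ e₁ e₂ e₃ x = trans (cong (_+ Y x) (trans (e₃ x) (cong (_+ (- Y′ x)) BV′)))
        (trans (cong (λ z → ((((τ Y′ x) + (z + z)) + (- B V x)) + (- z)) + Y x) (e₁ x))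
          (solve 3 (λ t v y → (((t :+ ((v :+ (:- y)) :+ (v :+ (:- y)))) :+ (:- v)) :+ (:- (v :+ (:- y)))) :+ y := t) refl (τ Y′ x) (B V x) (Y x)))
        where
        open Linear lin
        BV′ : B V′ x ≡ (τ Y′ x + (Y′ x + Y′ x)) + (- B V x)
        BV′ = trans (≗-cong e₂ x) (trans (+-hom (A Y′) (λ y → - V y) x) (cong₂ _+_ (BA Y′ x) (neg-hom V x)))
      X-Rec : Rec X
      X-Rec j = eliminate a b (edge-linear (parity (m l k)) (does (l F.<? k))) ba (X j) (X (suc j)) (X (suc (suc j))) (Z (suc j)) (Z (suc (suc j)))
        (X-suc j) (Z-suc (suc j)) (X-suc (suc j))
      Z-Rec : Rec Z
      Z-Rec j = eliminate b a (edge-linear (parity (m k l)) (does (k F.<? l))) ab (Z j) (Z (suc j)) (Z (suc (suc j))) (X j) (X (suc j))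
        (Z-suc j) (X-suc j) (Z-suc (suc j))

  edge-cases : ∀ {n} (P : Parity n) → 2 ≤ n →
    (∃[ r ] n ≡ double r × (∀ c f x → edge P c f x ≡ 0ℤ)) ⊎
    (∃[ p ] n ≡ odd (suc p) × (∀ c f x → edge P c (edge P (not c) f) x ≡ 2+τ p f x))
  edge-cases (isEven r)      _        = inj₁ (r , refl , λ _ _ _ → refl)
  edge-cases (isOdd zero)    (s≤s ())
  edge-cases (isOdd (suc p)) _        = inj₂ (p , refl , λ { true _ _ → refl ; false _ _ → refl })

  <?-not : ∀ {k l : I} → k ≢ l → does (l F.<? k) ≡ not (does (k F.<? l))
  <?-not {k} {l} k≢l with Fin.<-cmp k l
  ... | tri< k<l _ l≮k = trans (dec-false (l F.<? k) l≮k) (cong not (sym (dec-true (k F.<? l) k<l)))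
  ... | tri≈ _ k≡l _   = ⊥-elim (k≢l k≡l)
  ... | tri> k≮l _ l<k = trans (dec-true (l F.<? k) l<k) (cong not (sym (dec-false (k F.<? l) k≮l)))

  relation : ∀ k l u → act* (pow _++_ [] ((k ∷ []) ++ (l ∷ [])) (m k l)) u ≗ u
  relation k l u with k Fin.≟ l
  ... | yes refl = λ r x → trans (cong (λ n → act* (pow _++_ [] (k ∷ k ∷ []) n) u r x) (m-diag k)) (act-involutive k u r x)
  ... | no k≢l with edge-cases (parity (m k l)) (m-off k l k≢l)
  ...   | inj₁ (r , eq , vanish) = subst (λ n → state n ≗ u) (sym eq)
          (even-relation r (vanish _) (λ f x → trans (cong (λ h → h f x) op-sym) (vanish _ f x)))
    where
    open RankTwo k≢l u
    op-sym : op l k ≡ edge (parity (m k l)) (not (does (k F.<? l)))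
    op-sym = cong₂ (λ n c → edge (parity n) c) (m-sym l k) (<?-not k≢l)
  ...   | inj₂ (p , eq , product) = subst (λ n → state n ≗ u) (sym eq)
          (odd-relation p (λ f x → trans (cong (λ h → a (h f) x) op-sym) (product _ f x))
            (λ f x → trans (cong (λ h → h (a f) x) op-sym)
              (trans (cong (λ c → edge (parity (m k l)) (not (does (k F.<? l))) (edge (parity (m k l)) c f) x) (sym (Bool.not-involutive (does (k F.<? l)))))
                (product (not (does (k F.<? l))) f x))))
    where
    open RankTwo k≢l u
    op-sym : op l k ≡ edge (parity (m k l)) (not (does (k F.<? l)))
    op-sym = cong₂ (λ n c → edge (parity n) c) (m-sym l k) (<?-not k≢l)

  -- The unit vector at `j` separates the two: the action of `i` keeps its coordinate at `j`, that
  -- of `j` negates it.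
  gen-injective : ∀ {i j} → gen i ≡ gen j → i ≡ j
  gen-injective {i} {j} eq with i Fin.≟ j
  ... | yes i≡j = i≡j
  ... | no  i≢j = ⊥-elim (1≢-1 (trans (sym value-i) (trans same value-j)))
    where
    hom = universal Words (λ k → k ∷ []) relation
    φ = proj₁ hom
    basis : Vector
    basis r x = if does (r Fin.≟ j) then 1ℤ else 0ℤ
    same : act i basis j 0 ≡ act j basis j 0
    same = trans (sym (proj₂ (proj₂ hom) i basis j 0))
      (trans (cong (λ w → act* (φ w) basis j 0) eq) (proj₂ (proj₂ hom) j basis j 0))
    basis-j : basis j 0 ≡ 1ℤ
    basis-j = cong (if_then 1ℤ else 0ℤ) (dec-true (j Fin.≟ j) refl)
    value-j : act j basis j 0 ≡ - 1ℤ
    value-j = trans (act-self j basis 0) (cong -_ basis-j)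
    value-i : act i basis j 0 ≡ 1ℤ
    value-i = trans (act-other (λ eq → i≢j (sym eq)) basis 0)
      (cong₂ _+_ basis-j (trans (Op.≗-cong j i (λ _ → cong (if_then 1ℤ else 0ℤ) (dec-false (i Fin.≟ j) i≢j)) 0) (Op.0-hom j i 0)))
    1≢-1 : 1ℤ ≢ - 1ℤ
    1≢-1 ()

-- Equations between group elements

module CoxeterGroup (C : FiniteCoxeterSystem) where

  open FiniteCoxeterSystem C
  open IsGroup isGroup using (assoc; identityˡ; identityʳ; inverseˡ; inverseʳ)

  I : Set
  I = Fin rank

  infixl 7 _∙_
  _∙_ : W → W → W
  _∙_ = _·_

  infix 4 _≟_
  abstract
    _≟_ : DecidableEquality W
    _≟_ = enumerated⇒≟ elemsW allW

  gen² : ∀ i → gen i ∙ gen i ≡ e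
  gen² i = trans (sym (identityʳ _)) (subst (λ k → pow _·_ e (gen i · gen i) k ≡ e) (m-diag i) (relations i i))

  -- Group identities in W are decided by free reduction; the letters `rf n` stand for generators
  -- and are therefore also cancelled as involutions.
  data Expr : Set where
    el rf : ℕ → Expr
    _⊙_ : Expr → Expr → Expr
    _⁻  : Expr → Expr
    ε   : Expr

  infixl 7 _⊙_
  infix 8 _⁻

  data Letter : Set where
    pos neg inv : ℕ → Letter

  private
    nth : List W → ℕ → W
    nth []       _       = e
    nth (x ∷ _)  zero    = x
    nth (_ ∷ xs) (suc n) = nth xs n

    nthGen : List I → ℕ → W
    nthGen []       _       = e
    nthGen (i ∷ _)  zero    = gen i
    nthGen (_ ∷ is) (suc n) = nthGen is n

    nthGen² : ∀ is n → nthGen is n ∙ nthGen is n ≡ e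
    nthGen² []       n       = identityˡ e
    nthGen² (i ∷ is) zero    = gen² i
    nthGen² (i ∷ is) (suc n) = nthGen² is n

  cancel : Letter → List Letter → List Letter
  cancel (pos n) (neg k ∷ l) with n ℕ.≟ k
  ... | yes _ = l
  ... | no  _ = pos n ∷ neg k ∷ l
  cancel (neg n) (pos k ∷ l) with n ℕ.≟ k
  ... | yes _ = l
  ... | no  _ = neg n ∷ pos k ∷ l
  cancel (inv n) (inv k ∷ l) with n ℕ.≟ k
  ... | yes _ = l
  ... | no  _ = inv n ∷ inv k ∷ l
  cancel x l = x ∷ l

  reduce⁺ reduce⁻ : Expr → List Letter → List Letter
  reduce⁺ (el n)   l = cancel (pos n) l
  reduce⁺ (rf n)   l = cancel (inv n) l
  reduce⁺ (a ⊙ b) l = reduce⁺ a (reduce⁺ b l)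
  reduce⁺ (a ⁻)   l = reduce⁻ a l
  reduce⁺ ε       l = l
  reduce⁻ (el n)   l = cancel (neg n) l
  reduce⁻ (rf n)   l = cancel (inv n) l
  reduce⁻ (a ⊙ b) l = reduce⁻ b (reduce⁻ a l)
  reduce⁻ (a ⁻)   l = reduce⁺ a l
  reduce⁻ ε       l = l

  cancelˡ : ∀ {a b} → a ∙ b ≡ e → ∀ x → a ∙ (b ∙ x) ≡ x
  cancelˡ {a} {b} ab x = trans (sym (assoc a b x)) (trans (cong (_∙ x) ab) (identityˡ x))

  inverse-unique : ∀ {a b} → a ∙ b ≡ e → a ⁻¹ ≡ b
  inverse-unique {a} {b} ab = trans (sym (identityʳ _)) (trans (cong (a ⁻¹ ∙_) (sym ab)) (cancelˡ (inverseˡ a) b))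

  ⁻¹-involutive : ∀ a → (a ⁻¹) ⁻¹ ≡ a
  ⁻¹-involutive a = inverse-unique (inverseˡ a)

  ⁻¹-anti-∙ : ∀ a b → (a ∙ b) ⁻¹ ≡ b ⁻¹ ∙ a ⁻¹
  ⁻¹-anti-∙ a b = inverse-unique (trans (assoc a b _) (trans (cong (a ∙_) (cancelˡ (inverseʳ b) _)) (inverseʳ a)))

  module Reflect (ρ : List W) (σ : List I) where
    ⟦_⟧ : Expr → W
    ⟦ el n ⟧   = nth ρ n
    ⟦ rf n ⟧   = nthGen σ n
    ⟦ a ⊙ b ⟧ = ⟦ a ⟧ ∙ ⟦ b ⟧
    ⟦ a ⁻ ⟧   = ⟦ a ⟧ ⁻¹
    ⟦ ε ⟧     = e

    ⟦_⟧ᴸ : Letter → W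
    ⟦ pos n ⟧ᴸ = nth ρ n
    ⟦ neg n ⟧ᴸ = nth ρ n ⁻¹
    ⟦ inv n ⟧ᴸ = nthGen σ n

    ⟦_⟧* : List Letter → W
    ⟦ [] ⟧*    = e
    ⟦ x ∷ l ⟧* = ⟦ x ⟧ᴸ ∙ ⟦ l ⟧*

    cancel-sound : ∀ x l → ⟦ cancel x l ⟧* ≡ ⟦ x ⟧ᴸ ∙ ⟦ l ⟧*
    cancel-sound (pos n) (neg k ∷ l) with n ℕ.≟ k
    ... | yes refl = sym (cancelˡ (inverseʳ _) _)
    ... | no  _    = refl
    cancel-sound (neg n) (pos k ∷ l) with n ℕ.≟ k
    ... | yes refl = sym (cancelˡ (inverseˡ _) _)
    ... | no  _    = refl
    cancel-sound (inv n) (inv k ∷ l) with n ℕ.≟ k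
    ... | yes refl = sym (cancelˡ (nthGen² σ n) _)
    ... | no  _    = refl
    cancel-sound (pos n) []          = refl
    cancel-sound (pos n) (pos _ ∷ l) = refl
    cancel-sound (pos n) (inv _ ∷ l) = refl
    cancel-sound (neg n) []          = refl
    cancel-sound (neg n) (neg _ ∷ l) = refl
    cancel-sound (neg n) (inv _ ∷ l) = refl
    cancel-sound (inv n) []          = refl
    cancel-sound (inv n) (pos _ ∷ l) = refl
    cancel-sound (inv n) (neg _ ∷ l) = refl

    reduce⁺-sound : ∀ a l → ⟦ reduce⁺ a l ⟧* ≡ ⟦ a ⟧ ∙ ⟦ l ⟧*
    reduce⁻-sound : ∀ a l → ⟦ reduce⁻ a l ⟧* ≡ ⟦ a ⟧ ⁻¹ ∙ ⟦ l ⟧*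
    reduce⁺-sound (el n)   l = cancel-sound (pos n) l
    reduce⁺-sound (rf n)   l = cancel-sound (inv n) l
    reduce⁺-sound (a ⊙ b) l =
      trans (reduce⁺-sound a _) (trans (cong (⟦ a ⟧ ∙_) (reduce⁺-sound b l)) (sym (assoc _ _ _)))
    reduce⁺-sound (a ⁻)   l = reduce⁻-sound a l
    reduce⁺-sound ε       l = sym (identityˡ _)
    reduce⁻-sound (el n)   l = cancel-sound (neg n) l
    reduce⁻-sound (rf n)   l = trans (cancel-sound (inv n) l) (cong (_∙ ⟦ l ⟧*) (sym (inverse-unique (nthGen² σ n))))
    reduce⁻-sound (a ⊙ b) l =
      trans (reduce⁻-sound b _) (trans (cong (⟦ b ⟧ ⁻¹ ∙_) (reduce⁻-sound a l))
        (trans (sym (assoc _ _ _)) (cong (_∙ ⟦ l ⟧*) (sym (⁻¹-anti-∙ _ _)))))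
    reduce⁻-sound (a ⁻)   l = trans (reduce⁺-sound a l) (cong (_∙ ⟦ l ⟧*) (sym (⁻¹-involutive _)))
    reduce⁻-sound ε       l = sym (trans (cong (_∙ ⟦ l ⟧*) (inverse-unique (identityˡ e))) (identityˡ _))

    solve : ∀ a b → reduce⁺ a [] ≡ reduce⁺ b [] → ⟦ a ⟧ ≡ ⟦ b ⟧
    solve a b eq = trans (sound a) (trans (cong ⟦_⟧* eq) (sym (sound b)))
      where
      sound : ∀ c → ⟦ c ⟧ ≡ ⟦ reduce⁺ c [] ⟧*
      sound c = sym (trans (reduce⁺-sound c []) (identityʳ _))

  open Reflect using (solve)

  δ : W → W → Bool
  δ a b = does (a ≟ b)

  δ-refl : ∀ {a b} → a ≡ b → δ a b ≡ true
  δ-refl = dec-true (_ ≟ _)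

  δ-≢ : ∀ {a b} → a ≢ b → δ a b ≡ false
  δ-≢ = dec-false (_ ≟ _)

  δ-sound : ∀ a b → δ a b ≡ true → a ≡ b
  δ-sound a b eq with a ≟ b
  ... | yes p = p
  δ-sound a b () | no _

  δ-cong : ∀ {a b c d} → (a ≡ b → c ≡ d) → (c ≡ d → a ≡ b) → δ a b ≡ δ c d
  δ-cong {a} {b} to from with a ≟ b
  ... | yes p = sym (δ-refl (to p))
  ... | no ¬p = sym (δ-≢ (λ q → ¬p (from q)))

  -- The inversion cocycle and the exchange property

  _^_ : W → ℕ → W
  a ^ k = pow _·_ e a k

  conj : W → W → W
  conj a t = a ⁻¹ ∙ t ∙ a

  -- The semidirect product of W with the W-module of functions W → 𝔽₂; the crossed
  -- homomorphism W → (W → 𝔽₂) counting crossed reflections mod 2 is a section of it.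
  Cocycles : Group 0ℓ 0ℓ
  Cocycles = record
    { Carrier = W × (W → Bool)
    ; _≈_     = _≋_
    ; _∙_     = _⋆_
    ; ε       = e , λ _ → false
    ; _⁻¹     = λ (a , f) → a ⁻¹ , λ t → f (a ∙ t ∙ a ⁻¹)
    ; isGroup = record
      { isMonoid = record
        { isSemigroup = record
          { isMagma = record
            { isEquivalence = record
              { refl  = refl , λ _ → refl
              ; sym   = λ (p , q) → sym p , λ t → sym (q t)
              ; trans = λ (p , q) (p′ , q′) → trans p p′ , λ t → trans (q t) (q′ t)
              }
            ; ∙-cong = λ {x} {y} {u} {v} → ⋆-cong {x} {y} {u} {v}
            }
          ; assoc = λ (a , f) (b , g) (c , h) → assoc a b c , λ t →
              trans (Bool.xor-assoc (f t) (g (conj a t)) (h (conj (a ∙ b) t)))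
                (cong (λ z → f t xor (g (conj a t) xor h z))
                  (solve (a ∷ b ∷ t ∷ []) [] ((el 0 ⊙ el 1) ⁻ ⊙ el 2 ⊙ (el 0 ⊙ el 1))
                                             (el 1 ⁻ ⊙ (el 0 ⁻ ⊙ el 2 ⊙ el 0) ⊙ el 1) refl))
          }
        ; identity = (λ (a , f) → identityˡ a , λ t → cong f (solve (t ∷ []) [] (ε ⁻ ⊙ el 0 ⊙ ε) (el 0) refl))
                   , (λ (a , f) → identityʳ a , λ t → Bool.xor-identityʳ (f t))
        }
      ; inverse = (λ (a , f) → inverseˡ a , λ t →
                     trans (cong (λ z → f (a ∙ t ∙ a ⁻¹) xor f z)
                       (solve (a ∷ t ∷ []) [] ((el 0 ⁻) ⁻ ⊙ el 1 ⊙ el 0 ⁻) (el 0 ⊙ el 1 ⊙ el 0 ⁻) refl)) (Bool.xor-same (f (a ∙ t ∙ a ⁻¹))))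
                , (λ (a , f) → inverseʳ a , λ t →
                     trans (cong (λ z → f t xor f z)
                       (solve (a ∷ t ∷ []) [] (el 0 ⊙ (el 0 ⁻ ⊙ el 1 ⊙ el 0) ⊙ el 0 ⁻) (el 1) refl)) (Bool.xor-same (f t)))
      ; ⁻¹-cong = λ { {a , f} {_ , g} (refl , q) → refl , λ t → q _ }
      }
    }
    where
    _≋_ : W × (W → Bool) → W × (W → Bool) → Set
    (a , f) ≋ (b , g) = a ≡ b × (∀ t → f t ≡ g t)
    _⋆_ : W × (W → Bool) → W × (W → Bool) → W × (W → Bool)
    (a , f) ⋆ (b , g) = a ∙ b , λ t → f t xor g (conj a t)
    ⋆-cong : ∀ {x y u v} → x ≋ y → u ≋ v → (x ⋆ u) ≋ (y ⋆ v)
    ⋆-cong {a , f} {_ , f′} {b , g} {_ , g′} (refl , p) (refl , q) = refl , λ t → cong₂ _xor_ (p t) (q _)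

  pow-∙ : ∀ a k → a ^ k ∙ a ≡ a ∙ a ^ k
  pow-∙ a zero    = trans (identityˡ a) (sym (identityʳ a))
  pow-∙ a (suc k) = trans (assoc a (a ^ k) a) (cong (a ∙_) (pow-∙ a k))

  module Dihedral (i j : I) where
    a : W
    a = gen i ∙ gen j

    -- rot p is the reflection (sᵢsⱼ)ᵖ sᵢ, the p-th one crossed by the word sᵢsⱼsᵢsⱼ…
    rot : ℕ → W
    rot p = a ^ p ∙ gen i

    -- The parity with which `t` occurs among `n` consecutive reflections `rot p`, `rot (suc p)`,
    -- and so on.
    crossings : ℕ → ℕ → W → Bool
    crossings zero    p t = false
    crossings (suc n) p t = δ t (rot p) xor crossings n (suc p) t

    conj-rot : ∀ p → a ∙ rot p ∙ a ⁻¹ ≡ rot (suc (suc p))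
    conj-rot p = trans
      (solve (a ^ p ∷ []) (i ∷ j ∷ []) (rf 0 ⊙ rf 1 ⊙ (el 0 ⊙ rf 0) ⊙ (rf 0 ⊙ rf 1) ⁻)
        (rf 0 ⊙ rf 1 ⊙ (el 0 ⊙ (rf 0 ⊙ rf 1)) ⊙ rf 0) refl)
      (cong (λ z → a ∙ z ∙ gen i) (pow-∙ a p))

    δ-conj : ∀ p t → δ (conj a t) (rot p) ≡ δ t (rot (suc (suc p)))
    δ-conj p t = δ-cong
      (λ eq → trans (solve (a ∷ t ∷ []) [] (el 1) (el 0 ⊙ (el 0 ⁻ ⊙ el 1 ⊙ el 0) ⊙ el 0 ⁻) refl)
                    (trans (cong (λ z → a ∙ z ∙ a ⁻¹) eq) (conj-rot p)))
      (λ eq → trans (cong (conj a) (trans eq (sym (conj-rot p))))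
                    (solve (a ∷ rot p ∷ []) [] (el 0 ⁻ ⊙ (el 0 ⊙ el 1 ⊙ el 0 ⁻) ⊙ el 0) (el 1) refl))

    crossings-conj : ∀ n p t → crossings n p (conj a t) ≡ crossings n (suc (suc p)) t
    crossings-conj zero    p t = refl
    crossings-conj (suc n) p t = cong₂ _xor_ (δ-conj p t) (crossings-conj n (suc p) t)

    crossings-+ : ∀ n k p t → crossings (n +ℕ k) p t ≡ crossings n p t xor crossings k (n +ℕ p) t
    crossings-+ zero    k p t = refl
    crossings-+ (suc n) k p t = trans
      (cong (δ t (rot p) xor_) (trans (crossings-+ n k (suc p) t)
        (cong (λ z → crossings n (suc p) t xor crossings k z t) (ℕ.+-suc n p))))
      (sym (Bool.xor-assoc (δ t (rot p)) _ _))

    pow-+ : ∀ n p → a ^ (n +ℕ p) ≡ a ^ n ∙ a ^ p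
    pow-+ zero    p = sym (identityˡ _)
    pow-+ (suc n) p = trans (cong (a ∙_) (pow-+ n p)) (sym (assoc a _ _))

    crossings-period : ∀ n k → a ^ n ≡ e → ∀ p t → crossings k (n +ℕ p) t ≡ crossings k p t
    crossings-period n zero    an p t = refl
    crossings-period n (suc k) an p t = cong₂ _xor_
      (cong (λ z → δ t (z ∙ gen i)) (trans (pow-+ n p) (trans (cong (_∙ a ^ p) an) (identityˡ _))))
      (trans (cong (λ z → crossings k z t) (sym (ℕ.+-suc n p))) (crossings-period n k an (suc p) t))

    open Group Cocycles using () renaming (_∙_ to _⋆_; ε to ε⋆)

    crossed : I → W × (W → Bool)
    crossed k = gen k , λ t → δ t (gen k)

    pow-crossed : ∀ n → proj₁ (pow _⋆_ ε⋆ (crossed i ⋆ crossed j) n) ≡ a ^ n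
    pow-crossed zero    = refl
    pow-crossed (suc n) = cong (a ∙_) (pow-crossed n)

    pow-crossed-count : ∀ n t → proj₂ (pow _⋆_ ε⋆ (crossed i ⋆ crossed j) n) t ≡ crossings (n +ℕ n) 0 t
    pow-crossed-count zero    t = refl
    pow-crossed-count (suc n) t = trans
      (cong₂ _xor_ (cong₂ _xor_ (cong (δ t) (sym (identityˡ (gen i)))) (δ-cong to from))
                   (trans (pow-crossed-count n (conj a t)) (crossings-conj (n +ℕ n) 0 t)))
      (trans (Bool.xor-assoc (δ t (rot 0)) _ _)
        (sym (cong (λ z → crossings (suc z) 0 t) (ℕ.+-suc n n))))
      where
      to : conj (gen i) t ≡ gen j → t ≡ rot 1
      to eq = trans (solve (t ∷ []) (i ∷ []) (el 0) (rf 0 ⊙ (rf 0 ⁻ ⊙ el 0 ⊙ rf 0) ⊙ rf 0) refl)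
        (trans (cong (λ z → gen i ∙ z ∙ gen i) eq) (cong (_∙ gen i) (sym (identityʳ a))))
      from : t ≡ rot 1 → conj (gen i) t ≡ gen j
      from eq = trans (cong (conj (gen i)) eq)
        (solve [] (i ∷ j ∷ []) (rf 0 ⁻ ⊙ (rf 0 ⊙ rf 1 ⊙ ε ⊙ rf 0) ⊙ rf 0) (rf 1) refl)

    -- The relator crosses the reflections `rot 0`, `rot 1`, ... up to twice `m i j` of them. Since
    -- `a` to the power `m i j` is trivial, the second half repeats the first, so every reflection
    -- is crossed an even number of times.
    crossed-relation : proj₁ (pow _⋆_ ε⋆ (crossed i ⋆ crossed j) (m i j)) ≡ e
                     × (∀ t → proj₂ (pow _⋆_ ε⋆ (crossed i ⋆ crossed j) (m i j)) t ≡ false)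
    crossed-relation = trans (pow-crossed (m i j)) (relations i j) , λ t →
      trans (pow-crossed-count (m i j) t)
        (trans (crossings-+ (m i j) (m i j) 0 t)
          (trans (cong (crossings (m i j) 0 t xor_) (crossings-period (m i j) (m i j) (relations i j) 0 t))
            (Bool.xor-same (crossings (m i j) 0 t))))

  private
    section = universal Cocycles (λ k → gen k , λ t → δ t (gen k)) Dihedral.crossed-relation
    φ = proj₁ section
    φ-∙ = proj₁ (proj₂ section)
    φ-gen = proj₂ (proj₂ section)

    φ-e : proj₁ (φ e) ≡ e
    φ-e = trans (solve (proj₁ (φ e) ∷ []) [] (el 0) (el 0 ⁻ ⊙ (el 0 ⊙ el 0)) refl)
      (trans (cong (proj₁ (φ e) ⁻¹ ∙_) (trans (sym (proj₁ (φ-∙ e e))) (cong (λ z → proj₁ (φ z)) (identityˡ e))))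
        (inverseˡ _))

    φ-prod : ∀ ws → proj₁ (φ (prod ws)) ≡ prod ws
    φ-prod []       = φ-e
    φ-prod (i ∷ ws) = trans (proj₁ (φ-∙ (gen i) (prod ws))) (cong₂ _∙_ (proj₁ (φ-gen i)) (φ-prod ws))

    φ-id : ∀ w → proj₁ (φ w) ≡ w
    φ-id w = subst (λ z → proj₁ (φ z) ≡ z) (proj₂ (generated w)) (φ-prod (proj₁ (generated w)))

  -- N w is the indicator function of the set of left inversions of w.
  abstract
    N : W → W → Bool
    N w = proj₂ (φ w)

    N-∙ : ∀ a b t → N (a ∙ b) t ≡ N a t xor N b (conj a t)
    N-∙ a b t = trans (proj₂ (φ-∙ a b) t) (cong (λ z → N a t xor N b (conj z t)) (φ-id a))

    N-gen : ∀ i t → N (gen i) t ≡ δ t (gen i)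
    N-gen i = proj₂ (φ-gen i)

  conj-e : ∀ t → conj e t ≡ t
  conj-e t = solve (t ∷ []) [] (ε ⁻ ⊙ el 0 ⊙ ε) (el 0) refl

  N-e : ∀ t → N e t ≡ false
  N-e t = trans (cong (λ z → N z t) (sym (identityˡ e)))
    (trans (N-∙ e e t) (trans (cong (λ z → N e t xor N e z) (conj-e t)) (Bool.xor-same (N e t))))

  N-inverse : ∀ a t → N (a ⁻¹) (conj a t) ≡ N a t
  N-inverse a t = xor-cancel (trans (sym (N-∙ a (a ⁻¹) t)) (trans (cong (λ z → N z t) (inverseʳ a)) (N-e t)))
    where
    xor-cancel : ∀ {x y} → x xor y ≡ false → y ≡ x
    xor-cancel {true}  {true}  _ = refl
    xor-cancel {false} {false} _ = refl

  -- By the cocycle law the parity for the whole word is a sum over its letters, so `t` is crossed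
  -- at some letter, and deleting that letter multiplies the product by `t`. That the result is a
  -- subword is recorded for the later crossing out of layers.
  exchange : ∀ ws t → N (prod ws) t ≡ true →
    ∃[ us ] us ⊆ ws × prod us ≡ t ∙ prod ws × suc (length us) ≡ length ws
  exchange [] t h with trans (sym h) (N-e t)
  ... | ()
  exchange (i ∷ ws) t h with t ≟ gen i
  ... | yes refl = ws , i ∷ʳ ⊆-refl , sym (cancelˡ (gen² i) (prod ws)) , refl
  ... | no  t≢i  with exchange ws (conj (gen i) t) h′
    where
    h′ : N (prod ws) (conj (gen i) t) ≡ true
    h′ = trans (cong (_xor N (prod ws) (conj (gen i) t)) (sym (trans (N-gen i t) (δ-≢ t≢i))))
           (trans (sym (N-∙ (gen i) (prod ws) t)) h)
  ... | us , us⊆ws , eq , len = i ∷ us , refl ∷ us⊆ws ,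
    trans (cong (gen i ∙_) eq) (solve (t ∷ prod ws ∷ []) (i ∷ []) (rf 0 ⊙ (rf 0 ⁻ ⊙ el 0 ⊙ rf 0 ⊙ el 1)) (el 0 ⊙ (rf 0 ⊙ el 1)) refl) ,
    cong suc len

  open Coxeter C

  true≢false : {b : Bool} → b ≡ true → b ≡ false → ⊥
  true≢false refl ()

  -- Reduced words, length and descents

  prod-++ : ∀ us ws → prod (us ++ ws) ≡ prod us ∙ prod ws
  prod-++ []       ws = sym (identityˡ _)
  prod-++ (i ∷ us) ws = trans (cong (gen i ∙_) (prod-++ us ws)) (sym (assoc _ _ _))

  prod-[] : ∀ i → prod [ i ] ≡ gen i
  prod-[] i = identityʳ (gen i)

  prod-reverse : ∀ ws → prod (reverse ws) ≡ prod ws ⁻¹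
  prod-reverse []       = sym (inverse-unique (identityˡ e))
  prod-reverse (i ∷ ws) = trans (cong prod (List.unfold-reverse i ws))
    (trans (prod-++ (reverse ws) [ i ])
      (trans (cong₂ _∙_ (prod-reverse ws) (prod-[] i))
        (solve (prod ws ∷ []) (i ∷ []) (el 0 ⁻ ⊙ rf 0) ((rf 0 ⊙ el 0) ⁻) refl)))

  -- Stated by ascents, so that it can be decided with `N` and built letter by letter;
  -- `Reduced-minimal` recovers minimality of the length.
  data Reduced : List I → Set where
    []  : Reduced []
    _∷_ : ∀ {i ws} → N (prod ws) (gen i) ≡ false → Reduced ws → Reduced (i ∷ ws)

  N-gen∙ : ∀ i w t → N (gen i ∙ w) t ≡ δ t (gen i) xor N w (conj (gen i) t)
  N-gen∙ i w t = trans (N-∙ (gen i) w t) (cong (_xor N w (conj (gen i) t)) (N-gen i t))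

  conj-gen : ∀ i → conj (gen i) (gen i) ≡ gen i
  conj-gen i = solve [] (i ∷ []) (rf 0 ⁻ ⊙ rf 0 ⊙ rf 0) (rf 0) refl

  N-gen∙-self : ∀ i w → N (gen i ∙ w) (gen i) ≡ not (N w (gen i))
  N-gen∙-self i w = trans (N-gen∙ i w (gen i)) (cong₂ _xor_ (δ-refl refl) (cong (N w) (conj-gen i)))

  toReduced : ∀ n ws → length ws ≤ n → ∃[ us ] us ⊆ ws × prod us ≡ prod ws × Reduced us
  toReduced n       []       _ = [] , [] , refl , []
  toReduced (suc n) (i ∷ ws) (s≤s ws≤n) with toReduced n ws ws≤n
  ... | us , us⊆ws , eq , red with N (prod us) (gen i) in d
  ...   | false = i ∷ us , refl ∷ us⊆ws , cong (gen i ∙_) eq , d ∷ red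
  ...   | true with exchange us (gen i) d
  ...     | xs , xs⊆us , eq′ , len with toReduced n xs (ℕ.≤-trans (ℕ.n≤1+n _) (ℕ.≤-trans (ℕ.≤-reflexive len) (ℕ.≤-trans (⊆-length us⊆ws) ws≤n)))
    where
    ⊆-length : ∀ {us ws : List I} → us ⊆ ws → length us ≤ length ws
    ⊆-length []          = z≤n
    ⊆-length (_ ∷ʳ p)    = ℕ.m≤n⇒m≤1+n (⊆-length p)
    ⊆-length (_ ∷ p)     = s≤s (⊆-length p)
  ...       | ys , ys⊆xs , eq″ , red′ = ys , i ∷ʳ ⊆-trans ys⊆xs (⊆-trans xs⊆us us⊆ws) ,
              trans eq″ (trans eq′ (cong (gen i ∙_) eq)) , red′

  Reduced-minimal : ∀ {ws} vs → Reduced ws → prod ws ≡ prod vs → length ws ≤ length vs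
  Reduced-minimal vs []      _  = z≤n
  Reduced-minimal {i ∷ ws} vs (d ∷ red) eq
    with exchange vs (gen i) (trans (cong (λ z → N z (gen i)) (sym eq)) (trans (N-gen∙-self i (prod ws)) (cong not d)))
  ... | us , _ , eq′ , len = ℕ.≤-trans
    (s≤s (Reduced-minimal us red (trans (sym (cancelˡ (gen² i) _)) (trans (cong (gen i ∙_) eq) (sym eq′)))))
    (ℕ.≤-reflexive len)

  reducedWord : ∀ w → ∃[ ws ] prod ws ≡ w × Reduced ws
  reducedWord w with generated w
  ... | ws , eq with toReduced (length ws) ws ℕ.≤-refl
  ... | us , _ , eq′ , red = us , trans eq′ eq , red

  abstract
    ℓ : W → ℕ
    ℓ w = length (proj₁ (reducedWord w))

    word : ∀ w → ∃[ ws ] prod ws ≡ w × Reduced ws × length ws ≡ ℓ w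
    word w = let (ws , eq , red) = reducedWord w in ws , eq , red , refl

  ℓ≤length : ∀ {w} vs → prod vs ≡ w → ℓ w ≤ length vs
  ℓ≤length {w} vs eq with word w
  ... | _ , eq′ , red , len = subst (_≤ length vs) len (Reduced-minimal vs red (trans eq′ (sym eq)))

  ℓ-Reduced : ∀ {ws} → Reduced ws → ℓ (prod ws) ≡ length ws
  ℓ-Reduced {ws} red with word (prod ws)
  ... | us , eq , _ , len = ℕ.≤-antisym (ℓ≤length ws refl) (ℕ.≤-trans (Reduced-minimal us red (sym eq)) (ℕ.≤-reflexive len))

  ℓ-HasLength : ∀ w → HasLength w (ℓ w)
  ℓ-HasLength w with word w
  ... | ws , eq , _ , len = (ws , eq , len) , λ vs → ℓ≤length vs

  HasLength-ℓ : ∀ {w k} → HasLength w k → k ≡ ℓ w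
  HasLength-ℓ {w} ((ws , eq , refl) , min) with word w
  ... | us , eq′ , _ , len = ℕ.≤-antisym (ℕ.≤-trans (min us eq′) (ℕ.≤-reflexive len)) (ℓ≤length ws eq)

  ℓ-∙ : ∀ a b → ℓ (a ∙ b) ≤ ℓ a +ℕ ℓ b
  ℓ-∙ a b with word a | word b
  ... | us , eq , _ , len | ws , eq′ , _ , len′ =
    ℕ.≤-trans (ℓ≤length (us ++ ws) (trans (prod-++ us ws) (cong₂ _∙_ eq eq′)))
              (ℕ.≤-reflexive (trans (List.length-++ us) (cong₂ _+ℕ_ len len′)))

  ℓ-⁻¹ : ∀ a → ℓ (a ⁻¹) ≡ ℓ a
  ℓ-⁻¹ a = ℕ.≤-antisym (bound a) (subst (λ z → ℓ z ≤ ℓ (a ⁻¹)) (⁻¹-involutive a) (bound (a ⁻¹)))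
    where
    bound : ∀ a → ℓ (a ⁻¹) ≤ ℓ a
    bound a with word a
    ... | ws , eq , _ , len = ℕ.≤-trans (ℓ≤length (reverse ws) (trans (prod-reverse ws) (cong _⁻¹ eq)))
                                        (ℕ.≤-reflexive (trans (List.length-reverse ws) len))

  ℓ-e : ℓ e ≡ 0
  ℓ-e = ℓ-Reduced []

  ℓ-gen : ∀ i → ℓ (gen i) ≤ 1
  ℓ-gen i = ℓ≤length [ i ] (prod-[] i)

  N⇒shorter : ∀ w t → N w t ≡ true → ℓ (t ∙ w) < ℓ w
  N⇒shorter w t h with word w
  ... | ws , eq , red , len with exchange ws t (subst (λ z → N z t ≡ true) (sym eq) h)
  ... | us , _ , eq′ , len′ = ℕ.≤-trans (s≤s (ℓ≤length us (trans eq′ (cong (t ∙_) eq)))) (ℕ.≤-reflexive (trans len′ len))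

  N-reflection : ∀ t → IsReflection t → N t t ≡ true
  N-reflection t (w , i , refl) =
    trans (N-∙ (w ∙ gen i) (w ⁻¹) t) (trans (cong₂ _xor_ (N-∙ w (gen i) t) (cong (N (w ⁻¹)) c₁))
      (trans (cong₂ (λ x y → (N w t xor x) xor y) (trans (N-gen i _) (δ-refl c₂)) (trans (cong (N (w ⁻¹)) (sym c₂)) (N-inverse w t)))
        (lemma (N w t))))
    where
    c₁ : conj (w ∙ gen i) t ≡ gen i
    c₁ = solve (w ∷ []) (i ∷ []) ((el 0 ⊙ rf 0) ⁻ ⊙ (el 0 ⊙ rf 0 ⊙ el 0 ⁻) ⊙ (el 0 ⊙ rf 0)) (rf 0) refl
    c₂ : conj w t ≡ gen i
    c₂ = solve (w ∷ []) (i ∷ []) (el 0 ⁻ ⊙ (el 0 ⊙ rf 0 ⊙ el 0 ⁻) ⊙ el 0) (rf 0) refl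
    lemma : ∀ x → (x xor true) xor x ≡ true
    lemma true  = refl
    lemma false = refl

  reflection² : ∀ t → IsReflection t → t ∙ t ≡ e
  reflection² t (w , i , refl) =
    solve (w ∷ []) (i ∷ []) ((el 0 ⊙ rf 0 ⊙ el 0 ⁻) ⊙ (el 0 ⊙ rf 0 ⊙ el 0 ⁻)) ε refl

  -- A reflection inverts itself, so multiplication by `t` toggles whether `t` is an inversion;
  -- `N⇒shorter` then applies to `t ∙ w`.
  ¬N⇒longer : ∀ w t → IsReflection t → N w t ≡ false → ℓ w < ℓ (t ∙ w)
  ¬N⇒longer w t r h = subst (λ z → ℓ z < ℓ (t ∙ w)) (cancelˡ (reflection² t r) w)
    (N⇒shorter (t ∙ w) t (trans (N-∙ t w t) (cong₂ _xor_ (N-reflection t r) (trans (cong (N w) c) h))))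
    where
    c : conj t t ≡ t
    c = solve (t ∷ []) [] (el 0 ⁻ ⊙ el 0 ⊙ el 0) (el 0) refl

  gen-reflection : ∀ i → IsReflection (gen i)
  gen-reflection i = e , i , solve [] (i ∷ []) (rf 0) (ε ⊙ rf 0 ⊙ ε ⁻) refl

  N⇒reflection : ∀ w t → N w t ≡ true → IsReflection t
  N⇒reflection w t h with generated w
  ... | ws , refl = go ws t h
    where
    go : ∀ ws t → N (prod ws) t ≡ true → IsReflection t
    go [] t h = ⊥-elim (true≢false h (N-e t))
    go (i ∷ ws) t h with t ≟ gen i
    ... | yes refl = gen-reflection i
    ... | no  t≢i with go ws (conj (gen i) t) (trans (trans (cong (_xor N (prod ws) (conj (gen i) t)) (sym (δ-≢ t≢i))) (sym (N-gen∙ i (prod ws) t))) h)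
    ...   | w , j , eq = gen i ∙ w , j , trans (solve (t ∷ []) (i ∷ []) (el 0) (rf 0 ⊙ (rf 0 ⁻ ⊙ el 0 ⊙ rf 0) ⊙ rf 0 ⁻) refl)
              (trans (cong (λ z → gen i ∙ z ∙ gen i ⁻¹) eq)
                (solve (w ∷ []) (i ∷ j ∷ []) (rf 0 ⊙ (el 0 ⊙ rf 1 ⊙ el 0 ⁻) ⊙ rf 0 ⁻) (rf 0 ⊙ el 0 ⊙ rf 1 ⊙ (rf 0 ⊙ el 0) ⁻) refl))

  N⇒LeftInversion : ∀ w t → N w t ≡ true → LeftInversion w t
  N⇒LeftInversion w t h = N⇒reflection w t h , ℓ (t ∙ w) , ℓ w , ℓ-HasLength _ , ℓ-HasLength _ , N⇒shorter w t h

  LeftInversion⇒N : ∀ w t → LeftInversion w t → N w t ≡ true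
  LeftInversion⇒N w t (r , k , l , hk , hl , k<l) with N w t in h
  ... | true  = refl
  ... | false = ⊥-elim (ℕ.<-asym (¬N⇒longer w t r h) (subst₂ _<_ (HasLength-ℓ hk) (HasLength-ℓ hl) k<l))

  ℓ-desc : ∀ w i → N w (gen i) ≡ true → suc (ℓ (gen i ∙ w)) ≡ ℓ w
  ℓ-desc w i h = ℕ.≤-antisym (N⇒shorter w (gen i) h)
    (subst (λ z → ℓ z ≤ suc (ℓ (gen i ∙ w))) (cancelˡ (gen² i) w)
      (ℕ.≤-trans (ℓ-∙ (gen i) (gen i ∙ w)) (ℕ.+-monoˡ-≤ _ (ℓ-gen i))))

  ℓ-asc : ∀ w i → N w (gen i) ≡ false → ℓ (gen i ∙ w) ≡ suc (ℓ w)
  ℓ-asc w i h = ℕ.≤-antisym (ℕ.≤-trans (ℓ-∙ (gen i) w) (ℕ.+-monoˡ-≤ _ (ℓ-gen i)))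
    (¬N⇒longer w (gen i) (gen-reflection i) h)

  shorter⇒N : ∀ w i → ℓ (gen i ∙ w) < ℓ w → N w (gen i) ≡ true
  shorter⇒N w i lt with N w (gen i) in h
  ... | true  = refl
  ... | false = ⊥-elim (ℕ.<-asym lt (¬N⇒longer w (gen i) (gen-reflection i) h))

  longer⇒¬N : ∀ w i → ℓ w < ℓ (gen i ∙ w) → N w (gen i) ≡ false
  longer⇒¬N w i lt with N w (gen i) in h
  ... | false = refl
  ... | true  = ⊥-elim (ℕ.<-asym lt (N⇒shorter w (gen i) h))

  -- Right descents of w are left descents of its inverse.
  D : W → I → Bool
  D w i = N (w ⁻¹) (gen i)

  infix 9 _^[_]
  _^[_] : I → W → W
  i ^[ w ] = w ∙ gen i ∙ w ⁻¹

  D≡N : ∀ w i → D w i ≡ N w (i ^[ w ])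
  D≡N w i = trans (cong (N (w ⁻¹)) (solve (w ∷ []) (i ∷ []) (rf 0) (el 0 ⁻ ⊙ (el 0 ⊙ rf 0 ⊙ el 0 ⁻) ⊙ el 0) refl)) (N-inverse w (i ^[ w ]))

  N-∙gen : ∀ w i t → N (w ∙ gen i) t ≡ N w t xor δ t (i ^[ w ])
  N-∙gen w i t = trans (N-∙ w (gen i) t) (cong (N w t xor_) (trans (N-gen i _) (δ-cong
    (λ eq → trans (solve (w ∷ t ∷ []) [] (el 1) (el 0 ⊙ (el 0 ⁻ ⊙ el 1 ⊙ el 0) ⊙ el 0 ⁻) refl) (cong (λ z → w ∙ z ∙ w ⁻¹) eq))
    (λ eq → trans (cong (conj w) eq) (solve (w ∷ []) (i ∷ []) (el 0 ⁻ ⊙ (el 0 ⊙ rf 0 ⊙ el 0 ⁻) ⊙ el 0) (rf 0) refl)))))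

  ∙gen-⁻¹ : ∀ w i → (w ∙ gen i) ⁻¹ ≡ gen i ∙ w ⁻¹
  ∙gen-⁻¹ w i = solve (w ∷ []) (i ∷ []) ((el 0 ⊙ rf 0) ⁻) (rf 0 ⊙ el 0 ⁻) refl

  ∙gen∙gen : ∀ w i → w ∙ gen i ∙ gen i ≡ w
  ∙gen∙gen w i = solve (w ∷ []) (i ∷ []) (el 0 ⊙ rf 0 ⊙ rf 0) (el 0) refl

  ℓ-∙gen : ∀ w i → ℓ (w ∙ gen i) ≡ ℓ (gen i ∙ w ⁻¹)
  ℓ-∙gen w i = trans (sym (ℓ-⁻¹ _)) (cong ℓ (∙gen-⁻¹ w i))

  ℓ-descʳ : ∀ w i → D w i ≡ true → suc (ℓ (w ∙ gen i)) ≡ ℓ w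
  ℓ-descʳ w i h = trans (cong suc (ℓ-∙gen w i)) (trans (ℓ-desc (w ⁻¹) i h) (ℓ-⁻¹ w))

  ℓ-ascʳ : ∀ w i → D w i ≡ false → ℓ (w ∙ gen i) ≡ suc (ℓ w)
  ℓ-ascʳ w i h = trans (ℓ-∙gen w i) (trans (ℓ-asc (w ⁻¹) i h) (cong suc (ℓ-⁻¹ w)))

  shorter⇒D : ∀ w i → ℓ (w ∙ gen i) < ℓ w → D w i ≡ true
  shorter⇒D w i lt = shorter⇒N (w ⁻¹) i (subst₂ _<_ (ℓ-∙gen w i) (sym (ℓ-⁻¹ w)) lt)

  longer⇒¬D : ∀ w i → ℓ w < ℓ (w ∙ gen i) → D w i ≡ false
  longer⇒¬D w i lt = longer⇒¬N (w ⁻¹) i (subst₂ _<_ (sym (ℓ-⁻¹ w)) (ℓ-∙gen w i) lt)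

  abstract
    maxℓ : ℕ
    maxℓ = foldr (λ w n → ℓ w ⊔ℕ n) 0 elemsW

    ℓ≤maxℓ : ∀ w → ℓ w ≤ maxℓ
    ℓ≤maxℓ w = go elemsW (allW w)
      where
      go : ∀ xs → w ∈ xs → ℓ w ≤ foldr (λ w n → ℓ w ⊔ℕ n) 0 xs
      go (x ∷ xs) (here refl) = ℕ.m≤m⊔n (ℓ x) _
      go (x ∷ xs) (there w∈)  = ℕ.≤-trans (go xs w∈) (ℕ.m≤n⊔m (ℓ x) _)

  All-reverse : {P : I → Set} {ws : List I} → All P ws → All P (reverse ws)
  All-reverse []                       = []
  All-reverse {P} {i ∷ ws} (p ∷ ps) = subst (All P) (sym (List.unfold-reverse i ws)) (All.++⁺ (All-reverse ps) (p ∷ []))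

  -- Longest elements of parabolic cosets

  module Parabolic (P : I → Set) (P? : ∀ i → Dec (P i)) where

    Maximal : W → Set
    Maximal x = ∀ i → P i → D x i ≡ true

    -- Ascents by letters of `P` are followed until there are none; `n` bounds how far the length
    -- can still grow below `maxℓ`.
    climb : ∀ n x → maxℓ ≤ n +ℕ ℓ x → ∃[ ws ] All P ws × Maximal (x ∙ prod ws) × ℓ x ≤ ℓ (x ∙ prod ws)
    climb n x bound with Fin.any? (λ i → P? i ×-dec (D x i Bool.≟ false))
    climb n x bound | no none = [] , [] , subst Maximal (sym (identityʳ x)) max , ℕ.≤-reflexive (cong ℓ (sym (identityʳ x)))
      where
      max : Maximal x
      max i p with D x i in d
      ... | true  = refl
      ... | false = ⊥-elim (none (i , p , d))
    climb zero x bound | yes (i , p , d) =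
      ⊥-elim (ℕ.<-irrefl refl (ℕ.≤-trans (ℕ.≤-reflexive (sym (ℓ-ascʳ x i d))) (ℕ.≤-trans (ℓ≤maxℓ _) bound)))
    climb (suc n) x bound | yes (i , p , d)
      with climb n (x ∙ gen i) (ℕ.≤-trans bound (ℕ.≤-reflexive (trans (sym (ℕ.+-suc n (ℓ x))) (cong (n +ℕ_) (sym (ℓ-ascʳ x i d))))))
    ... | ws , ps , max , le = i ∷ ws , p ∷ ps , subst Maximal (assoc _ _ _) max ,
      ℕ.≤-trans (ℕ.n≤1+n _) (ℕ.≤-trans (ℕ.≤-reflexive (sym (ℓ-ascʳ x i d))) (subst (λ z → ℓ (x ∙ gen i) ≤ ℓ z) (assoc _ _ _) le))

    -- The reflections here are the conjugates under `x` of those of the parabolic subgroup, that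
    -- is, the ones which by left multiplication move `x` within its coset.
    InvertsAll : W → Set
    InvertsAll x = ∀ ws i → All P ws → P i → N x (i ^[ x ∙ prod ws ]) ≡ true

    -- Every letter stripped off is a descent: its reflection is inverted by `x` by assumption and
    -- not by the part already stripped, since the word is reduced.
    InvertsAll⇒ℓ : ∀ x → InvertsAll x → ∀ ws → All P ws → Reduced ws → ℓ (x ∙ prod ws ⁻¹) +ℕ length ws ≡ ℓ x
    InvertsAll⇒ℓ x full [] _ _ = trans (ℕ.+-identityʳ _) (cong ℓ (solve (x ∷ []) [] (el 0 ⊙ ε ⁻) (el 0) refl))
    InvertsAll⇒ℓ x full (i ∷ ws) (p ∷ ps) (d ∷ red) = trans (ℕ.+-suc _ _)
      (trans (cong (λ z → suc (ℓ z +ℕ length ws)) (solve (x ∷ prod ws ∷ []) (i ∷ []) (el 0 ⊙ (rf 0 ⊙ el 1) ⁻) (el 0 ⊙ el 1 ⁻ ⊙ rf 0) refl))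
        (trans (cong (_+ℕ length ws) (ℓ-descʳ y i dy)) (InvertsAll⇒ℓ x full ws ps red)))
      where
      q = prod ws ⁻¹
      y = x ∙ q
      dy : D y i ≡ true
      dy = trans (D≡N y i) (trans (N-∙ x q (i ^[ y ])) (cong₂ _xor_
        (subst (λ z → N x (i ^[ x ∙ z ]) ≡ true) (prod-reverse ws) (full (reverse ws) i (All-reverse ps) p))
        (trans (cong (N q) (solve (x ∷ q ∷ []) (i ∷ []) (el 0 ⁻ ⊙ (el 0 ⊙ el 1 ⊙ rf 0 ⊙ (el 0 ⊙ el 1) ⁻) ⊙ el 0) (el 1 ⊙ rf 0 ⊙ el 1 ⁻) refl))
          (trans (sym (D≡N q i)) (trans (cong (λ z → N z (gen i)) (⁻¹-involutive _)) d)))))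

    reducedInverse : ∀ ws → All P ws → ∃[ us ] All P us × Reduced us × prod us ⁻¹ ≡ prod ws × length us ≡ ℓ (prod ws)
    reducedInverse ws ps with toReduced (length (reverse ws)) (reverse ws) ℕ.≤-refl
    ... | us , us⊆ , eq , red = us , All-resp-⊆ us⊆ (All-reverse ps) , red ,
      trans (cong _⁻¹ eq′) (⁻¹-involutive _) ,
      trans (sym (ℓ-Reduced red)) (trans (cong ℓ eq′) (ℓ-⁻¹ _))
      where
      eq′ : prod us ≡ prod ws ⁻¹
      eq′ = trans eq (prod-reverse ws)

    -- If x were not inverted by some reflection of the parabolic subgroup, then climbing from the
    -- longer element of its coset reaches a strictly longer maximal element, below which x lies by
    -- induction, so that x has an ascent.
    Maximal⇒InvertsAll : ∀ n x → maxℓ ≤ n +ℕ ℓ x → Maximal x → InvertsAll x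
    Maximal⇒InvertsAll n x bound max ws i ps p with N x (i ^[ x ∙ prod ws ]) in d
    ... | true  = refl
    ... | false with climb maxℓ y (ℕ.m≤m+n maxℓ (ℓ y))
      where
      y = i ^[ x ∙ prod ws ] ∙ x
    ...   | us , us-P , max′ , le = ⊥-elim (impossible n bound)
      where
      t y z : W
      t = i ^[ x ∙ prod ws ]
      y = t ∙ x
      z = y ∙ prod us
      x<z : ℓ x < ℓ z
      x<z = ℕ.≤-trans (¬N⇒longer x t (x ∙ prod ws , i , refl) d) le
      vs : List I
      vs = reverse (ws ++ i ∷ reverse ws ++ us)
      vs-P : All P vs
      vs-P = All-reverse (All.++⁺ ps (p ∷ All.++⁺ (All-reverse ps) us-P))
      x≡zv : x ≡ z ∙ prod vs
      x≡zv = sym (trans (cong (z ∙_) (trans (prod-reverse (ws ++ i ∷ reverse ws ++ us))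
          (cong _⁻¹ (trans (prod-++ ws _) (cong (λ q → prod ws ∙ (gen i ∙ q)) (trans (prod-++ (reverse ws) us) (cong (_∙ prod us) (prod-reverse ws))))))))
        (solve (x ∷ prod ws ∷ prod us ∷ []) (i ∷ [])
          ((el 0 ⊙ el 1 ⊙ rf 0 ⊙ (el 0 ⊙ el 1) ⁻ ⊙ el 0 ⊙ el 2) ⊙ (el 1 ⊙ (rf 0 ⊙ (el 1 ⁻ ⊙ el 2))) ⁻) (el 0) refl))
      contra : InvertsAll z → ⊥
      contra full with reducedInverse vs vs-P
      ... | [] , _ , _ , eq , _ = ℕ.<-irrefl (cong ℓ (trans x≡zv (trans (cong (z ∙_) (sym eq)) (solve (z ∷ []) [] (el 0 ⊙ ε ⁻) (el 0) refl)))) x<z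
      ... | j ∷ js , pj ∷ pjs , r@(_ ∷ red) , eq , _ = ℕ.<-irrefl refl
          (ℕ.<-trans (ℕ.≤-reflexive (ℓ-descʳ x j (max j pj))) (ℕ.≤-reflexive (ℕ.+-cancelʳ-≡ (length js) _ _ sizes)))
        where
        xj : x ∙ gen j ≡ z ∙ prod js ⁻¹
        xj = trans (cong (_∙ gen j) (trans x≡zv (cong (z ∙_) (sym eq))))
          (solve (z ∷ prod js ∷ []) (j ∷ []) (el 0 ⊙ (rf 0 ⊙ el 1) ⁻ ⊙ rf 0) (el 0 ⊙ el 1 ⁻) refl)
        sizes : suc (ℓ x) +ℕ length js ≡ ℓ (x ∙ gen j) +ℕ length js
        sizes = trans (sym (ℕ.+-suc (ℓ x) (length js)))
          (trans (cong (λ w → ℓ w +ℕ suc (length js)) (trans x≡zv (cong (z ∙_) (sym eq))))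
            (trans (InvertsAll⇒ℓ z full (j ∷ js) (pj ∷ pjs) r)
              (trans (sym (InvertsAll⇒ℓ z full js pjs red)) (cong (λ w → ℓ w +ℕ length js) (sym xj)))))
      impossible : ∀ n → maxℓ ≤ n +ℕ ℓ x → ⊥
      impossible zero    b = ℕ.<-irrefl refl (ℕ.<-≤-trans x<z (ℕ.≤-trans (ℓ≤maxℓ z) b))
      impossible (suc n) b = contra (Maximal⇒InvertsAll n z
        (ℕ.≤-trans b (ℕ.≤-trans (ℕ.≤-reflexive (sym (ℕ.+-suc n (ℓ x)))) (ℕ.+-monoʳ-≤ n x<z))) max′)

    -- The length formula behind all later descent arguments. All letters give the longest element,
    -- two letters give local meets and braids, and a letter with its neighbours gives the drop in
    -- length under a star.
    Maximal-ℓ : ∀ x → Maximal x → ∀ ws → All P ws → ℓ (x ∙ prod ws) +ℕ ℓ (prod ws) ≡ ℓ x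
    Maximal-ℓ x max ws ps with reducedInverse ws ps
    ... | us , us-P , red , eq , len = trans (cong₂ (λ a b → ℓ (x ∙ a) +ℕ b) (sym eq) (sym len))
      (InvertsAll⇒ℓ x (Maximal⇒InvertsAll maxℓ x (ℕ.m≤m+n maxℓ (ℓ x)) max) us us-P red)

  -- The weak order and its meets

  infix 4 _⊑_
  _⊑_ : W → W → Set
  u ⊑ v = ∀ t → N u t ≡ true → N v t ≡ true

  ⊑⇒≤w : ∀ {u v} → u ⊑ v → u ≤w v
  ⊑⇒≤w {u} {v} p t h = N⇒LeftInversion v t (p t (LeftInversion⇒N u t h))

  ≤w⇒⊑ : ∀ {u v} → u ≤w v → u ⊑ v
  ≤w⇒⊑ {u} {v} p t h = LeftInversion⇒N v t (p t (N⇒LeftInversion u t h))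

  ⊑-refl : ∀ {u} → u ⊑ u
  ⊑-refl t h = h

  ⊑-trans : ∀ {u v w} → u ⊑ v → v ⊑ w → u ⊑ w
  ⊑-trans p q t h = q t (p t h)

  ⊑-asc : ∀ u i → D u i ≡ false → u ⊑ u ∙ gen i
  ⊑-asc u i d t h = trans (N-∙gen u i t) (trans (cong₂ _xor_ h (δ-≢ λ { refl → true≢false h (trans (sym (D≡N u i)) d) })) refl)

  ⊑-desc : ∀ w i → D w i ≡ true → w ∙ gen i ⊑ w
  ⊑-desc w i d t h with t ≟ i ^[ w ]
  ... | yes refl = trans (sym (D≡N w i)) d
  ... | no  t≢   = trans (sym (Bool.xor-identityʳ _)) (trans (cong (N w t xor_) (sym (δ-≢ t≢))) (trans (sym (N-∙gen w i t)) h))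

  additive⇒⊑ : ∀ u g → ℓ (u ∙ g) ≡ ℓ u +ℕ ℓ g → u ⊑ u ∙ g
  additive⇒⊑ u g eq with word g
  ... | ws , refl , _ , len = go u ws (trans eq (cong (ℓ u +ℕ_) (sym len)))
    where
    go : ∀ u ws → ℓ (u ∙ prod ws) ≡ ℓ u +ℕ length ws → u ⊑ u ∙ prod ws
    go u []       eq = subst (u ⊑_) (sym (identityʳ u)) ⊑-refl
    go u (i ∷ ws) eq = subst (u ⊑_) (assoc _ _ _) (⊑-trans (⊑-asc u i d)
        (go (u ∙ gen i) ws (trans (cong ℓ (assoc _ _ _)) (trans eq (trans (ℕ.+-suc _ _) (cong (_+ℕ length ws) (sym (ℓ-ascʳ u i d))))))))
      where
      d : D u i ≡ false
      d = longer⇒¬D u i (ℕ.+-cancelʳ-≤ (length ws) _ _ (ℕ.≤-trans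
        (ℕ.≤-reflexive (trans (sym (ℕ.+-suc (ℓ u) (length ws))) (trans (sym eq) (cong ℓ (sym (assoc _ _ _))))))
        (ℕ.≤-trans (ℓ-∙ (u ∙ gen i) (prod ws)) (ℕ.+-monoʳ-≤ _ (ℓ≤length ws refl)))))

  ⊑⇒additive : ∀ u v → u ⊑ v → ℓ v ≡ ℓ u +ℕ ℓ (u ⁻¹ ∙ v)
  ⊑⇒additive u v u⊑v with word (u ⁻¹)
  ... | us , eq , red , len = trans (go us red (subst (_⊑ v) (trans (sym (⁻¹-involutive u)) (cong _⁻¹ (sym eq))) u⊑v))
      (cong₂ _+ℕ_ (trans len (ℓ-⁻¹ u)) (cong (λ z → ℓ (z ∙ v)) eq))
    where
    go : ∀ us → Reduced us → prod us ⁻¹ ⊑ v → ℓ v ≡ length us +ℕ ℓ (prod us ∙ v)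
    go [] _ _ = cong ℓ (sym (identityˡ v))
    go (i ∷ us) (d ∷ red) le = trans (go us red (⊑-trans (⊑-asc u′ i du′) le′))
        (trans (cong (length us +ℕ_) (trans (sym (ℓ-desc x i dx)) (cong (λ z → suc (ℓ z)) (sym (assoc _ _ _))))) (ℕ.+-suc _ _))
      where
      u′ = prod us ⁻¹
      x = prod us ∙ v
      t = i ^[ u′ ]
      du′ : D u′ i ≡ false
      du′ = trans (cong (λ z → N z (gen i)) (⁻¹-involutive _)) d
      le′ : u′ ∙ gen i ⊑ v
      le′ = subst (_⊑ v) (solve (prod us ∷ []) (i ∷ []) ((rf 0 ⊙ el 0) ⁻) (el 0 ⁻ ⊙ rf 0) refl) le
      Nu′ : N u′ t ≡ false
      Nu′ = trans (sym (D≡N u′ i)) du′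
      dx : N x (gen i) ≡ true
      dx = trans (cong (N x) (solve (u′ ∷ []) (i ∷ []) (rf 0) (el 0 ⁻ ⊙ (el 0 ⊙ rf 0 ⊙ el 0 ⁻) ⊙ el 0) refl))
        (trans (cong (_xor N x (conj u′ t)) (sym Nu′)) (trans (sym (N-∙ u′ x t))
          (trans (cong (λ z → N z t) (solve (prod us ∷ v ∷ []) [] (el 0 ⁻ ⊙ (el 0 ⊙ el 1)) (el 1) refl))
            (le′ t (trans (N-∙gen u′ i t) (cong₂ _xor_ Nu′ (δ-refl refl)))))))

  leftDescent : ∀ w → w ≢ e → ∃[ i ] N w (gen i) ≡ true
  leftDescent w w≢e with word w
  ... | []     , eq , _       , _ = ⊥-elim (w≢e (sym eq))
  ... | i ∷ us , eq , (d ∷ _) , _ = i , trans (cong (λ z → N z (gen i)) (sym eq)) (trans (N-gen∙-self i (prod us)) (cong not d))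

  -- The descent is the last letter of a reduced word for `y ⁻¹ ∙ x`.
  below-descent : ∀ y x → y ⊑ x → y ≢ x → ∃[ i ] D x i ≡ true × y ⊑ x ∙ gen i
  below-descent y x y⊑x y≢x with leftDescent (g ⁻¹) g⁻¹≢e
    where
    g = y ⁻¹ ∙ x
    g⁻¹≢e : g ⁻¹ ≢ e
    g⁻¹≢e eq = y≢x (trans (solve (x ∷ y ∷ []) [] (el 1) (el 0 ⊙ (el 1 ⁻ ⊙ el 0) ⁻) refl) (trans (cong (x ∙_) eq) (identityʳ x)))
  ... | i , dg = i , shorter⇒D x i (ℕ.≤-reflexive (trans (cong suc additive) len)) , subst (y ⊑_) (sym eq) (additive⇒⊑ y (g ∙ gen i) (trans (cong ℓ (sym eq)) additive))
    where
    g = y ⁻¹ ∙ x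
    eq : x ∙ gen i ≡ y ∙ (g ∙ gen i)
    eq = solve (x ∷ y ∷ []) (i ∷ []) (el 0 ⊙ rf 0) (el 1 ⊙ (el 1 ⁻ ⊙ el 0 ⊙ rf 0)) refl
    len : suc (ℓ y +ℕ ℓ (g ∙ gen i)) ≡ ℓ x
    len = trans (sym (ℕ.+-suc _ _)) (trans (cong (ℓ y +ℕ_) (ℓ-descʳ g i dg)) (sym (⊑⇒additive y x y⊑x)))
    additive : ℓ (x ∙ gen i) ≡ ℓ y +ℕ ℓ (g ∙ gen i)
    additive = ℕ.≤-antisym (ℕ.≤-trans (ℕ.≤-reflexive (cong ℓ eq)) (ℓ-∙ y _))
      (s≤s⁻¹ (ℕ.≤-trans (ℕ.≤-reflexive len) (lower x)))
      where
      lower : ∀ x → ℓ x ≤ suc (ℓ (x ∙ gen i))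
      lower x with D x i in d
      ... | true  = ℕ.≤-reflexive (sym (ℓ-descʳ x i d))
      ... | false = ℕ.m≤n⇒m≤1+n (ℕ.≤-trans (ℕ.n≤1+n _) (ℕ.≤-reflexive (sym (ℓ-ascʳ x i d))))

  maximal-⊑ : ∀ x → (∀ i → N x (gen i) ≡ true) → ∀ w → w ⊑ x
  maximal-⊑ x max w with generated w
  ... | ws , refl = subst (prod ws ⊑_) (solve (x ∷ prod ws ∷ []) [] (el 1 ⊙ (el 1 ⁻ ⊙ el 0)) (el 0) refl)
      (additive⇒⊑ (prod ws) (prod ws ⁻¹ ∙ x) (trans (cong ℓ (solve (x ∷ prod ws ∷ []) [] (el 1 ⊙ (el 1 ⁻ ⊙ el 0)) (el 0) refl))
        (trans (sym (ℓ-⁻¹ x)) (trans (sym (Maximal-ℓ (x ⁻¹) (λ i _ → trans (cong (λ z → N z (gen i)) (⁻¹-involutive x)) (max i)) ws (all-⊤ ws)))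
          (trans (ℕ.+-comm _ (ℓ (prod ws))) (cong (ℓ (prod ws) +ℕ_) (trans (sym (ℓ-⁻¹ _)) (cong ℓ (solve (x ∷ prod ws ∷ []) [] ((el 0 ⁻ ⊙ el 1) ⁻) (el 1 ⁻ ⊙ el 0) refl)))))))))
    where
    open Parabolic (λ _ → ⊤) (λ _ → yes tt)
    all-⊤ : ∀ ws → All (λ _ → ⊤) ws
    all-⊤ []       = []
    all-⊤ (_ ∷ ws) = tt ∷ all-⊤ ws

  ∃-maximal : ∃[ x ] (∀ w → w ⊑ x)
  ∃-maximal with Parabolic.climb (λ _ → ⊤) (λ _ → yes tt) maxℓ e (ℕ.m≤m+n maxℓ (ℓ e))
  ... | ws , _ , max , _ = (e ∙ prod ws) ⁻¹ , maximal-⊑ _ (λ i → max i tt)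

  IsMeet : W → W → W → Set
  IsMeet u v z = z ⊑ u × z ⊑ v × (∀ y → y ⊑ u → y ⊑ v → y ⊑ z)

  module LocalMeet (a : W) (i j : I) (di : D a i ≡ true) (dj : D a j ≡ true) where
    P : I → Set
    P k = (k ≡ i) ⊎ (k ≡ j)

    open Parabolic P (λ k → (k Fin.≟ i) ⊎-dec (k Fin.≟ j))

    private
      longest = climb maxℓ e (ℕ.m≤m+n maxℓ (ℓ e))
      ws = proj₁ longest
      ws-P = proj₁ (proj₂ longest)

    w₀ : W
    w₀ = prod ws

    w₀-max : Maximal w₀
    w₀-max = subst Maximal (identityˡ w₀) (proj₁ (proj₂ (proj₂ longest)))

    -- The shortest element of the coset of `a` under the two generators: both are descents of `a`,
    -- so `a` is the longest one.
    m₀ : W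
    m₀ = a ∙ w₀

    below : ∀ x → Maximal x → ℓ (x ∙ w₀) +ℕ ℓ w₀ ≡ ℓ x
    below x max = Maximal-ℓ x max ws ws-P

    a-max : Maximal a
    a-max k (inj₁ refl) = di
    a-max k (inj₂ refl) = dj

    m₀⊑ : ∀ k → P k → m₀ ⊑ a ∙ gen k
    m₀⊑ k pk = subst (m₀ ⊑_) (sym eq) (additive⇒⊑ m₀ (w₀ ⁻¹ ∙ gen k)
        (ℕ.≤-antisym (ℓ-∙ m₀ _) (ℕ.+-cancelʳ-≤ 1 _ _ (ℕ.≤-trans (ℕ.≤-reflexive (ℕ.+-assoc (ℓ m₀) _ 1))
          (ℕ.≤-trans (ℕ.+-monoʳ-≤ (ℓ m₀) (ℕ.≤-trans (ℕ.≤-reflexive (ℕ.+-comm _ 1)) left))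
            (ℕ.≤-reflexive (trans (below a a-max) (trans (sym (ℓ-descʳ a k (a-max k pk))) (trans (cong (λ z → suc (ℓ z)) eq) (ℕ.+-comm 1 _))))))))))
      where
      eq : a ∙ gen k ≡ m₀ ∙ (w₀ ⁻¹ ∙ gen k)
      eq = solve (a ∷ w₀ ∷ []) (k ∷ []) (el 0 ⊙ rf 0) (el 0 ⊙ el 1 ⊙ (el 1 ⁻ ⊙ rf 0)) refl
      us : List I
      us = reverse ws ++ k ∷ ws
      us≡ : prod us ≡ w₀ ⁻¹ ∙ (gen k ∙ w₀)
      us≡ = trans (prod-++ (reverse ws) (k ∷ ws)) (cong (_∙ (gen k ∙ w₀)) (prod-reverse ws))
      shorter : ℓ (gen k ∙ w₀) +ℕ ℓ (prod us) ≡ ℓ w₀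
      shorter = trans (cong (λ z → ℓ z +ℕ ℓ (prod us)) (sym (trans (cong (w₀ ∙_) us≡) (cancelˡ (inverseʳ w₀) _))))
        (Maximal-ℓ w₀ w₀-max us (All.++⁺ (All-reverse ws-P) (pk ∷ ws-P)))
      -- sₖ w₀ lies in the parabolic subgroup and differs from w₀ in length
      desc : N w₀ (gen k) ≡ true
      desc with N w₀ (gen k) in d
      ... | true  = refl
      ... | false = ⊥-elim (ℕ.<-irrefl refl (ℕ.≤-trans (ℕ.≤-reflexive (sym (ℓ-asc w₀ k d))) (ℕ.≤-trans (ℕ.m≤m+n _ _) (ℕ.≤-reflexive shorter))))
      left : suc (ℓ (w₀ ⁻¹ ∙ gen k)) ≤ ℓ w₀
      left = ℕ.≤-reflexive (trans (cong suc (trans (sym (ℓ-⁻¹ _)) (cong ℓ (solve (w₀ ∷ []) (k ∷ []) ((el 0 ⁻ ⊙ rf 0) ⁻) (rf 0 ⊙ el 0) refl)))) (ℓ-desc w₀ k desc))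

    -- Lying below both elements makes both letters right descents of `y ⁻¹ ∙ a`. Hence `w₀` can be
    -- split off from this element with its full length, just as from `a`.
    greatest : ∀ y → y ⊑ a ∙ gen i → y ⊑ a ∙ gen j → y ⊑ m₀
    greatest y yi yj = subst (y ⊑_) eq (additive⇒⊑ y (x ∙ w₀) (ℕ.+-cancelʳ-≡ (ℓ w₀) _ _
        (trans (cong (λ z → ℓ z +ℕ ℓ w₀) eq) (trans (below a a-max) (trans (⊑⇒additive y a y⊑a)
          (trans (cong (ℓ y +ℕ_) (sym (below x x-max))) (sym (ℕ.+-assoc (ℓ y) _ _))))))))
      where
      x = y ⁻¹ ∙ a
      y⊑a : y ⊑ a
      y⊑a = ⊑-trans yi (⊑-desc a i di)
      eq : y ∙ (x ∙ w₀) ≡ m₀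
      eq = solve (a ∷ y ∷ w₀ ∷ []) [] (el 1 ⊙ (el 1 ⁻ ⊙ el 0 ⊙ el 2)) (el 0 ⊙ el 2) refl
      desc : ∀ k → D a k ≡ true → y ⊑ a ∙ gen k → D x k ≡ true
      desc k dk yk = shorter⇒D x k (ℕ.+-cancelˡ-≤ (ℓ y) _ _ (ℕ.≤-reflexive
        (trans (ℕ.+-suc (ℓ y) _) (trans (cong (λ z → suc (ℓ y +ℕ ℓ z)) (assoc _ _ _))
          (trans (cong suc (sym (⊑⇒additive y (a ∙ gen k) yk))) (trans (ℓ-descʳ a k dk) (⊑⇒additive y a y⊑a)))))))
      x-max : Maximal x
      x-max k (inj₁ refl) = desc k di yi
      x-max k (inj₂ refl) = desc k dj yj

  abstract
    localMeet : ∀ a i j → D a i ≡ true → D a j ≡ true → ∃[ x ] IsMeet (a ∙ gen i) (a ∙ gen j) x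
    localMeet a i j di dj = m₀ , m₀⊑ i (inj₁ refl) , m₀⊑ j (inj₂ refl) , greatest
      where open LocalMeet a i j di dj

  -- Local meets suffice by induction from above: with `c` the meet of the two elements reached by
  -- the descents, the meet of `y` and `c` is formed below the first, and its meet with `z` below
  -- the second.
  meet-below : ∀ n a y z → ℓ a ≤ n → y ⊑ a → z ⊑ a → ∃[ x ] IsMeet y z x
  meet-below n a y z bound ya za with y ≟ a | z ≟ a
  ... | yes refl | _ = z , za , ⊑-refl , λ _ _ q → q
  ... | no _ | yes refl = y , ⊑-refl , ya , λ _ p _ → p
  ... | no y≢a | no z≢a = step n bound (below-descent y a ya y≢a) (below-descent z a za z≢a)
    where
    step : ∀ n → ℓ a ≤ n → ∃[ i ] D a i ≡ true × y ⊑ a ∙ gen i → ∃[ j ] D a j ≡ true × z ⊑ a ∙ gen j → ∃[ x ] IsMeet y z x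
    step zero    b (i , di , _) _ = ⊥-elim (ℕ.n≮0 (ℕ.≤-trans (ℕ.≤-reflexive (ℓ-descʳ a i di)) b))
    step (suc n) b (i , di , yi) (j , dj , zj) =
      let (c , ci , cj , c-max) = localMeet a i j di dj
          (k , k⊑y , k⊑c , k-max) = meet-below n (a ∙ gen i) y c (bound′ i di) yi ci
          (x , x⊑k , x⊑z , x-max) = meet-below n (a ∙ gen j) k z (bound′ j dj) (⊑-trans {k} {c} k⊑c cj) zj
      in x , ⊑-trans {x} {k} x⊑k k⊑y , x⊑z , λ u u⊑y u⊑z →
           x-max u (k-max u u⊑y (c-max u (⊑-trans {u} {y} u⊑y yi) (⊑-trans {u} {z} u⊑z zj))) u⊑z
      where
      bound′ : ∀ i → D a i ≡ true → ℓ (a ∙ gen i) ≤ n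
      bound′ i di = s≤s⁻¹ (ℕ.≤-trans (ℕ.≤-reflexive (ℓ-descʳ a i di)) b)

  -- A quotient map is assumed to respect those meets that exist, so their existence has to be
  -- supplied before fibres can have least elements.
  meet : ∀ y z → ∃[ x ] IsMeet y z x
  meet y z = let (w , top) = ∃-maximal in meet-below (ℓ w) w y z ℕ.≤-refl (top y) (top z)

  open DecMembership (Fin._≟_ {rank}) using (_∈?_)
  open Distinct C using (gen-injective)

  -- Commuting generators and short braid words

  Commute : W → W → Set
  Commute a b = a ∙ b ≡ b ∙ a

  Adj : I → I → Set
  Adj i j = ¬ Commute (gen i) (gen j)

  commute? : ∀ i j → Dec (Commute (gen i) (gen j))
  commute? i j = gen i ∙ gen j ≟ gen j ∙ gen i

  Adj-sym : ∀ {i j} → Adj i j → Adj j i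
  Adj-sym adj eq = adj (sym eq)

  Adj-≢ : ∀ {i j} → Adj i j → i ≢ j
  Adj-≢ adj refl = adj refl

  ¬Adj⇒Commute : ∀ {i j} → ¬ Adj i j → Commute (gen i) (gen j)
  ¬Adj⇒Commute {i} {j} = decidable-stable (commute? i j)

  commute-e : ∀ a → Commute a e
  commute-e a = trans (identityʳ a) (sym (identityˡ a))

  commute-∙ : ∀ {a b c} → Commute a b → Commute a c → Commute a (b ∙ c)
  commute-∙ {a} {b} {c} p q = trans (sym (assoc a b c)) (trans (cong (_∙ c) p) (trans (assoc b a c) (trans (cong (b ∙_) q) (sym (assoc b c a)))))

  commute-prod : ∀ {a} ws → (∀ i → i ∈ ws → Commute a (gen i)) → Commute a (prod ws)
  commute-prod []       h = commute-e _
  commute-prod (i ∷ ws) h = commute-∙ (h i (here refl)) (commute-prod ws (λ j j∈ → h j (there j∈)))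

  conj-commute : ∀ {i t} → Commute (gen i) t → conj (gen i) t ≡ t
  conj-commute {i} {t} eq = trans (assoc _ _ _) (trans (cong (gen i ⁻¹ ∙_) (sym eq)) (cancelˡ (inverseˡ (gen i)) t))

  ℓ-lower : ∀ i x → ℓ x ≤ suc (ℓ (gen i ∙ x))
  ℓ-lower i x = subst (λ z → ℓ z ≤ suc (ℓ (gen i ∙ x))) (cancelˡ (gen² i) x)
    (ℕ.≤-trans (ℓ-∙ (gen i) (gen i ∙ x)) (ℕ.+-monoˡ-≤ _ (ℓ-gen i)))

  aba-Reduced : ∀ {i l} → Adj i l → Reduced (i ∷ l ∷ i ∷ [])
  aba-Reduced {i} {l} adj = d₂ ∷ d₁ ∷ N-e _ ∷ []
    where
    i≢l : gen i ≢ gen l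
    i≢l eq = Adj-≢ adj (gen-injective eq)
    d₁ : N (prod (i ∷ [])) (gen l) ≡ false
    d₁ = trans (N-gen∙ i e (gen l)) (cong₂ _xor_ (δ-≢ (λ eq → i≢l (sym eq))) (N-e _))
    d₂ : N (prod (l ∷ i ∷ [])) (gen i) ≡ false
    d₂ = trans (N-gen∙ l _ (gen i)) (cong₂ _xor_ (δ-≢ i≢l) (trans (N-gen∙ i e _)
      (cong₂ _xor_ (δ-≢ (λ eq → adj (trans (solve [] (i ∷ l ∷ []) (rf 0 ⊙ rf 1) (rf 1 ⊙ (rf 1 ⁻ ⊙ rf 0 ⊙ rf 1)) refl) (cong (gen l ∙_) eq)))) (N-e _))))

  -- Here `z ⁻¹` is the longest element of its coset under the two letters, so multiplying by the
  -- reduced word `i`, `l`, `i` costs exactly three, and each letter is a descent in its turn.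
  two-descents : ∀ {i l} z → Adj i l → N z (gen i) ≡ true → N z (gen l) ≡ true →
    N (gen i ∙ z) (gen l) ≡ true × N (gen l ∙ (gen i ∙ z)) (gen i) ≡ true
  two-descents {i} {l} z adj di dl =
      shorter⇒N (gen i ∙ z) l (s≤s⁻¹ (ℕ.≤-trans (s≤s (s≤s (ℓ-lower i y₂))) (ℕ.≤-reflexive (trans total (sym (ℓ-desc z i di)))))) ,
      shorter⇒N y₂ i (s≤s⁻¹ (s≤s⁻¹ (ℕ.≤-trans (ℕ.≤-reflexive total) (ℕ.≤-trans (ℓ-lower i z) (s≤s (ℓ-lower l (gen i ∙ z)))))))
    where
    P : I → Set
    P k = (k ≡ i) ⊎ (k ≡ l)
    open Parabolic P (λ k → (k Fin.≟ i) ⊎-dec (k Fin.≟ l))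
    y₂ = gen l ∙ (gen i ∙ z)
    max : Maximal (z ⁻¹)
    max k (inj₁ refl) = trans (cong (λ w → N w (gen i)) (⁻¹-involutive z)) di
    max k (inj₂ refl) = trans (cong (λ w → N w (gen l)) (⁻¹-involutive z)) dl
    ws = i ∷ l ∷ i ∷ []
    total : suc (suc (suc (ℓ (gen i ∙ y₂)))) ≡ ℓ z
    total = trans (ℕ.+-comm 3 _) (trans (cong₂ _+ℕ_
        (trans (cong ℓ (solve (z ∷ []) (i ∷ l ∷ []) (rf 0 ⊙ (rf 1 ⊙ (rf 0 ⊙ el 0))) ((el 0 ⁻ ⊙ (rf 0 ⊙ (rf 1 ⊙ (rf 0 ⊙ ε)))) ⁻) refl)) (ℓ-⁻¹ _))
        (sym (ℓ-Reduced (aba-Reduced adj))))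
      (trans (Maximal-ℓ (z ⁻¹) max ws (inj₁ refl ∷ inj₂ refl ∷ inj₁ refl ∷ [])) (ℓ-⁻¹ z)))

  -- The noncommutation graph is a forest

  data Walk : I → List I → Set where
    start : ∀ {i} → Walk i []
    step₁ : ∀ {i j} → Adj i j → Walk i (j ∷ [])
    step  : ∀ {i j k ws} → Adj i j → i ≢ k → Walk j (k ∷ ws) → Walk i (j ∷ k ∷ ws)

  -- Uniqueness of the left descent carries the induction. A second descent `l` that commutes with
  -- `i` would be a descent of the tail, so equal to its first letter `j`, which is adjacent to `i`.
  -- If it does not commute, `two-descents` again gives `l ≡ j` and makes `i` a descent of what
  -- follows `j`, so the walk would turn back.
  Walk-Reduced : ∀ {i ws} → Walk i ws → Reduced (i ∷ ws) × (∀ l → N (prod (i ∷ ws)) (gen l) ≡ true → l ≡ i)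
  Walk-Reduced {i} start = N-e _ ∷ [] , only
    where
    only : ∀ l → N (prod (i ∷ [])) (gen l) ≡ true → l ≡ i
    only l h = gen-injective (δ-sound _ _ (trans (sym (trans (N-gen∙ i e (gen l)) (trans (cong (δ (gen l) (gen i) xor_) (N-e _)) (Bool.xor-identityʳ _)))) h))
  Walk-Reduced {i} {j ∷ ws} w = asc ∷ proj₁ tail , only
    where
    edge : ∀ {i j ws} → Walk i (j ∷ ws) → Adj i j
    edge (step₁ a)    = a
    edge (step a _ _) = a
    sub : ∀ {i j ws} → Walk i (j ∷ ws) → Reduced (j ∷ ws) × (∀ l → N (prod (j ∷ ws)) (gen l) ≡ true → l ≡ j)
    sub (step₁ _)    = Walk-Reduced start
    sub (step _ _ w) = Walk-Reduced w
    no-return : ∀ {i j ws} → Walk i (j ∷ ws) → N (prod ws) (gen i) ≡ true → ⊥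
    no-return (step₁ _) h = true≢false h (N-e _)
    no-return (step _ i≢k w) h with w
    ... | step₁ _    = i≢k (proj₂ (Walk-Reduced start) _ h)
    ... | step _ _ w′ = i≢k (proj₂ (Walk-Reduced w′) _ h)
    tail = sub w
    u = prod (j ∷ ws)
    adj : Adj i j
    adj = edge w
    asc : N u (gen i) ≡ false
    asc = Bool.¬-not (λ h → Adj-≢ adj (proj₂ tail i h))
    only : ∀ l → N (gen i ∙ u) (gen l) ≡ true → l ≡ i
    only l h with l Fin.≟ i
    ... | yes l≡i = l≡i
    ... | no  l≢i with commute? i l
    ...   | yes c = ⊥-elim (adj (subst (λ k → Commute (gen i) (gen k)) (proj₂ tail l Nul) c))
      where
      Nul : N u (gen l) ≡ true
      Nul = trans (sym (trans (N-gen∙ i u (gen l)) (cong₂ _xor_ (δ-≢ (λ eq → l≢i (gen-injective eq))) (cong (N u) (conj-commute c))))) h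
    ...   | no  a = ⊥-elim (no-return w (subst (λ z → N z (gen i) ≡ true) (trans (cong₂ (λ k z → gen k ∙ z) l≡j (cancelˡ (gen² i) u)) (cancelˡ (gen² j) _)) (proj₂ both)))
      where
      both = two-descents (gen i ∙ u) a (trans (N-gen∙-self i u) (cong not asc)) h
      l≡j : l ≡ j
      l≡j = proj₂ tail l (subst (λ z → N z (gen l) ≡ true) (cancelˡ (gen² i) u) (proj₁ both))

  IsLeaf : List I → I → I → Set
  IsLeaf l x stem = ∀ u → u ∈ l → Adj u x → u ≡ stem

  -- A walk that never turns back spells a reduced word, so it must end at a leaf.
  leaf : ∀ i l → i ∈ l → ∃[ x ] ∃[ stem ] x ∈ l × IsLeaf l x stem
  leaf i l i∈l with Fin.any? (λ k → (k ∈? l) ×-dec ¬? (commute? k i))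
  ... | no none = i , i , i∈l , λ u u∈l adj → ⊥-elim (none (u , u∈l , adj))
  ... | yes (k , k∈l , adj) = extend maxℓ k∈l (step₁ adj) (ℕ.m≤m+n maxℓ 2)
    where
    extend : ∀ n {k j ws} → k ∈ l → Walk k (j ∷ ws) → maxℓ ≤ n +ℕ length (k ∷ j ∷ ws) → ∃[ x ] ∃[ stem ] x ∈ l × IsLeaf l x stem
    extend n {k} {j} k∈l w bound with Fin.any? (λ x → (x ∈? l) ×-dec ¬? (commute? x k) ×-dec ¬? (x Fin.≟ j))
    extend n {k} {j} k∈l w bound | no none = k , j , k∈l , λ u u∈l adj → decidable-stable (u Fin.≟ j) (λ u≢j → none (u , u∈l , adj , u≢j))
    extend zero {k} {j} {ws} k∈l w bound | yes (x , x∈l , adj , x≢j) = ⊥-elim (ℕ.<-irrefl refl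
      (ℕ.≤-trans (ℕ.≤-reflexive (sym (ℓ-Reduced (proj₁ (Walk-Reduced (step adj x≢j w)))))) (ℕ.≤-trans (ℓ≤maxℓ _) bound)))
    extend (suc n) {k} {j} {ws} k∈l w bound | yes (x , x∈l , adj , x≢j) =
      extend n x∈l (step adj x≢j w) (ℕ.≤-trans bound (ℕ.≤-reflexive (sym (ℕ.+-suc n (length (k ∷ j ∷ ws))))))

  -- The order of the indices orients every edge, and on a forest any orientation comes from such a
  -- height. Then only consecutive levels can fail to commute, and the parity of the height is the
  -- bipartition.
  IsHeight : List I → (I → ℕ) → Set
  IsHeight l H = ∀ i j → i ∈ l → j ∈ l → Adj i j → i F.< j → H j ≡ suc (H i)

  heights : ∀ n l → length l ≤ n → ∃[ H ] IsHeight l H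
  heights n [] _ = (λ _ → 0) , λ i j ()
  heights (suc n) l@(a ∷ _) bound with leaf a l (here refl)
  ... | x , stem , x∈l , isLeaf
      with heights n (filter ≢x? l) (s≤s⁻¹ (ℕ.≤-trans (List.filter-notAll ≢x? l (Any.map (λ eq ne → ne (sym eq)) x∈l)) bound))
    where ≢x? = λ i → ¬? (i Fin.≟ x)
  ... | H , isH = H′ , isH′
    where
    ≢x? = λ i → ¬? (i Fin.≟ x)
    -- All other heights are raised by one, which leaves room for a leaf below a stem of height
    -- zero.
    Hx : ℕ
    Hx = if does (x F.<? stem) then H stem else suc (suc (H stem))
    H′ : I → ℕ
    H′ i = if does (i Fin.≟ x) then Hx else suc (H i)
    isH′ : IsHeight l H′
    isH′ i j i∈ j∈ adj i<j with i Fin.≟ x | j Fin.≟ x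
    ... | yes refl | yes refl = ⊥-elim (Adj-≢ adj refl)
    ... | yes refl | no  j≢x with isLeaf j j∈ (Adj-sym adj)
    ...   | refl = cong suc (sym (cong (if_then H j else suc (suc (H j))) (dec-true (i F.<? j) i<j)))
    isH′ i j i∈ j∈ adj i<j | no i≢x | yes refl with isLeaf i i∈ adj
    ...   | refl = cong (if_then H i else suc (suc (H i))) (dec-false (j F.<? i) (Fin.<-asym i<j))
    isH′ i j i∈ j∈ adj i<j | no i≢x | no j≢x =
      cong suc (isH i j (∈-filter⁺ ≢x? i∈ i≢x) (∈-filter⁺ ≢x? j∈ j≢x) adj i<j)

  -- Conjugating the Coxeter element to a bipartite one

  Conj : W → W → Set
  Conj a b = ∃[ x ] x ∙ a ≡ b ∙ x

  Conj-refl : ∀ {a b} → a ≡ b → Conj a b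
  Conj-refl {a} refl = e , trans (identityˡ a) (sym (identityʳ a))

  Conj-trans : ∀ {a b c} → Conj a b → Conj b c → Conj a c
  Conj-trans {a} {b} {c} (x , p) (y , q) = y ∙ x ,
    trans (assoc y x a) (trans (cong (y ∙_) p) (trans (sym (assoc y b x)) (trans (cong (_∙ x) q) (assoc c y x))))

  Conj-swap : ∀ a b → Conj (a ∙ b) (b ∙ a)
  Conj-swap a b = b , sym (assoc b a b)

  Conj-pow : ∀ {a b} n → Conj a b → a ^ n ≡ e → b ^ n ≡ e
  Conj-pow {a} {b} n (x , p) an = trans (solve (b ^ n ∷ x ∷ []) [] (el 0) (el 0 ⊙ el 1 ⊙ el 1 ⁻) refl)
    (trans (cong (_∙ x ⁻¹) (sym (powers n))) (trans (cong (λ z → x ∙ z ∙ x ⁻¹) an) (solve (x ∷ []) [] (el 0 ⊙ ε ⊙ el 0 ⁻) ε refl)))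
    where
    powers : ∀ n → x ∙ a ^ n ≡ b ^ n ∙ x
    powers zero    = trans (identityʳ x) (sym (identityˡ x))
    powers (suc n) = trans (sym (assoc x a _)) (trans (cong (_∙ a ^ n) p) (trans (assoc b x _) (trans (cong (b ∙_) (powers n)) (sym (assoc b _ x)))))

  Seq : Set
  Seq = ℕ → W

  seq : Seq → ℕ → W
  seq b zero    = e
  seq b (suc r) = b 0 ∙ seq (b ∘ suc) r

  part : Bool → Seq → ℕ → W
  part _     b zero    = e
  part true  b (suc r) = b 0 ∙ part false (b ∘ suc) r
  part false b (suc r) = part true (b ∘ suc) r

  Far : Seq → Set
  Far b = ∀ k l → suc k < l → Commute (b k) (b l)

  commute-seq : ∀ {a} b r → (∀ k → Commute a (b k)) → Commute a (seq b r)
  commute-seq b zero    h = commute-e _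
  commute-seq b (suc r) h = commute-∙ (h 0) (commute-seq (b ∘ suc) r (λ k → h (suc k)))

  -- Conjugation moves the first factor to the end, and from there next to the third one.
  bipartite : ∀ b r → Far b → Conj (seq b r) (part true b r ∙ part false b r)
  bipartite b zero          far = Conj-refl (sym (identityˡ e))
  bipartite b (suc zero)    far = Conj-refl (sym (identityʳ _))
  bipartite b (suc (suc zero)) far = Conj-refl (solve (b 0 ∷ b 1 ∷ []) [] (el 0 ⊙ (el 1 ⊙ ε)) (el 0 ⊙ ε ⊙ (el 1 ⊙ ε)) refl)
  bipartite b (suc (suc (suc r))) far = Conj-trans (Conj-swap (b 0) (b 1 ∙ (b 2 ∙ R)))
      (Conj-trans (Conj-refl moved) (Conj-trans (bipartite b′ (suc (suc r)) far′)
        (Conj-trans (Conj-swap _ _) (Conj-refl (cong (_∙ (b 1 ∙ part true (b ∘ (3 +ℕ_)) r)) (assoc _ _ _))))))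
    where
    R = seq (b ∘ (3 +ℕ_)) r
    b′ : Seq
    b′ zero          = b 1
    b′ (suc zero)    = b 0 ∙ b 2
    b′ (suc (suc k)) = b (3 +ℕ k)
    moved : b 1 ∙ (b 2 ∙ R) ∙ b 0 ≡ b 1 ∙ ((b 0 ∙ b 2) ∙ R)
    moved = trans (assoc _ _ _) (cong (b 1 ∙_) (trans (sym (commute-seq (b ∘ (2 +ℕ_)) (suc r) (λ k → far 0 (2 +ℕ k) (s≤s (s≤s z≤n))))) (sym (assoc _ _ _))))
    far′ : Far b′
    far′ zero          (suc (suc l)) _       = far 1 (3 +ℕ l) (s≤s (s≤s (s≤s z≤n)))
    far′ zero          (suc zero)    (s≤s ())
    far′ (suc zero)    (suc (suc zero)) (s≤s (s≤s ()))
    far′ (suc zero)    (suc (suc (suc l))) _ = sym (commute-∙ (sym (far 0 (4 +ℕ l) (s≤s (s≤s z≤n)))) (sym (far 2 (4 +ℕ l) (s≤s (s≤s (s≤s (s≤s z≤n)))))))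
    far′ (suc zero)    (suc zero)    (s≤s ())
    far′ (suc (suc k)) (suc (suc l)) lt      = far (3 +ℕ k) (3 +ℕ l) (s≤s lt)
    far′ (suc (suc k)) (suc zero)    (s≤s ())

  even : ℕ → Bool
  even zero    = true
  even (suc n) = not (even n)

  record Insertion (s : W) (p : ℕ) (b b′ : Seq) : Set where
    field
      at  : b′ p ≡ s ∙ b p
      off : ∀ k → k ≢ p → b′ k ≡ b k

  shift : ∀ {s p b b′} → Insertion s (suc p) b b′ → Insertion s p (b ∘ suc) (b′ ∘ suc)
  shift ins = record { at = at ; off = λ k k≢p → off (suc k) (λ eq → k≢p (ℕ.suc-injective eq)) }
    where open Insertion ins

  seq-cong : ∀ {b b′} r → (∀ k → b′ k ≡ b k) → seq b′ r ≡ seq b r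
  seq-cong zero    eq = refl
  seq-cong (suc r) eq = cong₂ _∙_ (eq 0) (seq-cong r (λ k → eq (suc k)))

  part-cong : ∀ c {b b′} r → (∀ k → b′ k ≡ b k) → part c b′ r ≡ part c b r
  part-cong true  zero    eq = refl
  part-cong false zero    eq = refl
  part-cong true  (suc r) eq = cong₂ _∙_ (eq 0) (part-cong false r (λ k → eq (suc k)))
  part-cong false (suc r) eq = part-cong true r (λ k → eq (suc k))

  seq-insert : ∀ {s b b′} p r → p < r → Insertion s p b b′ → (∀ k → k < p → Commute s (b k)) → seq b′ r ≡ s ∙ seq b r
  seq-insert zero (suc r) _ ins com = trans (cong₂ _∙_ at (seq-cong r (λ k → off (suc k) (λ ())))) (assoc _ _ _)
    where open Insertion ins
  seq-insert {s} {b} (suc p) (suc r) (s≤s p<r) ins com =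
    trans (cong₂ _∙_ (off 0 (λ ())) (seq-insert p r p<r (shift ins) (λ k k<p → com (suc k) (s≤s k<p))))
      (trans (sym (assoc _ _ _)) (trans (cong (_∙ seq (b ∘ suc) r) (sym (com 0 (s≤s z≤n)))) (assoc _ _ _)))
    where open Insertion ins

  part-insert : ∀ c {s b b′} p r → p < r → even p ≡ c → Insertion s p b b′ → (∀ k → even k ≡ c → Commute s (b k)) →
    part c b′ r ≡ s ∙ part c b r
  part-insert true zero (suc r) _ _ ins com = trans (cong₂ _∙_ at (part-cong false r (λ k → off (suc k) (λ ())))) (assoc _ _ _)
    where open Insertion ins
  part-insert true {s} {b} (suc p) (suc r) (s≤s p<r) ev ins com =
    trans (cong₂ _∙_ (off 0 (λ ())) (part-insert false p r p<r (Bool.not-injective ev) (shift ins) (λ k evk → com (suc k) (cong not evk))))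
      (trans (sym (assoc _ _ _)) (trans (cong (_∙ part false (b ∘ suc) r) (sym (com 0 refl))) (assoc _ _ _)))
    where open Insertion ins
  part-insert false (suc p) (suc r) (s≤s p<r) ev ins com =
    part-insert true p r p<r (Bool.not-injective ev) (shift ins) (λ k evk → com (suc k) (cong not evk))
  part-insert false zero r _ () ins com

  part-skip : ∀ c {s b b′} p r → p < r → even p ≡ not c → Insertion s p b b′ → part c b′ r ≡ part c b r
  part-skip false zero (suc r) _ _ ins = part-cong true r (λ k → off (suc k) (λ ()))
    where open Insertion ins
  part-skip true (suc p) (suc r) (s≤s p<r) ev ins =
    cong₂ _∙_ (off 0 (λ ())) (part-skip false p r p<r (Bool.not-injective ev) (shift ins))
    where open Insertion ins
  part-skip false (suc p) (suc r) (s≤s p<r) ev ins = part-skip true p r p<r (Bool.not-injective ev) (shift ins)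
  part-skip true zero r _ () ins

  monochrome : (I → Bool) → Bool → List I
  monochrome colour c = filter (λ i → colour i Bool.≟ c) (allFin rank)

  -- The Coxeter element as a product of levels

  module Levels (H : I → ℕ) (isH : ∀ i j → Adj i j → i F.< j → H j ≡ suc (H i)) where

    colour : I → Bool
    colour i = even (H i)

    Adj-height : ∀ {i j} → Adj i j → H j ≡ suc (H i) ⊎ H i ≡ suc (H j)
    Adj-height {i} {j} adj with Fin.<-cmp i j
    ... | tri< i<j _ _  = inj₁ (isH i j adj i<j)
    ... | tri≈ _ refl _ = ⊥-elim (Adj-≢ adj refl)
    ... | tri> _ _ j<i  = inj₂ (isH j i (Adj-sym adj) j<i)

    same-colour : ∀ {i j} → colour i ≡ colour j → Commute (gen i) (gen j)
    same-colour {i} {j} eq = ¬Adj⇒Commute λ adj → flip (Adj-height adj)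
      where
      flip : H j ≡ suc (H i) ⊎ H i ≡ suc (H j) → ⊥
      flip (inj₁ p) = Bool.not-¬ {colour j} refl (trans (cong even p) (cong not eq))
      flip (inj₂ p) = Bool.not-¬ {colour i} refl (trans (cong even p) (cong not (sym eq)))

    level : List I → Seq
    level l k = prod (filter (λ i → H i ℕ.≟ k) l)

    level-insertion : ∀ x l → Insertion (gen x) (H x) (level l) (level (x ∷ l))
    level-insertion x l = record
      { at  = cong prod (List.filter-accept (λ i → H i ℕ.≟ H x) refl)
      ; off = λ k k≢ → cong prod (List.filter-reject (λ i → H i ℕ.≟ k) (λ eq → k≢ (sym eq)))
      }

    commute-level : ∀ {a} l k → (∀ i → i ∈ l → H i ≡ k → Commute a (gen i)) → Commute a (level l k)
    commute-level l k h = commute-prod _ λ i i∈ → let (i∈l , Hi) = ∈-filter⁻ (λ i → H i ℕ.≟ k) {xs = l} i∈ in h i i∈l Hi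

    level-far : ∀ l → Far (level l)
    level-far l k k′ lt = commute-level l k′ λ j _ Hj → sym (commute-level l k λ i _ Hi → ¬Adj⇒Commute λ adj → apart i j Hi Hj (Adj-height adj))
      where
      apart : ∀ i j → H i ≡ k → H j ≡ k′ → H i ≡ suc (H j) ⊎ H j ≡ suc (H i) → ⊥
      apart i j refl refl (inj₁ p) = ℕ.<-irrefl p (ℕ.<-trans (ℕ.n<1+n _) (ℕ.<-trans lt (ℕ.n<1+n _)))
      apart i j refl refl (inj₂ p) = ℕ.<-irrefl (sym p) lt

    maxH : ℕ
    maxH = suc (foldr (λ i n → H i ⊔ℕ n) 0 (allFin rank))

    H<maxH : ∀ i → H i < maxH
    H<maxH i = s≤s (go (allFin rank) (∈-allFin i))
      where
      go : ∀ l → i ∈ l → H i ≤ foldr (λ i n → H i ⊔ℕ n) 0 l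
      go (_ ∷ l) (here refl) = ℕ.m≤m⊔n (H i) _
      go (x ∷ l) (there i∈)  = ℕ.≤-trans (go l i∈) (ℕ.m≤n⊔m (H x) _)

    -- To join its level, `x` moves past later letters of lower levels only. A later neighbour of
    -- `x` lies one level above it, so all letters passed commute with `x`.
    sorted : ∀ l → AllPairs F._<_ l → prod l ≡ seq (level l) maxH
    sorted [] _ = sym (trivial maxH)
      where
      trivial : ∀ r → seq (λ _ → e) r ≡ e
      trivial zero    = refl
      trivial (suc r) = trans (identityˡ _) (trivial r)
    sorted (x ∷ l) (x<l ∷ l<) = trans (cong (gen x ∙_) (sorted l l<))
      (sym (seq-insert (H x) maxH (H<maxH x) (level-insertion x l) λ k k<Hx →
        commute-level l k λ i i∈ Hi → ¬Adj⇒Commute λ adj →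
          ℕ.<-asym k<Hx (ℕ.≤-reflexive (trans (sym (isH x i adj (All.lookup x<l i∈))) Hi))))

    layer-part : ∀ c l → prod (filter (λ i → colour i Bool.≟ c) l) ≡ part c (level l) maxH
    layer-part c [] = sym (trivial c maxH)
      where
      trivial : ∀ c r → part c (λ _ → e) r ≡ e
      trivial true  zero    = refl
      trivial false zero    = refl
      trivial true  (suc r) = trans (identityˡ _) (trivial false r)
      trivial false (suc r) = trivial true r
    layer-part c (x ∷ l) with colour x Bool.≟ c
    ... | yes eq = trans (cong (gen x ∙_) (layer-part c l))
          (sym (part-insert c (H x) maxH (H<maxH x) eq (level-insertion x l) λ k ek →
            commute-level l k λ i _ Hi → same-colour (trans eq (sym (trans (cong even Hi) ek)))))
    ... | no neq = trans (layer-part c l) (sym (part-skip c (H x) maxH (H<maxH x) (Bool.¬-not neq) (level-insertion x l)))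

    coxeter-bipartite : Conj coxeterElement (prod (monochrome colour true) ∙ prod (monochrome colour false))
    coxeter-bipartite = Conj-trans (Conj-refl (sorted (allFin rank) (AllPairs.tabulate⁺-< (λ lt → lt))))
      (Conj-trans (bipartite (level (allFin rank)) maxH (level-far (allFin rank)))
        (Conj-refl (sym (cong₂ _∙_ (layer-part true (allFin rank)) (layer-part false (allFin rank))))))

  ∃-bipartition : ∃[ colour ] (∀ {i j} → colour i ≡ colour j → Commute (gen i) (gen j)) ×
    Conj coxeterElement (prod (monochrome colour true) ∙ prod (monochrome colour false))
  ∃-bipartition with heights (length (allFin rank)) (allFin rank) ℕ.≤-refl
  ... | H , isH = colour , same-colour , coxeter-bipartite
    where open Levels H (λ i j → isH i j (∈-allFin i) (∈-allFin j))

  -- Alternating words of commuting layers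

  module Bipartition (colour : I → Bool) (same-colour : ∀ {i j} → colour i ≡ colour j → Commute (gen i) (gen j)) where

    Mono : Bool → List I → Set
    Mono c = All (λ i → colour i ≡ c)

    layer : Bool → List I
    layer = monochrome colour

    layer-Mono : ∀ c → Mono c (layer c)
    layer-Mono c = All.all-filter (λ i → colour i Bool.≟ c) (allFin rank)

    ∈-layer : ∀ {i c} → colour i ≡ c → i ∈ layer c
    ∈-layer {i} {c} eq = ∈-filter⁺ (λ i → colour i Bool.≟ c) (∈-allFin i) eq

    layer-Unique : ∀ c → Unique (layer c)
    layer-Unique c = Unique.filter⁺ (λ i → colour i Bool.≟ c) (Unique.allFin⁺ rank)

    Mono-commute : ∀ {c i ws} → colour i ≡ c → Mono c ws → Commute (gen i) (prod ws)
    Mono-commute eq mono = commute-prod _ λ j j∈ → same-colour (trans eq (sym (All.lookup mono j∈)))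

    Mono-N : ∀ {c} ws → Mono c ws → ∀ t → N (prod ws) t ≡ true → ∃[ i ] i ∈ ws × t ≡ gen i
    Mono-N [] _ t h = ⊥-elim (true≢false h (N-e t))
    Mono-N (i ∷ ws) (ci ∷ mono) t h with t ≟ gen i
    ... | yes eq = i , here refl , eq
    ... | no neq with Mono-N ws mono (conj (gen i) t) (trans (sym (trans (N-gen∙ i (prod ws) t) (cong (_xor N (prod ws) (conj (gen i) t)) (δ-≢ neq)))) h)
    ...   | j , j∈ , eq = j , there j∈ ,
            trans (solve (t ∷ []) (i ∷ []) (el 0) (rf 0 ⊙ (rf 0 ⁻ ⊙ el 0 ⊙ rf 0) ⊙ rf 0) refl)
              (trans (cong (λ z → gen i ∙ z ∙ gen i) eq)
                (trans (cong (_∙ gen i) (same-colour (trans ci (sym (All.lookup mono j∈))))) (∙gen∙gen (gen j) i)))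

    Mono-remove : ∀ {c i} ws → Mono c ws → i ∈ ws →
      ∃[ us ] Mono c us × prod ws ≡ gen i ∙ prod us × prod ws ≡ prod us ∙ gen i × suc (length us) ≡ length ws
    Mono-remove (i ∷ ws) (ci ∷ mono) (here refl) = ws , mono , refl , Mono-commute ci mono , refl
    Mono-remove {i = i} (j ∷ ws) (cj ∷ mono) (there i∈) with Mono-remove ws mono i∈
    ... | us , mono′ , eq , eq′ , len = j ∷ us , cj ∷ mono′ ,
      trans (cong (gen j ∙_) eq) (trans (sym (assoc _ _ _)) (trans (cong (_∙ prod us) (same-colour (trans cj (sym (All.lookup mono i∈))))) (assoc _ _ _))) ,
      trans (cong (gen j ∙_) eq′) (sym (assoc _ _ _)) , cong suc len

    Mono-involutive : ∀ {c} ws → Mono c ws → prod ws ∙ prod ws ≡ e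
    Mono-involutive []       _           = identityˡ e
    Mono-involutive (i ∷ ws) (ci ∷ mono) = trans (cong (_∙ (gen i ∙ prod ws)) (Mono-commute ci mono))
      (trans (assoc _ _ _) (trans (cong (prod ws ∙_) (cancelˡ (gen² i) (prod ws))) (Mono-involutive ws mono)))

    Mono-⁻¹ : ∀ {c} ws → Mono c ws → prod ws ⁻¹ ≡ prod ws
    Mono-⁻¹ ws mono = inverse-unique (Mono-involutive ws mono)

    D-commute : ∀ {i j} x → i ≢ j → Commute (gen i) (gen j) → D (x ∙ gen i) j ≡ D x j
    D-commute {i} {j} x i≢j com = trans (cong (λ z → N z (gen j)) (∙gen-⁻¹ x i)) (trans (N-gen∙ i (x ⁻¹) (gen j))
      (cong₂ _xor_ (δ-≢ (λ eq → i≢j (sym (gen-injective eq)))) (cong (N (x ⁻¹)) (conj-commute com))))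

    Mono-ascend : ∀ {c} x ws → Mono c ws → Unique ws → (∀ i → i ∈ ws → D x i ≡ false) → ℓ (x ∙ prod ws) ≡ ℓ x +ℕ length ws
    Mono-ascend x [] _ _ _ = trans (cong ℓ (identityʳ x)) (sym (ℕ.+-identityʳ _))
    Mono-ascend x (i ∷ ws) (ci ∷ mono) (i∉ ∷ uniq) asc = trans (cong ℓ (sym (assoc _ _ _)))
      (trans (Mono-ascend (x ∙ gen i) ws mono uniq λ j j∈ →
          trans (D-commute x (All.lookup i∉ j∈) (same-colour (trans ci (sym (All.lookup mono j∈))))) (asc j (there j∈)))
        (trans (cong (_+ℕ length ws) (ℓ-ascʳ x i (asc i (here refl)))) (sym (ℕ.+-suc _ _))))

    alt : Bool → ℕ → List I
    alt c zero    = []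
    alt c (suc k) = layer c ++ alt (not c) k

    -- The colour of layer `k` counted from zero, hence of the final layer of `alt c (suc k)` and of
    -- the layer that would extend `alt c k`.
    last : Bool → ℕ → Bool
    last c zero    = c
    last c (suc k) = last (not c) k

    last-not : ∀ c k → last (not c) k ≡ not (last c k)
    last-not c zero    = refl
    last-not c (suc k) = last-not (not c) k

    last-last : ∀ c k → last (last c k) k ≡ c
    last-last c zero    = refl
    last-last c (suc k) = trans (last-not (last (not c) k) k) (trans (cong not (last-last (not c) k)) (Bool.not-involutive c))

    last-2+ : ∀ c k → last c (suc (suc k)) ≡ last c k
    last-2+ c k = cong (λ d → last d k) (Bool.not-involutive c)

    alt-snoc : ∀ c k → alt c (suc k) ≡ alt c k ++ layer (last c k)
    alt-snoc c zero    = List.++-identityʳ _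
    alt-snoc c (suc k) = trans (cong (layer c ++_) (alt-snoc (not c) k)) (sym (List.++-assoc (layer c) _ _))

    L : Bool → W
    L c = prod (layer c)

    A : Bool → ℕ → W
    A c k = prod (alt c k)

    A-suc : ∀ c k → A c (suc k) ≡ L c ∙ A (not c) k
    A-suc c k = prod-++ (layer c) _

    A-snoc : ∀ c k → A c (suc k) ≡ A c k ∙ L (last c k)
    A-snoc c k = trans (cong prod (alt-snoc c k)) (prod-++ (alt c k) _)

    L² : ∀ c → L c ∙ L c ≡ e
    L² c = Mono-involutive (layer c) (layer-Mono c)

    A-⁻¹ : ∀ c k → A c (suc k) ⁻¹ ≡ A (last c k) (suc k)
    A-⁻¹ c zero    = trans (cong _⁻¹ (trans (A-suc c 0) (identityʳ _))) (trans (inverse-unique (L² c)) (sym (trans (A-suc c 0) (identityʳ _))))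
    A-⁻¹ c (suc k) = trans (cong _⁻¹ (A-snoc c (suc k))) (trans (⁻¹-anti-∙ _ _) (trans
      (cong₂ _∙_ (inverse-unique (L² _)) (trans (A-⁻¹ c k) (cong (λ d → A d (suc k)) (sym (trans (cong not (last-not c k)) (Bool.not-involutive _))))))
      (sym (A-suc (last c (suc k)) (suc k)))))

    Red : Bool → ℕ → Set
    Red c k = ℓ (A c k) ≡ length (alt c k)

    length-alt : ∀ c k → length (alt c (suc k)) ≡ length (layer c) +ℕ length (alt (not c) k)
    length-alt c k = List.length-++ (layer c)

    length-alt-snoc : ∀ c k → length (alt c (suc k)) ≡ length (alt c k) +ℕ length (layer (last c k))
    length-alt-snoc c k = trans (cong length (alt-snoc c k)) (List.length-++ (alt c k))

    delete-last : ∀ c k x i → Red c (suc k) → colour i ≡ last c k → x ≡ A c k ∙ (gen i ∙ L (last c k)) → ℓ x < ℓ (A c (suc k))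
    delete-last c k x i red ci eq with Mono-remove (layer (last c k)) (layer-Mono _) (∈-layer ci)
    ... | us , _ , eq₁ , _ , len = ℕ.≤-trans (s≤s (ℓ≤length (alt c k ++ us)
        (trans (prod-++ (alt c k) us) (sym (trans eq (cong (A c k ∙_) (trans (cong (gen i ∙_) eq₁) (cancelˡ (gen² i) _))))))))
      (ℕ.≤-reflexive (trans (cong suc (List.length-++ (alt c k))) (trans (sym (ℕ.+-suc _ _)) (trans (cong (length (alt c k) +ℕ_) len)
        (sym (trans red (length-alt-snoc c k)))))))

    left-desc : ∀ c k i → Red c (suc k) → colour i ≡ c → N (A c (suc k)) (gen i) ≡ true
    left-desc c k i red ci with Mono-remove (layer c) (layer-Mono c) (∈-layer ci)
    ... | us , _ , eq , _ , len = shorter⇒N _ i (ℕ.≤-trans (s≤s (ℓ≤length (us ++ alt (not c) k)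
        (trans (prod-++ us _) (sym (trans (cong (gen i ∙_) (trans (A-suc c k) (cong (_∙ A (not c) k) eq)))
          (trans (cong (gen i ∙_) (assoc _ _ _)) (cancelˡ (gen² i) _)))))))
      (ℕ.≤-reflexive (trans (cong suc (List.length-++ us)) (trans (cong (_+ℕ length (alt (not c) k)) len) (sym (trans red (length-alt c k)))))))

    right-desc : ∀ c k i → Red c (suc k) → colour i ≡ last c k → D (A c (suc k)) i ≡ true
    right-desc c k i red ci = shorter⇒D (A c (suc k)) i (delete-last c k _ i red ci
      (trans (cong (_∙ gen i) (A-snoc c k)) (trans (assoc _ _ _) (cong (A c k ∙_) (sym (Mono-commute ci (layer-Mono _)))))))

    left-asc : ∀ c k i → Red c (suc k) → colour i ≡ c → N (A (not c) k) (gen i) ≡ false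
    left-asc c k i red ci with Mono-remove (layer c) (layer-Mono c) (∈-layer ci)
    ... | us , _ , _ , eq , len = longer⇒¬N _ i (ℕ.+-cancelˡ-≤ (length us) _ _ (ℕ.≤-trans
        (ℕ.≤-trans (ℕ.+-monoʳ-≤ (length us) (s≤s (ℓ≤length (alt (not c) k) refl)))
          (ℕ.≤-reflexive (trans (ℕ.+-suc _ _) (trans (cong (_+ℕ length (alt (not c) k)) len) (sym (trans red (length-alt c k)))))))
        (ℕ.≤-trans (ℕ.≤-reflexive (cong ℓ (trans (A-suc c k) (trans (cong (_∙ A (not c) k) eq) (assoc _ _ _)))))
          (ℕ.≤-trans (ℓ-∙ (prod us) _) (ℕ.+-monoˡ-≤ _ (ℓ≤length us refl))))))

    right-asc : ∀ c k i → Red c (suc k) → colour i ≡ last c k → D (A c k) i ≡ false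
    right-asc c k i red ci with Mono-remove (layer (last c k)) (layer-Mono _) (∈-layer ci)
    ... | us , _ , eq , _ , len = longer⇒¬D _ i (ℕ.+-cancelʳ-≤ (length us) _ _ (ℕ.≤-trans
        (ℕ.≤-trans (ℕ.+-monoˡ-≤ (length us) (s≤s (ℓ≤length (alt c k) refl)))
          (ℕ.≤-reflexive (trans (sym (ℕ.+-suc _ _)) (trans (cong (length (alt c k) +ℕ_) len) (sym (trans red (length-alt-snoc c k)))))))
        (ℕ.≤-trans (ℕ.≤-reflexive (cong ℓ (trans (A-snoc c k) (trans (cong (A c k ∙_) eq) (sym (assoc _ _ _))))))
          (ℕ.≤-trans (ℓ-∙ _ (prod us)) (ℕ.+-monoʳ-≤ _ (ℓ≤length us refl))))))

    Red-extend : ∀ c k → Red c k → (∀ i → colour i ≡ last c k → D (A c k) i ≡ false) → Red c (suc k)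
    Red-extend c k red asc = trans (cong ℓ (A-snoc c k))
      (trans (Mono-ascend (A c k) (layer (last c k)) (layer-Mono _) (layer-Unique _) (λ i i∈ → asc i (All.lookup (layer-Mono _) i∈)))
        (trans (cong (_+ℕ length (layer (last c k))) red) (sym (length-alt-snoc c k))))

    Red-1 : ∀ c → Red c 1
    Red-1 c = Red-extend c 0 ℓ-e (λ i _ → trans (cong (λ z → N z (gen i)) (inverse-unique (identityˡ e))) (N-e _))

    -- The word sⱼ followed by k layers and then sᵢ is not reduced: this is the first way in which an
    -- alternating word can fail to be reduced.
    Pair : ℕ → I → I → Set
    Pair k j i = colour i ≡ last (colour j) (suc k) × A (not (colour j)) k ∙ gen i ≡ gen j ∙ A (not (colour j)) k

    Pair-sym : ∀ k {j i} → Pair k j i → Pair k i j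
    Pair-sym k {j} {i} (ci , eq) = trans (sym (last-last (colour j) (suc k))) (cong (λ c → last c (suc k)) (sym ci)) ,
      trans (cong (_∙ gen j) (sym (inv≡ k ci)))
        (trans (trans (solve (y ∷ []) (j ∷ []) (el 0 ⁻ ⊙ rf 0) (el 0 ⁻ ⊙ (rf 0 ⊙ el 0) ⊙ el 0 ⁻) refl)
          (trans (cong (λ z → y ⁻¹ ∙ z ∙ y ⁻¹) (sym eq)) (solve (y ∷ []) (i ∷ []) (el 0 ⁻ ⊙ (el 0 ⊙ rf 0) ⊙ el 0 ⁻) (rf 0 ⊙ el 0 ⁻) refl)))
          (cong (gen i ∙_) (inv≡ k ci)))
      where
      y = A (not (colour j)) k
      inv≡ : ∀ k → colour i ≡ last (colour j) (suc k) → A (not (colour j)) k ⁻¹ ≡ A (not (colour i)) k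
      inv≡ zero    _  = inverse-unique (identityˡ e)
      inv≡ (suc k) ci = trans (A-⁻¹ (not (colour j)) k) (cong (λ c → A c (suc k))
        (trans (last-not (colour j) k) (cong not (sym (trans ci (last-2+ (colour j) k))))))

    nb : I → List I
    nb i = filter (λ j → ¬? (commute? i j)) (layer (not (colour i)))

    nb-Mono : ∀ i → Mono (not (colour i)) (nb i)
    nb-Mono i = All.filter⁺ (λ j → ¬? (commute? i j)) (layer-Mono _)

    nb-Unique : ∀ i → Unique (nb i)
    nb-Unique i = Unique.filter⁺ (λ j → ¬? (commute? i j)) (layer-Unique _)

    nb-Adj : ∀ {i j} → j ∈ nb i → Adj i j
    nb-Adj {i} j∈ = proj₂ (∈-filter⁻ (λ j → ¬? (commute? i j)) {xs = layer (not (colour i))} j∈)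

    Adj-colour : ∀ {i j} → Adj i j → colour j ≡ not (colour i)
    Adj-colour adj = Bool.¬-not (λ eq → adj (same-colour (sym eq)))

    ∈-nb : ∀ {i j} → Adj i j → j ∈ nb i
    ∈-nb {i} adj = ∈-filter⁺ (λ j → ¬? (commute? i j)) (∈-layer (Adj-colour adj)) adj

    -- A palindrome for the conjugate of `gen i` by its neighbours. Conjugation by the whole
    -- opposite layer gives the same element, but this word for it is reduced.
    star : I → List I
    star i = nb i ++ i ∷ nb i

    prod-star : ∀ i → prod (star i) ≡ prod (nb i) ∙ gen i ∙ prod (nb i)
    prod-star i = trans (prod-++ (nb i) _) (sym (assoc _ _ _))

    star-layer : ∀ i → prod (star i) ≡ L (not (colour i)) ∙ gen i ∙ L (not (colour i))
    star-layer i = trans (prod-star i) (sym (go (layer (not (colour i))) (layer-Mono _)))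
      where
      go : ∀ {c} ws → Mono c ws → prod ws ∙ gen i ∙ prod ws ≡
        prod (filter (λ j → ¬? (commute? i j)) ws) ∙ gen i ∙ prod (filter (λ j → ¬? (commute? i j)) ws)
      go [] _ = refl
      go (j ∷ ws) (cj ∷ mono) with commute? i j
      ... | yes com = trans (cong (λ z → gen j ∙ prod ws ∙ gen i ∙ z) (Mono-commute cj mono))
            (trans (solve (prod ws ∷ []) (i ∷ j ∷ []) (rf 1 ⊙ el 0 ⊙ rf 0 ⊙ (el 0 ⊙ rf 1)) (rf 1 ⊙ (el 0 ⊙ rf 0 ⊙ el 0) ⊙ rf 1) refl)
              (trans (cong (_∙ gen j) (commute-∙ (commute-∙ (Mono-commute cj mono) (sym com)) (Mono-commute cj mono)))
                (trans (∙gen∙gen _ j) (go ws mono))))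
      ... | no adj = trans (cong (λ z → gen j ∙ prod ws ∙ gen i ∙ z) (Mono-commute cj mono))
            (trans (solve (prod ws ∷ []) (i ∷ j ∷ []) (rf 1 ⊙ el 0 ⊙ rf 0 ⊙ (el 0 ⊙ rf 1)) (rf 1 ⊙ (el 0 ⊙ rf 0 ⊙ el 0) ⊙ rf 1) refl)
              (trans (cong (λ z → gen j ∙ z ∙ gen j) (go ws mono))
                (trans (solve (prod us ∷ []) (i ∷ j ∷ []) (rf 1 ⊙ (el 0 ⊙ rf 0 ⊙ el 0) ⊙ rf 1) (rf 1 ⊙ el 0 ⊙ rf 0 ⊙ (el 0 ⊙ rf 1)) refl)
                  (cong (λ z → gen j ∙ prod us ∙ gen i ∙ z) (sym (Mono-commute cj (All.filter⁺ (λ j → ¬? (commute? i j)) mono)))))))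
        where us = filter (λ j → ¬? (commute? i j)) ws

    -- Were a neighbour `j` a right descent after the neighbours and `i`, then conjugating `gen j`
    -- by `gen i` would give a generator, although this conjugate has length three.
    ℓ-star : ∀ i → ℓ (prod (star i)) ≡ length (star i)
    ℓ-star i = trans (cong ℓ (prod-star i)) (trans (Mono-ascend x (nb i) (nb-Mono i) (nb-Unique i) asc)
        (trans (cong (_+ℕ length (nb i)) len) (trans (sym (ℕ.+-suc (length (nb i)) (length (nb i)))) (sym (List.length-++ (nb i))))))
      where
      x = prod (nb i) ∙ gen i
      p = prod (nb i)
      i≢ : ∀ {j} → j ∈ nb i → gen i ≢ gen j
      i≢ j∈ eq = Adj-≢ (nb-Adj j∈) (gen-injective eq)
      De : ∀ j → D e j ≡ false
      De j = trans (cong (λ z → N z (gen j)) (inverse-unique (identityˡ e))) (N-e _)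
      x⁻¹ : x ⁻¹ ≡ gen i ∙ p
      x⁻¹ = trans (∙gen-⁻¹ p i) (cong (gen i ∙_) (Mono-⁻¹ (nb i) (nb-Mono i)))
      len-p : ℓ p ≡ length (nb i)
      len-p = trans (cong ℓ (sym (identityˡ p))) (trans (Mono-ascend e (nb i) (nb-Mono i) (nb-Unique i) (λ j _ → De j)) (cong (_+ℕ length (nb i)) ℓ-e))
      Np : N p (gen i) ≡ false
      Np = Bool.¬-not λ h → let (j , j∈ , eq) = Mono-N (nb i) (nb-Mono i) (gen i) h in i≢ j∈ eq
      len : ℓ x ≡ suc (length (nb i))
      len = trans (sym (ℓ-⁻¹ x)) (trans (cong ℓ x⁻¹) (trans (ℓ-asc p i Np) (cong suc len-p)))
      asc : ∀ j → j ∈ nb i → D x j ≡ false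
      asc j j∈ = trans (cong (λ z → N z (gen j)) x⁻¹) (trans (N-gen∙ i p (gen j))
        (cong₂ _xor_ (δ-≢ (λ eq → i≢ j∈ (sym eq))) (Bool.¬-not λ h → let (l , _ , eq) = Mono-N (nb i) (nb-Mono i) _ h in
          three≰one (ℕ.≤-trans (ℕ.≤-reflexive (trans (sym (ℓ-Reduced (aba-Reduced (nb-Adj j∈))))
            (cong ℓ (trans (solve [] (i ∷ j ∷ []) (rf 0 ⊙ (rf 1 ⊙ (rf 0 ⊙ ε))) (rf 0 ⁻ ⊙ rf 1 ⊙ rf 0) refl) eq)))) (ℓ-gen l)))))
        where
        three≰one : 3 ≤ 1 → ⊥
        three≰one (s≤s ())

    -- Propagation of intertwined pairs along edges

    module Propagate (k : ℕ) (red : ∀ c → Red c (suc k)) where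

      x : I → W
      x j = A (colour j) (suc k)

      intertwine : ∀ {j i} → Pair k j i → x j ∙ gen i ≡ gen j ∙ x j
      intertwine {j} {i} (ci , eq) = trans (cong (_∙ gen i) (A-suc (colour j) k)) (trans (assoc _ _ _) (trans (cong (L (colour j) ∙_) eq)
        (trans (sym (assoc _ _ _)) (trans (cong (_∙ A (not (colour j)) k) (sym (Mono-commute refl (layer-Mono (colour j)))))
          (trans (assoc _ _ _) (cong (gen j ∙_) (sym (A-suc (colour j) k))))))))

      -- x sᵢ = sⱼ x lifts to the stars of i and j because sᵢ commutes with the layer before the last one of x.
      intertwine-star : ∀ {j i} → Pair k j i → x j ∙ prod (star i) ≡ prod (star j) ∙ x j
      intertwine-star {j} {i} (ci , eq) = trans (cong₂ _∙_ (A-snoc cj k) (trans (star-layer i) (cong (λ c → L c ∙ gen i ∙ L c) d≡)))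
        (trans (solve (a ∷ L d ∷ []) (i ∷ []) (el 0 ⊙ el 1 ⊙ (el 1 ⊙ rf 0 ⊙ el 1)) (el 0 ⊙ (el 1 ⊙ el 1) ⊙ rf 0 ⊙ el 1) refl)
          (trans (cong (λ z → a ∙ z ∙ gen i ∙ L d) (L² d)) (trans (cong (λ z → z ∙ gen i ∙ L d) (identityʳ a))
            (trans (cong (_∙ L d) (inner k ci eq))
              (trans (assoc _ _ _) (cong₂ _∙_ (sym (star-layer j)) (sym (A-snoc cj k))))))))
        where
        cj = colour j
        d = last cj k
        a = A cj k
        d≡ : not (colour i) ≡ d
        d≡ = trans (cong not (trans ci (last-not cj k))) (Bool.not-involutive d)
        inner : ∀ k → colour i ≡ last cj (suc k) → A (not cj) k ∙ gen i ≡ gen j ∙ A (not cj) k →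
          A cj k ∙ gen i ≡ L (not cj) ∙ gen j ∙ L (not cj) ∙ A cj k
        inner zero    ci eq = ⊥-elim (Bool.not-¬ {cj} refl (trans (cong colour (sym i≡j)) ci))
          where
          i≡j : i ≡ j
          i≡j = gen-injective (trans (sym (identityˡ _)) (trans eq (identityʳ _)))
        inner (suc k) ci eq = trans (cong (_∙ gen i) (A-snoc cj k)) (trans (assoc _ _ _)
          (trans (cong (A cj k ∙_) (sym (Mono-commute (trans ci (last-2+ cj k)) (layer-Mono (last cj k)))))
            (trans (sym (assoc _ _ _)) (trans (cong (_∙ L (last cj k)) short) (trans (assoc _ _ _) (cong (L (not cj) ∙ gen j ∙ L (not cj) ∙_) (sym (A-snoc cj k))))))))
          where
          split : A (not cj) (suc k) ≡ L (not cj) ∙ A cj k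
          split = trans (A-suc (not cj) k) (cong (λ c → L (not cj) ∙ A c k) (Bool.not-involutive cj))
          short : A cj k ∙ gen i ≡ L (not cj) ∙ gen j ∙ L (not cj) ∙ A cj k
          short = trans (sym (cancelˡ (L² (not cj)) _)) (trans (cong (L (not cj) ∙_) (trans (sym (assoc _ _ _)) (trans (cong (_∙ gen i) (sym split)) (trans eq (cong (gen j ∙_) split)))))
            (solve (L (not cj) ∷ A cj k ∷ []) (j ∷ []) (el 0 ⊙ (rf 0 ⊙ (el 0 ⊙ el 1))) (el 0 ⊙ rf 0 ⊙ el 0 ⊙ el 1) refl))

      -- All letters of the star of `i` are right descents of `x j`: the neighbours because they
      -- belong to its final layer, and `i` because it is carried to the left descent `j`. So the
      -- star costs its full length.
      star-drop : ∀ {j i} → Pair k j i → ℓ (prod (star j) ∙ x j) +ℕ length (star i) ≡ ℓ (x j)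
      star-drop {j} {i} pair@(ci , _) = trans (cong₂ _+ℕ_ (cong ℓ (sym (intertwine-star pair))) (sym (ℓ-star i)))
          (Maximal-ℓ (x j) max (star i) (All.++⁺ nbs (inj₁ refl ∷ nbs)))
        where
        P : I → Set
        P l = l ≡ i ⊎ l ∈ nb i
        open Parabolic P (λ l → (l Fin.≟ i) ⊎-dec (l ∈? nb i))
        nbs : All P (nb i)
        nbs = All.tabulate inj₂
        max : Maximal (x j)
        max l (inj₁ refl) = shorter⇒D (x j) i (subst (_< ℓ (x j)) (cong ℓ (sym (intertwine pair)))
          (N⇒shorter (x j) (gen j) (left-desc (colour j) k j (red _) refl)))
        max l (inj₂ l∈)   = right-desc (colour j) k l (red _)
          (trans (All.lookup (nb-Mono i) l∈) (trans (cong not (trans ci (last-not (colour j) k))) (Bool.not-involutive _)))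

      -- The star of `j` cannot shorten `x j` by more letters than it has. By `Pair-sym` the reverse
      -- inequality holds as well.
      star-≤ : ∀ {j i} → Pair k j i → length (star i) ≤ length (star j)
      star-≤ {j} {i} pair = ℕ.+-cancelˡ-≤ (ℓ (prod (star j) ∙ x j)) _ _ (ℕ.≤-trans (ℕ.≤-reflexive (star-drop pair))
        (ℕ.≤-trans (ℕ.≤-reflexive (cong ℓ (solve (prod (star j) ∷ x j ∷ []) [] (el 1) (el 0 ⁻ ⊙ (el 0 ⊙ el 1)) refl)))
          (ℕ.≤-trans (ℓ-∙ _ _) (ℕ.≤-trans (ℕ.+-monoˡ-≤ _ (ℕ.≤-trans (ℕ.≤-reflexive (ℓ-⁻¹ _)) (ℓ≤length (star j) refl))) (ℕ.≤-reflexive (ℕ.+-comm (length (star j)) _))))))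

      -- Since the two stars are equally long, `x j` begins with the whole star of `j`, and any
      -- neighbour of `j` can be taken as the outermost letter of this palindrome.
      neighbour-desc : ∀ {j i l} → Pair k j i → Adj j l → N (x j) (gen l) ≡ true
      neighbour-desc {j} {i} {l} pair adj with Mono-remove (nb j) (nb-Mono j) (∈-nb adj)
      ... | us , _ , _ , eq , len = shorter⇒N (x j) l (ℕ.≤-trans (s≤s (ℕ.≤-trans (ℕ.≤-reflexive (cong ℓ factor)) (ℕ.≤-trans (ℓ-∙ _ _) (ℕ.+-monoˡ-≤ _ short))))
          (ℕ.≤-reflexive (trans (cong (_+ℕ ℓ (prod (star j) ∙ x j)) size) (trans (ℕ.+-comm (length (star j)) _)
            (trans (cong (ℓ (prod (star j) ∙ x j) +ℕ_) (ℕ.≤-antisym (star-≤ (Pair-sym k pair)) (star-≤ pair))) (star-drop pair))))))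
        where
        ws = nb j ++ j ∷ us
        ws≡ : prod (star j) ≡ prod ws ∙ gen l
        ws≡ = trans (prod-++ (nb j) _) (trans (cong (λ z → prod (nb j) ∙ (gen j ∙ z)) eq)
          (trans (solve (prod (nb j) ∷ prod us ∷ []) (j ∷ l ∷ []) (el 0 ⊙ (rf 0 ⊙ (el 1 ⊙ rf 1))) (el 0 ⊙ (rf 0 ⊙ el 1) ⊙ rf 1) refl)
            (cong (_∙ gen l) (sym (prod-++ (nb j) _)))))
        factor : gen l ∙ x j ≡ prod ws ⁻¹ ∙ (prod (star j) ∙ x j)
        factor = trans (solve (prod ws ∷ x j ∷ []) (l ∷ []) (rf 0 ⊙ el 1) (el 0 ⁻ ⊙ (el 0 ⊙ rf 0 ⊙ el 1)) refl)
          (cong (λ z → prod ws ⁻¹ ∙ (z ∙ x j)) (sym ws≡))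
        short : ℓ (prod ws ⁻¹) ≤ length ws
        short = ℕ.≤-trans (ℕ.≤-reflexive (ℓ-⁻¹ _)) (ℓ≤length ws refl)
        size : suc (length ws) ≡ length (star j)
        size = trans (cong suc (List.length-++ (nb j))) (trans (sym (ℕ.+-suc (length (nb j)) _))
          (trans (cong (λ n → length (nb j) +ℕ suc n) len) (sym (List.length-++ (nb j)))))

      -- The left descent `l` of `x j` is no descent of its first `k` layers, because putting the
      -- layer of `l` in front of them is reduced. So it is crossed within the final layer, where
      -- all reflections crossed are generators.
      propagate : ∀ {j i l} → Pair k j i → Adj j l → ∃[ r ] Pair k l r
      propagate {j} {i} {l} pair adj = finish (Mono-N (layer d) (layer-Mono d) (conj a (gen l)) inLast)
        where
        cj = colour j
        d = last cj k
        a = A cj k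
        cl : colour l ≡ not cj
        cl = Adj-colour adj
        first : N a (gen l) ≡ false
        first = subst (λ c → N (A c k) (gen l) ≡ false) (Bool.not-involutive cj) (left-asc (not cj) k l (red _) cl)
        inLast : N (L d) (conj a (gen l)) ≡ true
        inLast = trans (cong (_xor N (L d) (conj a (gen l))) (sym first)) (trans (sym (N-∙ a (L d) (gen l)))
          (trans (cong (λ z → N z (gen l)) (sym (A-snoc cj k))) (neighbour-desc pair adj)))
        finish : ∃[ r ] r ∈ layer d × conj a (gen l) ≡ gen r → ∃[ r ] Pair k l r
        finish (r , r∈ , eq) = r , trans (All.lookup (layer-Mono d) r∈) (sym (trans (cong (λ c → last c (suc k)) cl) (last-2+ cj k))) ,
          subst (λ c → A c k ∙ gen r ≡ gen l ∙ A c k) (sym (trans (cong not cl) (Bool.not-involutive cj)))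
            (trans (cong (a ∙_) (sym eq)) (solve (a ∷ []) (l ∷ []) (el 0 ⊙ (el 0 ⁻ ⊙ rf 0 ⊙ el 0)) (rf 0 ⊙ el 0) refl))

      -- Some letter `i` of the next layer is already a right descent. The layers after the first
      -- can be extended by `i`, so its reflection is crossed in the first layer and comes from a
      -- generator `j` there.
      firstPair : ∀ c → ¬ Red c (suc (suc k)) → ∃[ j ] ∃[ i ] Pair k j i
      firstPair c ¬red with Fin.any? (λ i → (colour i Bool.≟ last c (suc k)) ×-dec (D (A c (suc k)) i Bool.≟ true))
      ... | no none = ⊥-elim (¬red (Red-extend c (suc k) (red c) λ i ci → Bool.¬-not λ d → none (i , ci , d)))
      ... | yes (i , ci , d) with Mono-N (layer c) (layer-Mono c) (i ^[ A c (suc k) ]) inFirst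
        where
        y = A (not c) k
        inFirst : N (L c) (i ^[ A c (suc k) ]) ≡ true
        inFirst = trans (sym (Bool.xor-identityʳ _)) (trans (cong (N (L c) (i ^[ A c (suc k) ]) xor_)
            (sym (trans (cong (N y) (trans (cong (λ z → conj (L c) (i ^[ z ])) (A-suc c k))
              (solve (L c ∷ y ∷ []) (i ∷ []) (el 0 ⁻ ⊙ (el 0 ⊙ el 1 ⊙ rf 0 ⊙ (el 0 ⊙ el 1) ⁻) ⊙ el 0) (el 1 ⊙ rf 0 ⊙ el 1 ⁻) refl)))
              (trans (sym (D≡N y i)) (right-asc (not c) k i (red _) ci)))))
          (trans (sym (N-∙ (L c) y _)) (trans (cong (λ z → N z (i ^[ A c (suc k) ])) (sym (A-suc c k))) (trans (sym (D≡N _ i)) d))))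
      ...   | j , j∈ , eq = j , i , subst (λ c → colour i ≡ last c (suc k)) (sym cj) ci ,
            subst (λ c → A (not c) k ∙ gen i ≡ gen j ∙ A (not c) k) (sym cj) conclude
        where
        y = A (not c) k
        cj : colour j ≡ c
        cj = All.lookup (layer-Mono c) j∈
        conclude : y ∙ gen i ≡ gen j ∙ y
        conclude = trans (solve (L c ∷ y ∷ []) (i ∷ []) (el 1 ⊙ rf 0) (el 0 ⁻ ⊙ (el 0 ⊙ el 1 ⊙ rf 0 ⊙ (el 0 ⊙ el 1) ⁻) ⊙ el 0 ⊙ el 1) refl)
          (trans (cong (λ z → L c ⁻¹ ∙ z ∙ L c ∙ y) (trans (cong (i ^[_]) (sym (A-suc c k))) eq))
            (cong (_∙ y) (trans (assoc _ _ _) (trans (cong (L c ⁻¹ ∙_) (Mono-commute cj (layer-Mono c))) (cancelˡ (inverseˡ (L c)) (gen j))))))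

      Pair? : ∀ j i → Dec (Pair k j i)
      Pair? j i = (colour i Bool.≟ last (colour j) (suc k)) ×-dec (A (not (colour j)) k ∙ gen i ≟ gen j ∙ A (not (colour j)) k)

      allPairs : Irreducible → ∃[ j ] ∃[ i ] Pair k j i → ∀ j → ∃[ i ] Pair k j i
      allPairs irr (j₀ , pair₀) j with Fin.any? (Pair? j)
      ... | yes pair = pair
      ... | no none = ⊥-elim (proj₂ irr (paired , (j₀ , dec-true (Fin.any? (Pair? j₀)) pair₀) , (j , dec-false (Fin.any? (Pair? j)) none) , separated))
        where
        paired : I → Bool
        paired l = does (Fin.any? (Pair? l))
        separated : ∀ l r → paired l ≡ true → paired r ≡ false → Commute (gen l) (gen r)
        separated l r pl pr with Fin.any? (Pair? l)
        separated l r pl pr | yes (i , pair) = ¬Adj⇒Commute λ adj → true≢false (dec-true (Fin.any? (Pair? r)) (propagate pair adj)) pr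
        separated l r () pr | no _

      -- Letters of the first layer are descents by reducedness. One of the other colour is carried
      -- by its pair through the first `k` layers to a letter of the final layer, where it cancels.
      longest : Irreducible → ∃[ j ] ∃[ i ] Pair k j i → ∀ c i → N (A c (suc k)) (gen i) ≡ true
      longest irr pair c i with colour i Bool.≟ c
      ... | yes ci = left-desc c k i (red c) ci
      ... | no  ci with allPairs irr pair i
      ...   | r , cr , eq = shorter⇒N (A c (suc k)) i (delete-last c k _ r (red c) cr′
              (trans (cong (gen i ∙_) (A-snoc c k)) (trans (sym (assoc _ _ _)) (trans (cong (_∙ L (last c k)) (sym eq′)) (assoc _ _ _)))))
        where
        ci′ : colour i ≡ not c
        ci′ = Bool.¬-not ci
        cr′ : colour r ≡ last c k
        cr′ = trans cr (trans (cong (λ d → last d (suc k)) ci′) (last-2+ c k))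
        eq′ : A c k ∙ gen r ≡ gen i ∙ A c k
        eq′ = subst (λ d → A d k ∙ gen r ≡ gen i ∙ A d k) (trans (cong not ci′) (Bool.not-involutive c)) eq

    ∃-longest : Irreducible → ∀ k →
      (∀ c → Red c (suc k)) ⊎ (∃[ n ] n ≤ suc k × (∀ c i → N (A c n) (gen i) ≡ true))
    ∃-longest irr zero = inj₁ Red-1
    ∃-longest irr (suc k) with ∃-longest irr k
    ... | inj₂ (n , n≤ , max) = inj₂ (n , ℕ.m≤n⇒m≤1+n n≤ , max)
    ... | inj₁ red with ℓ (A true (suc (suc k))) ℕ.≟ length (alt true (suc (suc k))) | ℓ (A false (suc (suc k))) ℕ.≟ length (alt false (suc (suc k)))
    ...   | yes r₁ | yes r₂ = inj₁ λ { true → r₁ ; false → r₂ }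
    ...   | no ¬r  | _      = inj₂ (suc k , ℕ.n≤1+n _ , longest irr (firstPair true ¬r))
      where open Propagate k red
    ...   | yes _  | no ¬r  = inj₂ (suc k , ℕ.n≤1+n _ , longest irr (firstPair false ¬r))
      where open Propagate k red

    A-+ : ∀ c k l → A c (k +ℕ l) ≡ A c k ∙ A (last c k) l
    A-+ c zero    l = sym (identityˡ _)
    A-+ c (suc k) l = trans (A-suc c (k +ℕ l)) (trans (cong (L c ∙_) (A-+ (not c) k l)) (trans (sym (assoc _ _ _)) (cong (_∙ A (last c (suc k)) l) (sym (A-suc c k)))))

    A-pow : ∀ k → A true (k +ℕ k) ≡ (L true ∙ L false) ^ k
    A-pow zero    = refl
    A-pow (suc k) = trans (cong (λ n → A true (suc n)) (ℕ.+-suc k k)) (trans (A-suc true (suc (k +ℕ k))) (trans (cong (L true ∙_) (A-suc false (k +ℕ k)))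
      (trans (sym (assoc _ _ _)) (cong (L true ∙ L false ∙_) (A-pow k)))))

    -- The inverse of `A true (suc k)` is its reversal, and also the second half of the trivial word
    -- with twice as many layers. These two start with opposite colours.
    A-half : ∀ k → (L true ∙ L false) ^ suc k ≡ e → A true (suc k) ≡ A false (suc k)
    A-half k eq = lemma (last true k) half
      where
      half : A (last true k) (suc k) ≡ A (not (last true k)) (suc k)
      half = trans (sym (A-⁻¹ true k)) (trans (inverse-unique (trans (sym (A-+ true (suc k) (suc k))) (trans (A-pow (suc k)) eq)))
        (cong (λ c → A c (suc k)) (last-not true k)))
      lemma : ∀ c → A c (suc k) ≡ A (not c) (suc k) → A true (suc k) ≡ A false (suc k)
      lemma true  p = p
      lemma false p = sym p

    alternating-longest : Irreducible → ∀ k → (L true ∙ L false) ^ suc k ≡ e →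
      ∃[ n ] n ≤ suc k × (∀ c i → N (A c n) (gen i) ≡ true)
    alternating-longest irr k eq with ∃-longest irr k
    ... | inj₂ found = found
    ... | inj₁ red = suc k , ℕ.≤-refl , max
      where
      byColour : ∀ i c → colour i ≡ c → N (A c (suc k)) (gen i) ≡ true
      byColour i c ci = left-desc c k i (red c) ci
      transfer : ∀ c d → A c (suc k) ≡ A d (suc k)
      transfer true  true  = refl
      transfer true  false = A-half k eq
      transfer false true  = sym (A-half k eq)
      transfer false false = refl
      max : ∀ c i → N (A c (suc k)) (gen i) ≡ true
      max c i = subst (λ w → N w (gen i) ≡ true) (transfer (colour i) c) (byColour i (colour i) refl)

    -- Crossing out layers of an alternating word

    Sub : List I → W → Set
    Sub Q w = ∃[ us ] us ⊆ Q × prod us ≡ w ⁻¹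

    -- The inverse in `Sub` turns right descents of `x` into left inversions of the product of the
    -- subword, to which `exchange` applies; layers are therefore crossed out at the front of `Q`.
    Sub-desc : ∀ {Q x} i → Sub Q x → D x i ≡ true → Sub Q (x ∙ gen i)
    Sub-desc {x = x} i (us , us⊆ , eq) d with exchange us (gen i) (subst (λ z → N z (gen i) ≡ true) (sym eq) d)
    ... | vs , vs⊆ , eq′ , _ = vs , ⊆-trans vs⊆ us⊆ , trans eq′ (trans (cong (gen i ∙_) eq) (sym (∙gen-⁻¹ x i)))

    Sub-⊑ : ∀ {Q} n x y → ℓ x ≤ n → y ⊑ x → Sub Q x → Sub Q y
    Sub-⊑ n x y bound y⊑x sub with y ≟ x
    ... | yes refl = sub
    ... | no y≢x = go n bound (below-descent y x y⊑x y≢x)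
      where
      go : ∀ n → ℓ x ≤ n → ∃[ i ] D x i ≡ true × y ⊑ x ∙ gen i → Sub _ y
      go zero    b (i , d , _) = ⊥-elim (ℕ.n≮0 (ℕ.≤-trans (ℕ.≤-reflexive (ℓ-descʳ x i d)) b))
      go (suc n) b (i , d , le) = Sub-⊑ n (x ∙ gen i) y (s≤s⁻¹ (ℕ.≤-trans (ℕ.≤-reflexive (ℓ-descʳ x i d)) b)) le (Sub-desc i sub d)

    -- For commuting letters the second descent removes the same reflection whether or not the first
    -- has been made, and `y` does not have it as an inversion.
    ⊑-square : ∀ {i j} y z → i ≢ j → Commute (gen i) (gen j) → D z j ≡ true → y ⊑ z ∙ gen i → y ⊑ z ∙ gen j → y ⊑ z ∙ gen i ∙ gen j
    ⊑-square {i} {j} y z i≢j com dj yi yj t h = trans (N-∙gen (z ∙ gen i) j t) (cong₂ _xor_ (yi t h) (δ-≢ t≢))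
      where
      same : j ^[ z ∙ gen i ] ≡ j ^[ z ]
      same = trans (solve (z ∷ []) (i ∷ j ∷ []) (el 0 ⊙ rf 0 ⊙ rf 1 ⊙ (el 0 ⊙ rf 0) ⁻) (el 0 ⊙ (rf 0 ⊙ rf 1 ⊙ rf 0) ⊙ el 0 ⁻) refl)
        (cong (λ w → z ∙ w ∙ z ⁻¹) (trans (cong (_∙ gen i) com) (∙gen∙gen (gen j) i)))
      t≢ : t ≢ j ^[ z ∙ gen i ]
      t≢ eq = true≢false (yj t h) (trans (N-∙gen z j t) (trans (cong₂ _xor_ (trans (cong (N z) (trans eq same)) (trans (sym (D≡N z j)) dj)) (δ-refl (trans eq same))) refl))

    -- Crossing out a layer of commuting letters costs no more than one step below all descents.
    Sub-layer : ∀ {c Q} B → Mono c B → ∀ y z → y ⊑ z → (∀ i → i ∈ B → D z i ≡ true → y ⊑ z ∙ gen i) → Sub (B ++ Q) z → Sub Q y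
    Sub-layer [] _ y z y⊑z _ sub = Sub-⊑ (ℓ z) z y ℕ.≤-refl y⊑z sub
    Sub-layer {c} {Q} (b ∷ B) (cb ∷ mono) y z y⊑z h sub with D z b in d
    ... | false = Sub-layer B mono y z y⊑z (λ i i∈ → h i (there i∈)) (skip sub)
      where
      skip : Sub (b ∷ B ++ Q) z → Sub (B ++ Q) z
      skip (us , .b ∷ʳ us⊆ , eq) = us , us⊆ , eq
      skip (.b ∷ us , refl ∷ us⊆ , eq)
        with exchange us (gen b) (subst (λ w → N w (gen b) ≡ true) (trans (cong (gen b ∙_) (sym eq)) (cancelˡ (gen² b) _)) (trans (N-gen∙-self b (z ⁻¹)) (cong not d)))
      ... | vs , vs⊆ , eq′ , _ = vs , ⊆-trans vs⊆ us⊆ , trans eq′ eq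
    ... | true = Sub-layer B mono y (z ∙ gen b) (h b (here refl) d) h′ (drop sub)
      where
      drop : Sub (b ∷ B ++ Q) z → Sub (B ++ Q) (z ∙ gen b)
      drop (us , .b ∷ʳ us⊆ , eq) = Sub-desc b (us , us⊆ , eq) d
      drop (.b ∷ us , refl ∷ us⊆ , eq) = us , us⊆ , trans (sym (cancelˡ (gen² b) _)) (trans (cong (gen b ∙_) eq) (sym (∙gen-⁻¹ z b)))
      h′ : ∀ i → i ∈ B → D (z ∙ gen b) i ≡ true → y ⊑ z ∙ gen b ∙ gen i
      h′ i i∈ di with b Fin.≟ i
      ... | yes refl = ⊥-elim (true≢false di (trans (cong (λ w → N w (gen b)) (∙gen-⁻¹ z b)) (trans (N-gen∙-self b (z ⁻¹)) (cong not d))))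
      ... | no b≢i = ⊑-square y z b≢i com dzi (h b (here refl) d) (h i (there i∈) dzi)
        where
        com = same-colour (trans cb (sym (All.lookup mono i∈)))
        dzi = trans (sym (D-commute z b≢i com)) di

    Sub-step : ∀ c k x y → Sub (alt c (suc k)) x → y ⊑ x → (∀ i → D x i ≡ true → y ⊑ x ∙ gen i) → Sub (alt (not c) k) y
    Sub-step c k x y sub y⊑x h = Sub-layer (layer c) (layer-Mono c) y x y⊑x (λ i _ → h i) sub

    Sub-both : ∀ w → (∀ c → Sub (alt c 1) w) → w ≡ e
    Sub-both w sub = trans (sym (⁻¹-involutive w)) (trans (cong _⁻¹ (decidable-stable (w ⁻¹ ≟ e) nontrivial)) (inverse-unique (identityˡ e)))
      where
      ofColour : ∀ c t → N (w ⁻¹) t ≡ true → ∃[ i ] colour i ≡ c × t ≡ gen i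
      ofColour c t h =
        let (us , us⊆ , eq)  = sub c
            mono             = All-resp-⊆ us⊆ (subst (Mono c) (sym (List.++-identityʳ (layer c))) (layer-Mono c))
            (i , i∈ , t≡)    = Mono-N us mono t (trans (cong (λ z → N z t) eq) h)
        in i , All.lookup mono i∈ , t≡
      nontrivial : ¬ (w ⁻¹ ≢ e)
      nontrivial w≢e with leftDescent (w ⁻¹) w≢e
      ... | i , h with ofColour true (gen i) h | ofColour false (gen i) h
      ...   | a , ca , ea | b , cb , eb = true≢false ca (trans (cong colour (gen-injective (trans (sym ea) eb))) cb)

    Sub-all : ∀ n k → n ≤ k → (∀ c i → N (A c n) (gen i) ≡ true) → ∀ c w → Sub (alt c k) w
    Sub-all n k n≤k max c w = Sub-⊑ (ℓ x) x w ℕ.≤-refl (maximal-⊑ x (invMax n max) w) (alt c n , alt-⊆ c n k n≤k , sym (⁻¹-involutive _))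
      where
      x = A c n ⁻¹
      alt-⊆ : ∀ c n k → n ≤ k → alt c n ⊆ alt c k
      alt-⊆ c zero    k       _         = empty (alt c k)
        where
        empty : ∀ (l : List I) → [] ⊆ l
        empty []      = []
        empty (x ∷ l) = x ∷ʳ empty l
      alt-⊆ c (suc n) (suc k) (s≤s n≤k) = append (layer c) (alt-⊆ (not c) n k n≤k)
        where
        append : ∀ (l : List I) {us vs} → us ⊆ vs → l ++ us ⊆ l ++ vs
        append []      p = p
        append (_ ∷ l) p = refl ∷ append l p
      invMax : ∀ n → (∀ c i → N (A c n) (gen i) ≡ true) → ∀ i → N (A c n ⁻¹) (gen i) ≡ true
      invMax zero    max i = ⊥-elim (true≢false (max c i) (N-e _))
      invMax (suc n) max i = trans (cong (λ z → N z (gen i)) (A-⁻¹ c n)) (max (last c n) i)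

  -- Least elements of fibres and orbits of pop

  module Quotient (L : FiniteLattice) (f : W → FiniteLattice.Carrier L) (quotient : IsLatticeQuotientMap C L f) where
    open FiniteLattice L renaming (_⊑_ to _≼_)
    open LatticeOps L
    open IsLattice isLattice using (x≤x∨y; x∧y≤x; x∧y≤y; ∧-greatest; ∨-least)
      renaming (refl to ≼-refl; trans to ≼-trans; antisym to ≼-antisym)

    _≟L_ = enumerated⇒≟ elems allElems

    surjective : ∀ x → ∃[ w ] f w ≡ x
    surjective = proj₁ quotient

    f-meet : ∀ {u w z} → IsMeet u w z → f z ≡ f u ⊓ f w
    f-meet {u} {w} {z} (zu , zw , max) = proj₁ (proj₂ quotient) u w z
      (⊑⇒≤w zu , ⊑⇒≤w zw , λ y yu yw → ⊑⇒≤w (max y (≤w⇒⊑ yu) (≤w⇒⊑ yw)))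

    f-mono : ∀ {u w} → u ⊑ w → f u ≼ f w
    f-mono {u} {w} u⊑w = subst (_≼ f w) (sym (f-meet {u} {w} {u} ((λ _ h → h) , u⊑w , λ _ p _ → p))) (x∧y≤y (f u) (f w))

    ⊓-absorb : ∀ {x y} → x ≼ y → x ⊓ y ≡ x
    ⊓-absorb {x} {y} x≼y = ≼-antisym (x∧y≤x x y) (∧-greatest ≼-refl x≼y)

    Least : Carrier → W → Set
    Least x w = f w ≡ x × (∀ u → f u ≡ x → w ⊑ u)

    least : ∀ x → ∃[ w ] Least x w
    least x = let (w , fw , min) = go elemsW in w , fw , λ u → min u (allW u)
      where
      go : ∀ us → ∃[ w ] f w ≡ x × (∀ u → u ∈ us → f u ≡ x → w ⊑ u)
      go [] = let (w , fw) = surjective x in w , fw , λ u ()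
      go (a ∷ us) with f a ≟L x | go us
      ... | no fa≢x | w , fw , min = w , fw , λ { u (here refl) fu → ⊥-elim (fa≢x fu) ; u (there u∈) fu → min u u∈ fu }
      ... | yes fa  | w , fw , min with meet w a
      ...   | z , m@(zw , za , _) = z , trans (f-meet m) (trans (cong₂ _⊓_ fw fa) (⊓-absorb ≼-refl)) ,
              λ { u (here refl) _ → za ; u (there u∈) fu → λ t h → min u u∈ fu t (zw t h) }

    -- An element between the two is the image of some `u` below `w`, and `w` has just one inversion
    -- `t` more than `w ∙ gen i`. If `u` lacks `t`, it lies below `w ∙ gen i`; otherwise its join
    -- with `w ∙ gen i` is `w`. Strictness is the minimality of `w` in its fibre.
    descent-cover : ∀ {x w} i → Least x w → D w i ≡ true → f (w ∙ gen i) ⋖ x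
    descent-cover {x} {w} i (fw , min) d = below , strict , between
      where
      t = i ^[ w ]
      Nwt : N w t ≡ true
      Nwt = trans (sym (D≡N w i)) d
      below : f (w ∙ gen i) ≼ x
      below = subst (f (w ∙ gen i) ≼_) fw (f-mono (⊑-desc w i d))
      strict : f (w ∙ gen i) ≢ x
      strict eq = true≢false (min (w ∙ gen i) eq t Nwt) (trans (N-∙gen w i t) (cong₂ _xor_ Nwt (δ-refl refl)))
      without-t : ∀ {u} → u ⊑ w → N u t ≡ false → u ⊑ w ∙ gen i
      without-t u⊑w Nut s h = trans (N-∙gen w i s) (trans (cong₂ _xor_ (u⊑w s h) (δ-≢ λ { refl → true≢false h Nut })) refl)
      with-t : ∀ {y} → w ∙ gen i ⊑ y → N y t ≡ true → w ⊑ y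
      with-t ws⊑y Nyt s h with s ≟ t
      ... | yes refl = Nyt
      ... | no  s≢t  = ws⊑y s (trans (N-∙gen w i s) (trans (cong₂ _xor_ h (δ-≢ s≢t)) refl))
      between : ∀ z → f (w ∙ gen i) ≼ z → z ≼ x → z ≡ f (w ∙ gen i) ⊎ z ≡ x
      between z lo hi with surjective z
      ... | a , fa with meet a w
      ...   | u , m@(_ , u⊑w , _) = decide (N u t) refl
        where
        fu : f u ≡ z
        fu = trans (f-meet m) (trans (cong₂ _⊓_ fa fw) (⊓-absorb hi))
        decide : ∀ b → N u t ≡ b → z ≡ f (w ∙ gen i) ⊎ z ≡ x
        decide false Nut = inj₁ (≼-antisym (subst (_≼ f (w ∙ gen i)) fu (f-mono (without-t u⊑w Nut))) lo)
        decide true  Nut = inj₂ (sym (trans (sym fw) (trans join (trans (cong (_⊔ f (w ∙ gen i)) fu) (≼-antisym (∨-least ≼-refl lo) (x≤x∨y z _))))))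
          where
          join : f w ≡ f u ⊔ f (w ∙ gen i)
          join = proj₂ (proj₂ quotient) u (w ∙ gen i) w
            (⊑⇒≤w u⊑w , ⊑⇒≤w (⊑-desc w i d) , λ y uy wy → ⊑⇒≤w (with-t (≤w⇒⊑ wy) (≤w⇒⊑ uy t Nut)))

    pop-least : ∀ {x w p v} → Least x w → IsPop x p → Least p v → v ⊑ w × (∀ i → D w i ≡ true → v ⊑ w ∙ gen i)
    pop-least {x} {w} {p} {v} lw@(fw , _) (p≼x , p≼covers , _) (fv , min) =
        below w (subst (p ≼_) (sym fw) p≼x) , λ i d → below (w ∙ gen i) (p≼covers _ (descent-cover i lw d))
      where
      below : ∀ a → p ≼ f a → v ⊑ a
      below a p≼fa with meet v a
      ... | z , m@(_ , z⊑a , _) = λ t h → z⊑a t (min z (trans (f-meet m) (trans (cong (_⊓ f a) fv) (⊓-absorb p≼fa))) t h)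

    bottom : ∀ x → f e ≼ x
    bottom x = let (w , fw) = surjective x in subst (f e ≼_) fw (f-mono λ t h → ⊥-elim (true≢false h (N-e t)))

    pop-unique : ∀ {x p q} → IsPop x p → IsPop x q → p ≡ q
    pop-unique (p≼ , p-lb , p-max) (q≼ , q-lb , q-max) = ≼-antisym (q-max _ p≼ p-lb) (p-max _ q≼ q-lb)

    steps : ∀ {x z} → InOrbit x z → ℕ
    steps here       = 0
    steps (next o _) = suc (steps o)

    steps-unique : ∀ {x y z} (o : InOrbit x y) (o′ : InOrbit x z) → steps o ≡ steps o′ → y ≡ z
    steps-unique here       here        _  = refl
    steps-unique (next o p) (next o′ q) eq with steps-unique o o′ (ℕ.suc-injective eq)
    ... | refl = pop-unique p q

    module Orbit (colour : I → Bool) (same-colour : ∀ {i j} → colour i ≡ colour j → Commute (gen i) (gen j))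
      (k : ℕ) (all : ∀ c w → Bipartition.Sub colour same-colour (Bipartition.alt colour same-colour c (suc k)) w) where
      open Bipartition colour same-colour

      orbit-Sub : ∀ {x z} (o : InOrbit x z) n → steps o +ℕ n ≡ suc k → ∃[ w ] Least z w × (∀ c → Sub (alt c n) w)
      orbit-Sub {x} here n eq = let (w , lw) = least x in w , lw , λ c → subst (λ n → Sub (alt c n) w) (sym eq) (all c w)
      orbit-Sub (next {z} {p} o isPop) n eq =
        let (w , lw , sub) = orbit-Sub o (suc n) (trans (ℕ.+-suc (steps o) n) eq)
            (v , lv)       = least p
            (v⊑w , covers) = pop-least lw isPop lv
        in v , lv , λ c → subst (λ d → Sub (alt d n) v) (Bool.not-involutive c) (Sub-step (not c) n w v (sub (not c)) v⊑w covers)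

      orbit-bottom : ∀ {x z} (o : InOrbit x z) → k ≤ steps o → z ≡ f e
      orbit-bottom o k≤ with ℕ.m≤n⇒m<n∨m≡n k≤
      orbit-bottom o k≤ | inj₂ k≡ with orbit-Sub o 1 (trans (ℕ.+-comm (steps o) 1) (cong suc (sym k≡)))
      ... | w , (fw , _) , sub = trans (sym fw) (cong f (Sub-both w sub))
      orbit-bottom (next o (p≼z , _)) k≤ | inj₁ (s≤s k≤′) with orbit-bottom o k≤′
      ... | refl = ≼-antisym p≼z (bottom _)

      -- Here `suc k` is the Coxeter number. From step `k` on the orbit stays at `f e`, so the
      -- number of steps, cut off at `k`, determines the element and has `suc k` possible values.
      orbit-size : ∀ x → OrbitSizeAtMost x (suc k)
      orbit-size x n g g-inj inOrbit = Fin.injective⇒≤ {f = position} position-injective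
        where
        position : Fin n → Fin (suc k)
        position i = fromℕ< (s≤s (ℕ.m⊓n≤n (steps (inOrbit i)) k))
        position-injective : ∀ {i j} → position i ≡ position j → i ≡ j
        position-injective {i} {j} eq = g-inj (cases (ℕ.≤-total k (steps oi)) (ℕ.≤-total k (steps oj)))
          where
          oi = inOrbit i
          oj = inOrbit j
          same : steps oi ⊓ℕ k ≡ steps oj ⊓ℕ k
          same = Fin.fromℕ<-injective _ _ _ _ eq
          cases : k ≤ steps oi ⊎ steps oi ≤ k → k ≤ steps oj ⊎ steps oj ≤ k → g i ≡ g j
          cases (inj₁ a) (inj₁ b) = trans (orbit-bottom oi a) (sym (orbit-bottom oj b))
          cases (inj₂ a) (inj₂ b) = steps-unique oi oj (trans (sym (ℕ.m≤n⇒m⊓n≡m a)) (trans same (ℕ.m≤n⇒m⊓n≡m b)))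
          cases (inj₁ a) (inj₂ b) = trans (orbit-bottom oi a) (sym (orbit-bottom oj
            (ℕ.≤-reflexive (trans (sym (ℕ.m≥n⇒m⊓n≡n a)) (trans same (ℕ.m≤n⇒m⊓n≡m b))))))
          cases (inj₂ a) (inj₁ b) = trans (orbit-bottom oi (ℕ.≤-reflexive (trans (sym (ℕ.m≥n⇒m⊓n≡n b)) (trans (sym same) (ℕ.m≤n⇒m⊓n≡m a)))))
            (sym (orbit-bottom oj b))

    bound : Irreducible → ∀ h → CoxeterNumber h → ∀ x → OrbitSizeAtMost x h
    bound irr zero    (() , _)
    bound irr (suc k) (_ , order , _) =
      let (colour , same , conjugate) = ∃-bipartition
          (n , n≤ , max) = Bipartition.alternating-longest colour same irr k (Conj-pow (suc k) conjugate order)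
      in Orbit.orbit-size colour same k (Bipartition.Sub-all colour same n (suc k) n≤ max)

theorem9p6 : (C : FiniteCoxeterSystem) → Coxeter.Irreducible C →
    (h : ℕ) → Coxeter.CoxeterNumber C h →
    (L : FiniteLattice) (f : FiniteCoxeterSystem.W C → FiniteLattice.Carrier L) →
    IsLatticeQuotientMap C L f →
    ∀ x → LatticeOps.OrbitSizeAtMost L x h
theorem9p6 C irreducible h coxeterNumber L f quotient =
  CoxeterGroup.Quotient.bound C L f quotient irreducible h coxeterNumber
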